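{- There is a randomized distributed algorithm in the LOCAL model that, on any $n$-node tree, computes a $2$-ruling set in $O(\log\log n)$ rounds with high probability.
   Context: LOCAL model: the input graph $G=(V,E)$ with $|V|=n$ is the communication network; computation proceeds in synchronous rounds, in each round every node can send an arbitrarily large message to each neighbor and perform arbitrary local computation; initially each node knows only its neighbors, and at the end each node must know its own output (here, whether it belongs to the computed set). The running time is the number of rounds. A $\beta$-ruling set of $G$ is a set $S\subseteq V$ that is independent (no two nodes of $S$ are adjacent) and such that every node of $V$ is at distance at most $\beta$ (in $G$) from some node of $S$. "With high probability" means with probability at least $1-n^{ -c}$ for some constant $c>1$. -}

module Defs where

open import Data.Nat using (ℕ; zero; suc; _+_; _*_; _∸_; _^_; _≤_; _<_)
open import Data.Nat.Logarithm using (⌊log₂_⌋)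
open import Data.Bool using (Bool; true; false)
open import Data.Fin using (Fin)
open import Data.Vec using (Vec; lookup)
open import Data.List using (List; []; _∷_; length)
open import Data.List.Relation.Unary.All using (All)
open import Data.List.Relation.Unary.Unique.Propositional using (Unique)
open import Data.Product using (Σ; ∃; ∃-syntax; _×_; _,_)
open import Relation.Binary.PropositionalEquality using (_≡_)
open import Relation.Nullary using (¬_)

-- A simple undirected graph on the vertex set Fin n (vertex names double as
-- the unique identifiers {0,…,n-1} of the LOCAL model).
record Graph (n : ℕ) : Set where
  field
    adj   : Fin n → Fin n → Bool
    sym   : ∀ u v → adj u v ≡ adj v u
    irrefl : ∀ u → adj u u ≡ false
open Graph public

data Reach {n : ℕ} (G : Graph n) : ℕ → Fin n → Fin n → Set where
  here : ∀ {k u} → Reach G k u u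
  step : ∀ {k u w v} → adj G u w ≡ true → Reach G k w v → Reach G (suc k) u v

Connected : ∀ {n} → Graph n → Set
Connected G = ∀ u v → ∃[ k ] Reach G k u v

IsPath : ∀ {n} → Graph n → List (Fin n) → Set
IsPath G []            = Data.Unit.⊤ where import Data.Unit
IsPath G (x ∷ [])      = Data.Unit.⊤ where import Data.Unit
IsPath G (x ∷ y ∷ xs)  = adj G x y ≡ true × IsPath G (y ∷ xs)

lastOf : ∀ {A : Set} → A → List A → A
lastOf x []       = x
lastOf x (y ∷ ys) = lastOf y ys

IsCycle : ∀ {n} → Graph n → Fin n → Fin n → Fin n → List (Fin n) → Set
IsCycle G x y z rest =
  Unique (x ∷ y ∷ z ∷ rest) × IsPath G (x ∷ y ∷ z ∷ rest) × adj G (lastOf z rest) x ≡ true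

Acyclic : ∀ {n} → Graph n → Set
Acyclic {n} G = ∀ (x y z : Fin n) (rest : List (Fin n)) → ¬ IsCycle G x y z rest

IsTree : ∀ {n} → Graph n → Set
IsTree G = Connected G × Acyclic G

Independent : ∀ {n} → Graph n → (Fin n → Bool) → Set
Independent G S = ∀ u v → adj G u v ≡ true → ¬ (S u ≡ true × S v ≡ true)

IsRulingSet : ∀ {n} → ℕ → Graph n → (Fin n → Bool) → Set
IsRulingSet β G S = Independent G S × (∀ v → ∃[ u ] (S u ≡ true × Reach G β u v))

-- A randomized algorithm for n-node graphs: every node draws a uniform random
-- value in Fin m (its private random bits); the output of node v is a function
-- of the graph, all random values, and v.
RandAlg : ℕ → ℕ → Set
RandAlg n m = Graph n → Vec (Fin m) n → Fin n → Bool

-- LOCAL with T rounds: after T rounds v knows exactly the initial knowledge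
-- (neighbour list, random value) of the nodes at distance ≤ T. So the output of
-- v agrees on any two inputs coinciding on that information.
IsLocal : ∀ {n m} → ℕ → RandAlg n m → Set
IsLocal {n} {m} T A =
  ∀ (G G' : Graph n) (r r' : Vec (Fin m) n) (v : Fin n) →
  (∀ u → Reach G T v u → (lookup r u ≡ lookup r' u × (∀ w → adj G u w ≡ adj G' u w))) →
  A G r v ≡ A G' r' v

-- Success probability ≥ 1 - n^(-p/q): there are at least (stated in integers)
-- that many distinct random assignments on which the algorithm succeeds, i.e.
-- (#failures / #all) ≤ n^(-p/q), written as #failures^q * n^p ≤ #all^q.
SucceedsWHP : ∀ {n m} → ℕ → ℕ → RandAlg n m → Graph n → (Graph n → (Fin n → Bool) → Set) → Set
SucceedsWHP {n} {m} p q A G Good =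
  ∃[ L ] (Unique L × All (λ r → Good G (A G r)) L ×
          ((m ^ n) ∸ length L) ^ q * n ^ p ≤ (m ^ n) ^ q)

{-# OPTIONS --safe #-}

-- A marking step of rate 1/Δ lets every active vertex of degree at most Δ mark itself
-- with probability 1/Δ; marked vertices without marked neighbours join the ruling set M,
-- and everything within distance 2 of them becomes inactive. Suppose all active degrees
-- are at most Δ and v has degree d. If half of the children of v have δ children each,
-- about dδ/Δ of the grandchildren of v join at rate 1/Δ; otherwise about d/δ of the children
-- of v join at rate 1/δ. In a tree these events are independent over the children, so with
-- δ = √Δ the vertex v survives the two steps with probability exp(-Ω(d/√Δ)).
--
-- Hence, with high probability, the maximum degree drops from Δ to √Δ · O(log n) in O(1)
-- rounds, and after O(log log n) rounds it is polylogarithmic. From then on vertices whose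
-- degree stays too large are set aside; O(log log n) further steps bring the probability of
-- being set aside below any fixed inverse power of the polylogarithmic degree bound.
--
-- The vertices that remain uncovered are peeled, removing vertices of degree at most 2. A
-- vertex that survives t peelings is the root of a complete binary tree of depth about t of
-- uncovered vertices. The leaves of such a tree have disjoint subtrees, so the expected number
-- of trees decays like 2^(-2^t) and t = log log n + O(1) peelings suffice. The order of removal
-- gives an orientation of out-degree 2, Cole–Vishkin turns it into a colouring with 64 colours,
-- and sweeping through the colours yields a maximal independent set of the uncovered vertices.
module Submission where

open import Defs renaming (sym to adj-sym; irrefl to adj-irrefl)
open import Data.Bool using (Bool; true; false; _∧_; _∨_; not; if_then_else_)
open import Data.Bool.Properties using (T?; T-≡)
open import Data.Empty using (⊥; ⊥-elim)
open import Data.Fin using (Fin; zero; suc; toℕ; _↑ˡ_; _↑ʳ_; combine; remQuot)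
open import Data.Fin.Properties using (_≟_; toℕ<n; toℕ-injective; remQuot-combine)
open import Data.List using (List; []; _∷_; _++_; _∷ʳ_; length; filter; allFin; tabulate; upTo; cartesianProduct; cartesianProductWith)
import Data.List as List
open import Data.List.Membership.Propositional using (_∈_)
open import Data.List.Membership.Propositional.Properties using (∈-upTo⁺; ∈-cartesianProduct⁺)
open import Data.List.Properties using (length-++)
open import Data.List.Relation.Unary.All using (All; []; _∷_)
import Data.List.Relation.Unary.All as All
import Data.List.Relation.Unary.All.Properties as All
open import Data.List.Relation.Unary.AllPairs using ([]; _∷_)
open import Data.List.Relation.Unary.Any using (here; there)
open import Data.List.Relation.Unary.Unique.Propositional using (Unique)
import Data.List.Relation.Unary.Unique.Propositional.Properties as Unique
open import Data.Maybe using (Maybe; just; nothing; maybe)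
import Data.Maybe as Maybe
open import Data.Nat using (ℕ; zero; suc; _+_; _*_; _∸_; _^_; _≤_; _<_; z≤n; s≤s; _≤?_; _<?_; ⌊_/2⌋; ⌈_/2⌉)
open import Data.Nat.Logarithm using (⌊log₂_⌋; ⌊log₂⌋-mono-≤; ⌊log₂[2^n]⌋≡n)
open import Data.Nat.Properties hiding (_≟_)
open import Data.Nat.Tactic.RingSolver using (solve-∀)
open import Data.Product using (Σ; ∃-syntax; _×_; _,_; proj₁; proj₂)
open import Data.Product.Properties using (≡-dec)
open import Data.Sum using (_⊎_; inj₁; inj₂; [_,_]′)
open import Data.Unit using (⊤; tt)
open import Data.Vec using (Vec; []; _∷_; lookup; map)
open import Data.Vec.Properties using (∷-injective; lookup-map)
open import Function using (_∘_; case_of_; id; Equivalence)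
open import Relation.Binary.Definitions using (tri<; tri≈; tri>)
open import Relation.Binary.PropositionalEquality using (_≡_; _≢_; refl; sym; trans; cong; cong₂; subst; module ≡-Reasoning)
open import Relation.Nullary using (¬_; Dec; yes; no; does; contradiction)
open import Relation.Nullary.Decidable using (dec-true; dec-false)

-- The marks of one step are independent over disjoint subtrees, but after several steps the states
-- of these subtrees are correlated through their common ancestors. The estimates therefore run as
-- supermartingales: a potential, scaled to a natural number, bounds the chance that a vertex ends
-- up set aside and uncovered, and no step increases its average given the state before the step.
-- The same kind of certificate is evaluated on two functionals of the potentials: the value at one
-- vertex, while the degree falls to polylogarithmic, and afterwards the weighted number `Ψ` of
-- binary trees, whose products average correctly because fresh marks in disjoint subtrees are
-- independent. Whether a vertex itself joins depends on the mark of its parent, so its potential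
-- may depend on the whole subtree of the parent. This is why the trees carry their weights at
-- children of leaves and not at the leaves. All rates are of the form 2^-j, and every probability
-- is an inequality in ℕ with denominators cleared.

infix 4 _==_

-- Boolean reflection, finite sums and counting

_==_ : ∀ {n} → Fin n → Fin n → Bool
u == v = does (u ≟ v)

does⁻ : ∀ {A : Set} (d : Dec A) → does d ≡ true → A
does⁻ (yes a) _ = a

does⁻-false : ∀ {A : Set} (d : Dec A) → does d ≡ false → ¬ A
does⁻-false (no ¬a) _ = ¬a

∧⁻ : ∀ {a b} → a ∧ b ≡ true → a ≡ true × b ≡ true
∧⁻ {true} {true} _ = refl , refl

∧⁺ : ∀ {a b} → a ≡ true → b ≡ true → a ∧ b ≡ true
∧⁺ refl refl = refl

∨⁻ : ∀ {a b} → a ∨ b ≡ true → a ≡ true ⊎ b ≡ true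
∨⁻ {true}  _ = inj₁ refl
∨⁻ {false} p = inj₂ p

∨⁺ˡ : ∀ {a b} → a ≡ true → a ∨ b ≡ true
∨⁺ˡ refl = refl

∨⁺ʳ : ∀ a {b} → b ≡ true → a ∨ b ≡ true
∨⁺ʳ true  _ = refl
∨⁺ʳ false p = p

not⁻ : ∀ {a} → not a ≡ true → a ≡ false
not⁻ {false} _ = refl

¬true : ∀ {a} → ¬ (a ≡ true) → a ≡ false
¬true {true}  p = ⊥-elim (p refl)
¬true {false} _ = refl

true≢false : ∀ {a} → a ≡ true → a ≡ false → ⊥
true≢false refl ()

true? : ∀ a → a ≡ true ⊎ a ≡ false
true? true  = inj₁ refl
true? false = inj₂ refl

⟦_⟧ : Bool → ℕ
⟦ true ⟧  = 1
⟦ false ⟧ = 0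

⟦⟧≤1 : ∀ a → ⟦ a ⟧ ≤ 1
⟦⟧≤1 true  = ≤-refl
⟦⟧≤1 false = z≤n

⟦⟧-mono : ∀ {a b} → (a ≡ true → b ≡ true) → ⟦ a ⟧ ≤ ⟦ b ⟧
⟦⟧-mono {true}  f = ≤-reflexive (cong ⟦_⟧ (sym (f refl)))
⟦⟧-mono {false} f = z≤n

∑ : ∀ {n} → (Fin n → ℕ) → ℕ
∑ {zero}  f = 0
∑ {suc n} f = f zero + ∑ (f ∘ suc)

∑-mono : ∀ {n} {f g : Fin n → ℕ} → (∀ i → f i ≤ g i) → ∑ f ≤ ∑ g
∑-mono {zero}  h = z≤n
∑-mono {suc n} h = +-mono-≤ (h zero) (∑-mono (h ∘ suc))

∑-cong : ∀ {n} {f g : Fin n → ℕ} → (∀ i → f i ≡ g i) → ∑ f ≡ ∑ g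
∑-cong {zero}  h = refl
∑-cong {suc n} h = cong₂ _+_ (h zero) (∑-cong (h ∘ suc))

∑-const : ∀ n c → ∑ {n} (λ _ → c) ≡ n * c
∑-const zero    c = refl
∑-const (suc n) c = cong (c +_) (∑-const n c)

∑-*ʳ : ∀ {n} (f : Fin n → ℕ) c → ∑ (λ i → f i * c) ≡ ∑ f * c
∑-*ʳ {zero}  f c = refl
∑-*ʳ {suc n} f c = trans (cong (f zero * c +_) (∑-*ʳ (f ∘ suc) c)) (sym (*-distribʳ-+ c (f zero) (∑ (f ∘ suc))))

∑-+ : ∀ {n} (f g : Fin n → ℕ) → ∑ (λ i → f i + g i) ≡ ∑ f + ∑ g
∑-+ {zero}  f g = refl
∑-+ {suc n} f g = trans (cong (f zero + g zero +_) (∑-+ (f ∘ suc) (g ∘ suc)))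
                        (interchange (f zero) (g zero) (∑ (f ∘ suc)) (∑ (g ∘ suc)))
  where
  interchange : ∀ a b c d → a + b + (c + d) ≡ a + c + (b + d)
  interchange = solve-∀

≤∑ : ∀ {n} (f : Fin n → ℕ) i → f i ≤ ∑ f
≤∑ f zero    = m≤m+n _ _
≤∑ f (suc i) = ≤-trans (≤∑ (f ∘ suc) i) (m≤n+m _ _)

cnt : ∀ {n} → (Fin n → Bool) → ℕ
cnt P = ∑ (λ i → ⟦ P i ⟧)

cnt-mono : ∀ {n} {P Q : Fin n → Bool} → (∀ i → P i ≡ true → Q i ≡ true) → cnt P ≤ cnt Q
cnt-mono h = ∑-mono (λ i → ⟦⟧-mono (h i))

cnt-∨ : ∀ {n} (P Q : Fin n → Bool) → cnt (λ i → P i ∨ Q i) ≤ cnt P + cnt Q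
cnt-∨ P Q = ≤-trans (∑-mono (λ i → h (P i) (Q i))) (≤-reflexive (∑-+ (⟦_⟧ ∘ P) (⟦_⟧ ∘ Q)))
  where
  h : ∀ a b → ⟦ a ∨ b ⟧ ≤ ⟦ a ⟧ + ⟦ b ⟧
  h true  b = s≤s z≤n
  h false b = ≤-refl

cnt≥1 : ∀ {n} (P : Fin n → Bool) → 1 ≤ cnt P → ∃[ i ] P i ≡ true
cnt≥1 {suc n} P h with true? (P zero)
... | inj₁ p = zero , p
... | inj₂ p with cnt≥1 (P ∘ suc) (subst (λ b → 1 ≤ ⟦ b ⟧ + cnt (P ∘ suc)) p h)
...   | i , q = suc i , q

cnt≥2 : ∀ {n} (P : Fin n → Bool) → 2 ≤ cnt P → ∃[ i ] ∃[ j ] (i ≢ j × P i ≡ true × P j ≡ true)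
cnt≥2 {suc n} P h with true? (P zero)
... | inj₁ p with cnt≥1 (P ∘ suc) (≤-pred (subst (λ b → 2 ≤ ⟦ b ⟧ + cnt (P ∘ suc)) p h))
...   | i , q = zero , suc i , (λ ()) , p , q
cnt≥2 {suc n} P h | inj₂ p with cnt≥2 (P ∘ suc) (subst (λ b → 2 ≤ ⟦ b ⟧ + cnt (P ∘ suc)) p h)
...   | i , j , i≢j , q , q′ = suc i , suc j , (λ { refl → i≢j refl }) , q , q′

cnt-== : ∀ {n} (x : Fin n) → cnt (_== x) ≡ 1
cnt-== {suc n} zero    = cong suc (trans (∑-const n 0) (*-zeroʳ n))
cnt-== {suc n} (suc x) = cnt-== x

any : ∀ {n} → (Fin n → Bool) → Bool
any {zero}  P = false
any {suc n} P = P zero ∨ any (P ∘ suc)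

any⁺ : ∀ {n} (P : Fin n → Bool) i → P i ≡ true → any P ≡ true
any⁺ P zero    p = ∨⁺ˡ p
any⁺ P (suc i) p = ∨⁺ʳ (P zero) (any⁺ (P ∘ suc) i p)

any⁻ : ∀ {n} (P : Fin n → Bool) → any P ≡ true → ∃[ i ] P i ≡ true
any⁻ {suc n} P p with ∨⁻ {P zero} p
... | inj₁ q = zero , q
... | inj₂ q with any⁻ (P ∘ suc) q
...   | i , r = suc i , r

any-cong : ∀ {n} {P Q : Fin n → Bool} → (∀ i → P i ≡ Q i) → any P ≡ any Q
any-cong {zero}  h = refl
any-cong {suc n} h = cong₂ _∨_ (h zero) (any-cong (h ∘ suc))

-- S b f sums f over all mark vectors, an entry false carrying weight b and an
-- entry true weight 1: the law of independent marks of probability 1/(1+b),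
-- multiplied by (1+b)ⁿ.
S : ∀ (b : ℕ) {n} → (Vec Bool n → ℕ) → ℕ
S b {zero}  f = f []
S b {suc n} f = S b (f ∘ (true ∷_)) + b * S b (f ∘ (false ∷_))

S-mono : ∀ b {n} {f g : Vec Bool n → ℕ} → (∀ m → f m ≤ g m) → S b f ≤ S b g
S-mono b {zero}  h = h []
S-mono b {suc n} h = +-mono-≤ (S-mono b (λ m → h (true ∷ m))) (*-monoʳ-≤ b (S-mono b (λ m → h (false ∷ m))))

S-cong : ∀ b {n} {f g : Vec Bool n → ℕ} → (∀ m → f m ≡ g m) → S b f ≡ S b g
S-cong b {zero}  h = h []
S-cong b {suc n} h = cong₂ (λ x y → x + b * y) (S-cong b (λ m → h (true ∷ m))) (S-cong b (λ m → h (false ∷ m)))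

S-+ : ∀ b {n} (f g : Vec Bool n → ℕ) → S b (λ m → f m + g m) ≡ S b f + S b g
S-+ b {zero}  f g = refl
S-+ b {suc n} f g = trans (cong₂ (λ x y → x + b * y) (S-+ b (f ∘ (true ∷_)) (g ∘ (true ∷_))) (S-+ b (f ∘ (false ∷_)) (g ∘ (false ∷_))))
                          (eq b (S b (f ∘ (true ∷_))) (S b (g ∘ (true ∷_))) (S b (f ∘ (false ∷_))) (S b (g ∘ (false ∷_))))
  where
  eq : ∀ b x y z w → x + y + b * (z + w) ≡ x + b * z + (y + b * w)
  eq = solve-∀

S-*ʳ : ∀ b {n} (f : Vec Bool n → ℕ) c → S b (λ m → f m * c) ≡ S b f * c
S-*ʳ b {zero}  f c = refl
S-*ʳ b {suc n} f c = trans (cong₂ (λ x y → x + b * y) (S-*ʳ b (f ∘ (true ∷_)) c) (S-*ʳ b (f ∘ (false ∷_)) c))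
                           (eq b (S b (f ∘ (true ∷_))) (S b (f ∘ (false ∷_))) c)
  where
  eq : ∀ b x y c → x * c + b * (y * c) ≡ (x + b * y) * c
  eq = solve-∀

S-const : ∀ b n c → S b {n} (λ _ → c) ≡ suc b ^ n * c
S-const b zero    c = sym (+-identityʳ c)
S-const b (suc n) c = trans (cong (λ x → x + b * x) (S-const b n c)) (eq b (suc b ^ n) c)
  where
  eq : ∀ b x c → x * c + b * (x * c) ≡ (1 + b) * x * c
  eq = solve-∀

S-1* : ∀ b {n} (f : Vec Bool n → ℕ) → S b (λ m → 1 * f m) ≡ S b f
S-1* b f = S-cong b (λ m → *-identityˡ (f m))

S-∑ : ∀ b {n k} (f : Fin k → Vec Bool n → ℕ) → S b (λ m → ∑ (λ i → f i m)) ≡ ∑ (λ i → S b (f i))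
S-∑ b {n} {zero}  f = trans (S-const b n 0) (*-zeroʳ (suc b ^ n))
S-∑ b {n} {suc k} f = trans (S-+ b (f zero) (λ m → ∑ (λ i → f (suc i) m))) (cong (S b (f zero) +_) (S-∑ b (f ∘ suc)))

Dep : ∀ {n} → (Fin n → Bool) → (Vec Bool n → ℕ) → Set
Dep M f = ∀ m m′ → (∀ i → M i ≡ true → lookup m i ≡ lookup m′ i) → f m ≡ f m′

Dep-⊆ : ∀ {n} {M M′ : Fin n → Bool} {f} → (∀ i → M i ≡ true → M′ i ≡ true) → Dep M f → Dep M′ f
Dep-⊆ M⊆M′ d m m′ h = d m m′ (λ i q → h i (M⊆M′ i q))

Dep-∷ : ∀ {n} {M : Fin (suc n) → Bool} {f} a → Dep M f → Dep (M ∘ suc) (f ∘ (a ∷_))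
Dep-∷ a d m m′ h = d (a ∷ m) (a ∷ m′) (λ { zero _ → refl ; (suc i) p → h i p })

Dep-head : ∀ {n} {M : Fin (suc n) → Bool} {f} → M zero ≡ false → Dep M f → ∀ m → f (false ∷ m) ≡ f (true ∷ m)
Dep-head p d m = d (false ∷ m) (true ∷ m) (λ { zero q → ⊥-elim (true≢false q p) ; (suc i) _ → refl })

-- By induction on the first mark: one of the two factors ignores it, so its two branches coincide
-- and the sum over this mark factors. The total weight on the left clears the denominator in a
-- product of two averages.
S-indep : ∀ b {n} (M : Fin n → Bool) (f g : Vec Bool n → ℕ) → Dep M f → Dep (not ∘ M) g →
          suc b ^ n * S b (λ m → f m * g m) ≡ S b f * S b g
S-indep b {zero}  M f g df dg = +-identityʳ _
S-indep b {suc n} M f g df dg = begin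
  suc b ^ suc n * (S b (λ m → f (true ∷ m) * g (true ∷ m)) + b * S b (λ m → f (false ∷ m) * g (false ∷ m)))
    ≡⟨ eq₁ b (suc b ^ n) _ _ ⟩
  (1 + b) * (suc b ^ n * S b (λ m → f (true ∷ m) * g (true ∷ m)) + b * (suc b ^ n * S b (λ m → f (false ∷ m) * g (false ∷ m))))
    ≡⟨ cong₂ (λ x y → (1 + b) * (x + b * y)) (ih true) (ih false) ⟩
  (1 + b) * (S b (f ∘ (true ∷_)) * S b (g ∘ (true ∷_)) + b * (S b (f ∘ (false ∷_)) * S b (g ∘ (false ∷_))))
    ≡⟨ fin ⟩
  S b f * S b g ∎
  where
  open ≡-Reasoning
  ih : ∀ a → suc b ^ n * S b (λ m → f (a ∷ m) * g (a ∷ m)) ≡ S b (f ∘ (a ∷_)) * S b (g ∘ (a ∷_))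
  ih a = S-indep b (M ∘ suc) (f ∘ (a ∷_)) (g ∘ (a ∷_)) (Dep-∷ a df) (Dep-∷ a dg)
  eq₁ : ∀ b B x y → (1 + b) * B * (x + b * y) ≡ (1 + b) * (B * x + b * (B * y))
  eq₁ = solve-∀
  eq₂ : ∀ b x y z → (1 + b) * (x * z + b * (y * z)) ≡ (x + b * y) * (z + b * z)
  eq₂ = solve-∀
  eq₃ : ∀ b x y z → (1 + b) * (x * y + b * (x * z)) ≡ (x + b * x) * (y + b * z)
  eq₃ = solve-∀
  fin : (1 + b) * (S b (f ∘ (true ∷_)) * S b (g ∘ (true ∷_)) + b * (S b (f ∘ (false ∷_)) * S b (g ∘ (false ∷_)))) ≡ S b f * S b g
  fin with true? (M zero)
  ... | inj₁ p rewrite S-cong b (Dep-head {M = not ∘ M} {g} (cong not p) dg) =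
        eq₂ b (S b (f ∘ (true ∷_))) (S b (f ∘ (false ∷_))) (S b (g ∘ (true ∷_)))
  ... | inj₂ p rewrite S-cong b (Dep-head {M = M} {f} p df) =
        eq₃ b (S b (f ∘ (true ∷_))) (S b (g ∘ (true ∷_))) (S b (g ∘ (false ∷_)))

∏ : ∀ {n} → (Fin n → ℕ) → ℕ
∏ {zero}  f = 1
∏ {suc n} f = f zero * ∏ (f ∘ suc)

Dep-∏ : ∀ {n k} {M : Fin n → Bool} (X : Fin k → Vec Bool n → ℕ) → (∀ i → Dep M (X i)) → Dep M (λ m → ∏ (λ i → X i m))
Dep-∏ {k = zero}  X d m m′ h = refl
Dep-∏ {k = suc k} X d m m′ h = cong₂ _*_ (d zero m m′ h) (Dep-∏ (X ∘ suc) (d ∘ suc) m m′ h)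

-- The supports `M i` are disjoint, so `S-indep` splits off one factor at a time. Factors selected
-- by `W` contribute the ratio α/β, the others are bounded by 1; hence the exponent `cnt W`.
S-∏ : ∀ b {n k} (α β : ℕ) (W : Fin k → Bool) (X : Fin k → Vec Bool n → ℕ) (M : Fin k → Fin n → Bool) →
      (∀ i j u → i ≢ j → M i u ≡ true → M j u ≡ false) →
      (∀ i → Dep (M i) (X i)) →
      (∀ i m → X i m ≤ 1) →
      (∀ i → W i ≡ true → S b (X i) * β ≤ α * suc b ^ n) →
      S b (λ m → ∏ (λ i → X i m)) * β ^ cnt W ≤ α ^ cnt W * suc b ^ n
S-∏ b {n} {zero}  α β W X M disj dep X≤1 hit = ≤-reflexive (trans (cong (_* 1) (S-const b n 1)) (eq (suc b ^ n)))
  where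
  eq : ∀ x → x * 1 * 1 ≡ 1 * x
  eq = solve-∀
S-∏ b {n} {suc k} α β W X M disj dep X≤1 hit = go (W zero) refl
  where
  B = suc b ^ n
  rest : Vec Bool n → ℕ
  rest m = ∏ (λ i → X (suc i) m)
  c = cnt (W ∘ suc)
  ih : S b rest * β ^ c ≤ α ^ c * B
  ih = S-∏ b α β (W ∘ suc) (X ∘ suc) (M ∘ suc) (λ i j u i≢j → disj (suc i) (suc j) u (λ { refl → i≢j refl }))
         (dep ∘ suc) (X≤1 ∘ suc) (hit ∘ suc)
  indep : B * S b (λ m → X zero m * rest m) ≡ S b (X zero) * S b rest
  indep = S-indep b (M zero) (X zero) rest (dep zero)
            (Dep-∏ (X ∘ suc) (λ i → Dep-⊆ (λ u p → cong not (disj (suc i) zero u (λ ()) p)) (dep (suc i))))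
  open ≤-Reasoning
  go : ∀ w → W zero ≡ w → S b (λ m → X zero m * rest m) * β ^ (⟦ W zero ⟧ + c) ≤ α ^ (⟦ W zero ⟧ + c) * B
  go true p rewrite p = *-cancelˡ-≤ B {{m^n≢0 (suc b) n}} (begin
    B * (S b (λ m → X zero m * rest m) * (β * β ^ c))   ≡⟨ sym (*-assoc B _ _) ⟩
    B * S b (λ m → X zero m * rest m) * (β * β ^ c)     ≡⟨ cong (_* (β * β ^ c)) indep ⟩
    S b (X zero) * S b rest * (β * β ^ c)               ≡⟨ eq₁ (S b (X zero)) (S b rest) β (β ^ c) ⟩
    S b (X zero) * β * (S b rest * β ^ c)               ≤⟨ *-mono-≤ (hit zero p) ih ⟩
    α * B * (α ^ c * B)                                 ≡⟨ eq₂ α B (α ^ c) ⟩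
    B * (α * α ^ c * B) ∎)
    where
    eq₁ : ∀ x y z w → x * y * (z * w) ≡ x * z * (y * w)
    eq₁ = solve-∀
    eq₂ : ∀ a B c → a * B * (c * B) ≡ B * (a * c * B)
    eq₂ = solve-∀
  go false p rewrite p = ≤-trans (*-monoˡ-≤ (β ^ c) (S-mono b (λ m → ≤-trans (*-monoˡ-≤ (rest m) (X≤1 zero m)) (≤-reflexive (+-identityʳ (rest m)))))) ih

-- Cylinder events: prescribing some of the marks

data Constraint : Set where
  marked unmarked free : Constraint

satisfies : Constraint → Bool → Bool
satisfies marked   a = a
satisfies unmarked a = not a
satisfies free     a = true

isMarked isUnmarked : Constraint → Bool
isMarked marked = true
isMarked _      = false
isUnmarked unmarked = true
isUnmarked _        = false

cyl : ∀ {n} → (Fin n → Constraint) → Vec Bool n → ℕ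
cyl c []      = 1
cyl c (a ∷ m) = ⟦ satisfies (c zero) a ⟧ * cyl (c ∘ suc) m

cyl-≤1 : ∀ {n} (c : Fin n → Constraint) m → cyl c m ≤ 1
cyl-≤1 c []      = ≤-refl
cyl-≤1 c (a ∷ m) = *-mono-≤ (⟦⟧≤1 (satisfies (c zero) a)) (cyl-≤1 (c ∘ suc) m)

cyl⁻ : ∀ {n} (c : Fin n → Constraint) m → 1 ≤ cyl c m → ∀ i → satisfies (c i) (lookup m i) ≡ true
cyl⁻ c (a ∷ m) h i with satisfies (c zero) a in eq
cyl⁻ c (a ∷ m) h zero    | true = eq
cyl⁻ c (a ∷ m) h (suc i) | true = cyl⁻ (c ∘ suc) m (subst (1 ≤_) (+-identityʳ _) h) i

Dep-cyl : ∀ {n} (c : Fin n → Constraint) (M : Fin n → Bool) → (∀ i → M i ≡ false → c i ≡ free) → Dep M (cyl c)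
Dep-cyl c M h []      []       e = refl
Dep-cyl c M h (a ∷ m) (a′ ∷ m′) e = cong₂ (λ x y → ⟦ x ⟧ * y) hd (Dep-cyl (c ∘ suc) (M ∘ suc) (h ∘ suc) m m′ (e ∘ suc))
  where
  hd : satisfies (c zero) a ≡ satisfies (c zero) a′
  hd with true? (M zero)
  ... | inj₁ p = cong (satisfies (c zero)) (e zero p)
  ... | inj₂ p rewrite h zero p = refl

-- A marked coordinate has probability 1/(1+b), an unmarked one b/(1+b) and a free one 1.
S-cyl : ∀ b {n} (c : Fin n → Constraint) →
        S b (cyl c) * suc b ^ (cnt (isMarked ∘ c) + cnt (isUnmarked ∘ c)) ≡ suc b ^ n * b ^ cnt (isUnmarked ∘ c)
S-cyl b {zero}  c = refl
S-cyl b {suc n} c with c zero | S-cyl b (c ∘ suc)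
... | marked | ih = trans (cong₂ (λ x y → (x + b * y) * suc b ^ suc (p + q)) (S-1* b (cyl (c ∘ suc))) (S-const b n 0))
                   (trans (eq b (S b (cyl (c ∘ suc))) (suc b ^ n) (suc b ^ (p + q))) (trans (cong (suc b *_) ih) (sym (*-assoc (suc b) (suc b ^ n) (b ^ q)))))
  where
  p = cnt (isMarked ∘ c ∘ suc)
  q = cnt (isUnmarked ∘ c ∘ suc)
  eq : ∀ b x B z → (x + b * (B * 0)) * ((1 + b) * z) ≡ (1 + b) * (x * z)
  eq = solve-∀
... | unmarked | ih = trans (cong₂ _*_ (cong₂ (λ x y → x + b * y) (S-const b n 0) (S-1* b (cyl (c ∘ suc)))) (cong (suc b ^_) (+-suc p q)))
                   (trans (eq b (S b (cyl (c ∘ suc))) (suc b ^ n) (suc b ^ (p + q))) (trans (cong ((1 + b) * b *_) ih) (eq₂ b (suc b ^ n) (b ^ q))))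
  where
  p = cnt (isMarked ∘ c ∘ suc)
  q = cnt (isUnmarked ∘ c ∘ suc)
  eq : ∀ b x B z → (B * 0 + b * x) * ((1 + b) * z) ≡ (1 + b) * b * (x * z)
  eq = solve-∀
  eq₂ : ∀ b B z → (1 + b) * b * (B * z) ≡ (1 + b) * B * (b * z)
  eq₂ = solve-∀
... | free | ih = trans (cong₂ (λ x y → (x + b * y) * suc b ^ (p + q)) (S-1* b (cyl (c ∘ suc))) (S-1* b (cyl (c ∘ suc))))
                   (trans (eq b (S b (cyl (c ∘ suc))) (suc b ^ (p + q))) (trans (cong (suc b *_) ih) (sym (*-assoc (suc b) (suc b ^ n) (b ^ q)))))
  where
  p = cnt (isMarked ∘ c ∘ suc)
  q = cnt (isUnmarked ∘ c ∘ suc)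
  eq : ∀ b x z → (x + b * x) * z ≡ (1 + b) * (x * z)
  eq = solve-∀

-- Probability estimates for cylinders

-- Bernoulli's inequality (1 - 1/(1+b))^k ≥ 1 - k/(1+b), multiplied by (1+b)^(k+1).
bernoulli-lower : ∀ b k → suc b ^ k * suc b ≤ b ^ k * suc b + k * suc b ^ k
bernoulli-lower b zero    = m≤m+n _ _
bernoulli-lower b (suc k) = begin
  suc b * suc b ^ k * suc b                              ≡⟨ *-assoc (suc b) (suc b ^ k) (suc b) ⟩
  suc b * (suc b ^ k * suc b)                            ≤⟨ *-monoʳ-≤ (suc b) (bernoulli-lower b k) ⟩
  suc b * (b ^ k * suc b + k * suc b ^ k)                ≡⟨ eq b (b ^ k) k (suc b ^ k) ⟩
  b * b ^ k * suc b + (b ^ k * suc b + k * (suc b * suc b ^ k))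
    ≤⟨ +-monoʳ-≤ (b * b ^ k * suc b) (+-monoˡ-≤ (k * (suc b * suc b ^ k)) (*-monoˡ-≤ (suc b) (^-monoˡ-≤ k (n≤1+n b)))) ⟩
  b * b ^ k * suc b + (suc b ^ k * suc b + k * (suc b * suc b ^ k))
    ≡⟨ cong (λ x → b * b ^ k * suc b + (x + k * (suc b * suc b ^ k))) (*-comm (suc b ^ k) (suc b)) ⟩
  b * b ^ k * suc b + suc k * (suc b * suc b ^ k) ∎
  where
  open ≤-Reasoning
  eq : ∀ b x k y → (1 + b) * (x * (1 + b) + k * y) ≡ b * x * (1 + b) + (x * (1 + b) + k * ((1 + b) * y))
  eq = solve-∀

-- If the expected number of marks among k vertices is at most 1/2, then with probability at least
-- 1/2 there is none.
half-power : ∀ b k → 2 * k ≤ suc b → suc b ^ k ≤ 2 * b ^ k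
half-power b k h = *-cancelʳ-≤ _ _ (suc b) (+-cancelʳ-≤ (2 * k * suc b ^ k) _ _ (begin
  suc b ^ k * suc b + 2 * k * suc b ^ k                  ≤⟨ +-monoʳ-≤ (suc b ^ k * suc b) (*-monoˡ-≤ (suc b ^ k) h) ⟩
  suc b ^ k * suc b + suc b * suc b ^ k                  ≡⟨ eq₁ (suc b ^ k) (suc b) ⟩
  2 * (suc b ^ k * suc b)                                ≤⟨ *-monoʳ-≤ 2 (bernoulli-lower b k) ⟩
  2 * (b ^ k * suc b + k * suc b ^ k)                    ≡⟨ eq₂ (b ^ k) (suc b) k (suc b ^ k) ⟩
  2 * b ^ k * suc b + 2 * k * suc b ^ k ∎))
  where
  open ≤-Reasoning
  eq₁ : ∀ x y → x * y + y * x ≡ 2 * (x * y)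
  eq₁ = solve-∀
  eq₂ : ∀ x y k z → 2 * (x * y + k * z) ≡ 2 * x * y + 2 * k * z
  eq₂ = solve-∀

-- Bernoulli's inequality (1 + 1/b)^k ≥ 1 + k/b, multiplied by b^(k+1).
bernoulli-upper : ∀ b k → b ^ k * (b + k) ≤ suc b ^ k * b
bernoulli-upper b zero    = ≤-reflexive (cong (1 *_) (+-identityʳ b))
bernoulli-upper b (suc k) = begin
  b * b ^ k * (b + suc k)                        ≡⟨ eq b (b ^ k) k ⟩
  b * (b ^ k * (b + k)) + b ^ k * b              ≤⟨ +-monoʳ-≤ _ (*-monoʳ-≤ (b ^ k) (m≤m+n b k)) ⟩
  b * (b ^ k * (b + k)) + b ^ k * (b + k)        ≡⟨ eq₂ b (b ^ k * (b + k)) ⟩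
  suc b * (b ^ k * (b + k))                      ≤⟨ *-monoʳ-≤ (suc b) (bernoulli-upper b k) ⟩
  suc b * (suc b ^ k * b)                        ≡⟨ sym (*-assoc (suc b) (suc b ^ k) b) ⟩
  suc b * suc b ^ k * b ∎
  where
  open ≤-Reasoning
  eq : ∀ b x k → b * x * (b + (1 + k)) ≡ b * (x * (b + k)) + x * b
  eq = solve-∀
  eq₂ : ∀ b x → b * x + x ≡ (1 + b) * x
  eq₂ = solve-∀

double-power : ∀ b → b ^ suc b * 2 ≤ suc b ^ suc b
double-power zero    = z≤n
double-power b@(suc _) = *-cancelʳ-≤ _ _ b (begin
  b ^ suc b * 2 * b            ≡⟨ eq (b ^ suc b) b ⟩
  b ^ suc b * (b + b)          ≤⟨ *-monoʳ-≤ (b ^ suc b) (+-monoʳ-≤ b (n≤1+n b)) ⟩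
  b ^ suc b * (b + suc b)      ≤⟨ bernoulli-upper b (suc b) ⟩
  suc b ^ suc b * b ∎)
  where
  open ≤-Reasoning
  eq : ∀ x b → x * 2 * b ≡ x * (b + b)
  eq = solve-∀

^-distribʳ-* : ∀ k m n → (m * n) ^ k ≡ m ^ k * n ^ k
^-distribʳ-* zero    m n = refl
^-distribʳ-* (suc k) m n = trans (cong (m * n *_) (^-distribʳ-* k m n)) (eq m n (m ^ k) (n ^ k))
  where
  eq : ∀ m n x y → m * n * (x * y) ≡ m * x * (n * y)
  eq = solve-∀

-- By `double-power` a block of 1+α factors α/(1+α) is at most 1/2; c contains e such blocks, and
-- the remaining factors are at most 1.
power-decay : ∀ α e c → suc α * e ≤ c → α ^ c * 2 ^ e ≤ suc α ^ c
power-decay α e c h = begin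
  α ^ c * 2 ^ e                           ≡⟨ cong (λ x → α ^ x * 2 ^ e) (sym (m+[n∸m]≡n h)) ⟩
  α ^ (p + r) * 2 ^ e                     ≡⟨ cong (_* 2 ^ e) (^-distribˡ-+-* α p r) ⟩
  α ^ p * α ^ r * 2 ^ e                   ≡⟨ eq (α ^ p) (α ^ r) (2 ^ e) ⟩
  α ^ p * 2 ^ e * α ^ r                   ≤⟨ *-mono-≤ main (^-monoˡ-≤ r (n≤1+n α)) ⟩
  suc α ^ p * suc α ^ r                   ≡⟨ sym (^-distribˡ-+-* (suc α) p r) ⟩
  suc α ^ (p + r)                         ≡⟨ cong (suc α ^_) (m+[n∸m]≡n h) ⟩
  suc α ^ c ∎
  where
  open ≤-Reasoning
  p = suc α * e
  r = c ∸ p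
  eq : ∀ x y z → x * y * z ≡ x * z * y
  eq = solve-∀
  main : α ^ p * 2 ^ e ≤ suc α ^ p
  main = begin
    α ^ (suc α * e) * 2 ^ e      ≡⟨ cong (_* 2 ^ e) (sym (^-*-assoc α (suc α) e)) ⟩
    (α ^ suc α) ^ e * 2 ^ e      ≡⟨ sym (^-distribʳ-* e (α ^ suc α) 2) ⟩
    (α ^ suc α * 2) ^ e          ≤⟨ ^-monoˡ-≤ e (double-power α) ⟩
    (suc α ^ suc α) ^ e          ≡⟨ ^-*-assoc (suc α) (suc α) e ⟩
    suc α ^ (suc α * e) ∎

decay : ∀ {s B} α e c → suc α * e ≤ c → s * suc α ^ c ≤ α ^ c * B → s * 2 ^ e ≤ B
decay {s} {B} α e c h k = *-cancelˡ-≤ (suc α ^ c) {{m^n≢0 (suc α) c}} (begin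
  suc α ^ c * (s * 2 ^ e)   ≡⟨ eq₁ (suc α ^ c) s (2 ^ e) ⟩
  s * suc α ^ c * 2 ^ e     ≤⟨ *-monoˡ-≤ (2 ^ e) k ⟩
  α ^ c * B * 2 ^ e         ≡⟨ eq₂ (α ^ c) B (2 ^ e) ⟩
  α ^ c * 2 ^ e * B         ≤⟨ *-monoˡ-≤ B (power-decay α e c h) ⟩
  suc α ^ c * B ∎)
  where
  open ≤-Reasoning
  eq₁ : ∀ x y z → x * (y * z) ≡ y * x * z
  eq₁ = solve-∀
  eq₂ : ∀ x y z → x * y * z ≡ x * z * y
  eq₂ = solve-∀

n<2^n : ∀ n → n < 2 ^ n
n<2^n zero    = s≤s z≤n
n<2^n (suc n) = ≤-trans (+-mono-≤ (m^n>0 2 n) (n<2^n n)) (≤-reflexive (cong (2 ^ n +_) (sym (+-identityʳ (2 ^ n)))))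

abstract
  -- The odds against an event of probability 2^-j: with b = `odds j` the rate 1/(1+b) is exactly
  -- 2^-j, and a miss has probability `odds j` / 2^j.
  odds : ℕ → ℕ
  odds j = 2 ^ j ∸ 1

  suc-odds : ∀ j → suc (odds j) ≡ 2 ^ j
  suc-odds j = m+[n∸m]≡n {1} (m^n>0 2 j)

module _ {n : ℕ} (κ j′ : ℕ) where
  private
    j b B : ℕ
    j = suc j′
    b = odds j
    B = suc b

  -- Split the F vertices into at most κ blocks of size at most `2 ^ j′`; by `half-power` each block
  -- stays unmarked with probability at least 1/2.
  power-ratio : ∀ F → F ≤ 2 ^ j′ * κ → B ^ F ≤ 2 ^ κ * b ^ F
  power-ratio F h = *-cancelʳ-≤ _ _ (B ^ r) {{m^n≢0 B r}} (begin
    B ^ F * B ^ r              ≡⟨ sym (^-distribˡ-+-* B F r) ⟩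
    B ^ (F + r)                ≡⟨ cong (B ^_) (m+[n∸m]≡n h) ⟩
    B ^ (2 ^ j′ * κ)           ≡⟨ sym (^-*-assoc B (2 ^ j′) κ) ⟩
    (B ^ 2 ^ j′) ^ κ           ≤⟨ ^-monoˡ-≤ κ (half-power b (2 ^ j′) (≤-reflexive (sym (suc-odds j)))) ⟩
    (2 * b ^ 2 ^ j′) ^ κ       ≡⟨ ^-distribʳ-* κ 2 (b ^ 2 ^ j′) ⟩
    2 ^ κ * (b ^ 2 ^ j′) ^ κ   ≡⟨ cong (2 ^ κ *_) (^-*-assoc b (2 ^ j′) κ) ⟩
    2 ^ κ * b ^ (2 ^ j′ * κ)   ≡⟨ cong (λ x → 2 ^ κ * b ^ x) (sym (m+[n∸m]≡n h)) ⟩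
    2 ^ κ * b ^ (F + r)        ≡⟨ cong (2 ^ κ *_) (^-distribˡ-+-* b F r) ⟩
    2 ^ κ * (b ^ F * b ^ r)    ≤⟨ *-monoʳ-≤ (2 ^ κ) (*-monoʳ-≤ (b ^ F) (^-monoˡ-≤ r (n≤1+n b))) ⟩
    2 ^ κ * (b ^ F * B ^ r)    ≡⟨ sym (*-assoc (2 ^ κ) (b ^ F) (B ^ r)) ⟩
    2 ^ κ * b ^ F * B ^ r ∎)
    where
    open ≤-Reasoning
    r = 2 ^ j′ * κ ∸ F

  -- The single mark costs a factor 2^j, the unmarked vertices cost 2^κ by `power-ratio`.
  S-cyl-≥ : (c : Fin n → Constraint) → cnt (isMarked ∘ c) ≤ 1 → cnt (isUnmarked ∘ c) ≤ 2 ^ j′ * κ →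
            B ^ n ≤ S b (cyl c) * 2 ^ (j + κ)
  S-cyl-≥ c t≤1 F≤ = *-cancelʳ-≤ _ _ (B ^ F) {{m^n≢0 B F}} (begin
    B ^ n * B ^ F                          ≤⟨ *-monoʳ-≤ (B ^ n) (power-ratio F F≤) ⟩
    B ^ n * (2 ^ κ * b ^ F)                ≡⟨ eq₁ (B ^ n) (2 ^ κ) (b ^ F) ⟩
    2 ^ κ * (B ^ n * b ^ F)                ≡⟨ cong (2 ^ κ *_) (sym (S-cyl b c)) ⟩
    2 ^ κ * (S b (cyl c) * B ^ (t + F))    ≤⟨ *-monoʳ-≤ (2 ^ κ) (*-monoʳ-≤ (S b (cyl c)) (^-monoʳ-≤ B (+-monoˡ-≤ F t≤1))) ⟩
    2 ^ κ * (S b (cyl c) * (B * B ^ F))    ≡⟨ eq₂ (2 ^ κ) (S b (cyl c)) B (B ^ F) ⟩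
    S b (cyl c) * (B * 2 ^ κ) * B ^ F      ≡⟨ cong (λ x → S b (cyl c) * (x * 2 ^ κ) * B ^ F) (suc-odds j) ⟩
    S b (cyl c) * (2 ^ j * 2 ^ κ) * B ^ F  ≡⟨ cong (λ x → S b (cyl c) * x * B ^ F) (sym (^-distribˡ-+-* 2 j κ)) ⟩
    S b (cyl c) * 2 ^ (j + κ) * B ^ F ∎)
    where
    open ≤-Reasoning
    t = cnt (isMarked ∘ c)
    F = cnt (isUnmarked ∘ c)
    eq₁ : ∀ x k y → x * (k * y) ≡ k * (x * y)
    eq₁ = solve-∀
    eq₂ : ∀ k x y z → k * (x * (y * z)) ≡ x * (y * k) * z
    eq₂ = solve-∀

∑≤1 : ∀ {n} (f : Fin n → ℕ) → (∀ i → f i ≤ 1) → (∀ i i′ → 1 ≤ f i → 1 ≤ f i′ → i ≡ i′) → ∑ f ≤ 1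
∑≤1 {zero}  f h u = z≤n
∑≤1 {suc n} f h u with f zero in eq | h zero
... | zero        | _ = ∑≤1 (f ∘ suc) (h ∘ suc) (λ i i′ p q → case u (suc i) (suc i′) p q of λ { refl → refl })
... | suc zero    | _ = ≤-reflexive (cong suc (trans (∑-cong zeros) (trans (∑-const n 0) (*-zeroʳ n))))
  where
  zeros : ∀ i → f (suc i) ≡ 0
  zeros i with f (suc i) in eq′
  ... | zero  = refl
  ... | suc _ with u zero (suc i) (subst (1 ≤_) (sym eq) ≤-refl) (subst (1 ≤_) (sym eq′) (s≤s z≤n))
  ...   | ()
... | suc (suc _) | s≤s ()

-- Kept outside `Hit` because `Family` forms the miss indicator under a Boolean test, before the
-- hypotheses of `Hit` are available.
hitsOf missOf : ∀ {n} → (Fin n → Bool) → (Fin n → Fin n → Constraint) → Vec Bool n → ℕ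
hitsOf C con m = ∑ (λ x → ⟦ C x ⟧ * cyl (con x) m)
missOf C con m = 1 ∸ hitsOf C con m

-- The cylinders of the 2ᶜ candidates exclude each other, so their probabilities,
-- each at least 2^-(j+κ), add up to at least 2^-y.
module Hit {n : ℕ} (κ j′ c y : ℕ) (y+c : y + c ≡ suc j′ + κ)
           (C : Fin n → Bool) (con : Fin n → Fin n → Constraint)
           (C≥ : 2 ^ c ≤ cnt C)
           (one : ∀ x → C x ≡ true → cnt (isMarked ∘ con x) ≤ 1)
           (few : ∀ x → C x ≡ true → cnt (isUnmarked ∘ con x) ≤ 2 ^ j′ * κ)
           (excl : ∀ x x′ → C x ≡ true → C x′ ≡ true → con x x ≡ marked × (x ≢ x′ → con x x′ ≡ unmarked)) where
  private
    b B : ℕ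
    b = odds (suc j′)
    B = suc b ^ n

    hits miss : Vec Bool n → ℕ
    hits = hitsOf C con
    miss = missOf C con

    pos : ∀ x m → 1 ≤ ⟦ C x ⟧ * cyl (con x) m → C x ≡ true × 1 ≤ cyl (con x) m
    pos x m h with C x
    ... | true = refl , subst (1 ≤_) (+-identityʳ _) h

    -- Two candidates cannot succeed together: one cylinder demands that the other candidate be
    -- unmarked, the other cylinder that it be marked.
    hits≤1 : ∀ m → hits m ≤ 1
    hits≤1 m = ∑≤1 _ (λ x → *-mono-≤ (⟦⟧≤1 (C x)) (cyl-≤1 (con x) m)) uniq
      where
      uniq : ∀ x x′ → 1 ≤ ⟦ C x ⟧ * cyl (con x) m → 1 ≤ ⟦ C x′ ⟧ * cyl (con x′) m → x ≡ x′
      uniq x x′ p q with x ≟ x′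
      ... | yes e = e
      ... | no x≢x′ with pos x m p | pos x′ m q
      ...   | Cx , cx | Cx′ , cx′ = ⊥-elim (true≢false
                (subst (λ k → satisfies k (lookup m x′) ≡ true) (proj₁ (excl x′ x Cx′ Cx)) (cyl⁻ (con x′) m cx′ x′))
                (not⁻ (subst (λ k → satisfies k (lookup m x′) ≡ true) (proj₂ (excl x x′ Cx Cx′) x≢x′) (cyl⁻ (con x) m cx x′))))

  hit-or-miss : ∀ m → (∃[ x ] (C x ≡ true × 1 ≤ cyl (con x) m)) ⊎ miss m ≡ 1
  hit-or-miss m with hits m in eq
  ... | zero  = inj₂ refl
  ... | suc k with positive (λ x → ⟦ C x ⟧ * cyl (con x) m) (subst (1 ≤_) (sym eq) (s≤s z≤n))
    where
    positive : ∀ {k} (f : Fin k → ℕ) → 1 ≤ ∑ f → ∃[ i ] 1 ≤ f i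
    positive {suc k} f h with f zero in eq
    ... | suc _ = zero , subst (1 ≤_) (sym eq) (s≤s z≤n)
    ... | zero with positive (f ∘ suc) h
    ...   | i , q = suc i , q
  ...   | x , q = inj₁ (x , pos x m q)

  Dep-miss : ∀ M → (∀ x → C x ≡ true → ∀ i → M i ≡ false → con x i ≡ free) → Dep M miss
  Dep-miss M h m m′ e = cong (1 ∸_) (∑-cong term)
    where
    term : ∀ x → ⟦ C x ⟧ * cyl (con x) m ≡ ⟦ C x ⟧ * cyl (con x) m′
    term x with C x in eq
    ... | true  = cong (1 *_) (Dep-cyl (con x) M (h x eq) m m′ e)
    ... | false = refl

  S-miss : S b miss * 2 ^ y ≤ odds y * B
  S-miss = +-cancelʳ-≤ B _ _ (begin
    S b miss * 2 ^ y + B                    ≤⟨ +-monoʳ-≤ (S b miss * 2 ^ y) S-hits ⟩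
    S b miss * 2 ^ y + S b hits * 2 ^ y     ≡⟨ sym (*-distribʳ-+ (2 ^ y) (S b miss) (S b hits)) ⟩
    (S b miss + S b hits) * 2 ^ y           ≡⟨ cong (_* 2 ^ y) (sym (S-+ b miss hits)) ⟩
    S b (λ m → miss m + hits m) * 2 ^ y     ≡⟨ cong (_* 2 ^ y) (S-cong b (λ m → m∸n+n≡m (hits≤1 m))) ⟩
    S b {n} (λ _ → 1) * 2 ^ y               ≡⟨ cong (_* 2 ^ y) (trans (S-const b n 1) (*-identityʳ B)) ⟩
    B * 2 ^ y                               ≡⟨ cong (B *_) (sym (suc-odds y)) ⟩
    B * suc (odds y)                        ≡⟨ eq B (odds y) ⟩
    odds y * B + B ∎)
    where
    open ≤-Reasoning
    eq : ∀ B o → B * (1 + o) ≡ o * B + B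
    eq = solve-∀
    eq₂ : ∀ s y c → s * y * c ≡ c * (s * y)
    eq₂ = solve-∀
    S-hits : B ≤ S b hits * 2 ^ y
    S-hits = *-cancelˡ-≤ (2 ^ c) {{m^n≢0 2 c}} (begin
      2 ^ c * B                                                 ≤⟨ *-monoˡ-≤ B C≥ ⟩
      cnt C * B                                                 ≡⟨ sym (∑-*ʳ (⟦_⟧ ∘ C) B) ⟩
      ∑ (λ x → ⟦ C x ⟧ * B)                                     ≤⟨ ∑-mono term ⟩
      ∑ (λ x → S b (λ m → ⟦ C x ⟧ * cyl (con x) m) * 2 ^ (suc j′ + κ))
        ≡⟨ ∑-*ʳ (λ x → S b (λ m → ⟦ C x ⟧ * cyl (con x) m)) (2 ^ (suc j′ + κ)) ⟩
      ∑ (λ x → S b (λ m → ⟦ C x ⟧ * cyl (con x) m)) * 2 ^ (suc j′ + κ)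
        ≡⟨ cong₂ (λ p q → p * 2 ^ q) (sym (S-∑ b (λ x m → ⟦ C x ⟧ * cyl (con x) m))) (sym y+c) ⟩
      S b hits * 2 ^ (y + c)                                    ≡⟨ cong (S b hits *_) (^-distribˡ-+-* 2 y c) ⟩
      S b hits * (2 ^ y * 2 ^ c)                                ≡⟨ trans (sym (*-assoc (S b hits) (2 ^ y) (2 ^ c))) (eq₂ (S b hits) (2 ^ y) (2 ^ c)) ⟩
      2 ^ c * (S b hits * 2 ^ y) ∎)
      where
      term : ∀ x → ⟦ C x ⟧ * B ≤ S b (λ m → ⟦ C x ⟧ * cyl (con x) m) * 2 ^ (suc j′ + κ)
      term x with C x in eq
      ... | false = z≤n
      ... | true  = begin
        1 * B                                             ≡⟨ *-identityˡ B ⟩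
        B                                                 ≤⟨ S-cyl-≥ κ j′ (con x) (one x eq) (few x eq) ⟩
        S b (cyl (con x)) * 2 ^ (suc j′ + κ)              ≡⟨ cong (_* 2 ^ (suc j′ + κ)) (sym (S-1* b (cyl (con x)))) ⟩
        S b (λ m → 1 * cyl (con x) m) * 2 ^ (suc j′ + κ) ∎

-- Rooted trees

-- Being a tree enters the probabilistic analysis only through this structure. The value of `par` at
-- a root is arbitrary.
record Rooted {n : ℕ} (G : Graph n) : Set where
  field
    par  : Fin n → Fin n
    dep  : Fin n → ℕ
    edge : ∀ u v → adj G u v ≡ true → (par v ≡ u × dep v ≡ suc (dep u)) ⊎ (par u ≡ v × dep u ≡ suc (dep v))

least : ∀ {P : ℕ → Set} → (∀ k → Dec (P k)) → ∀ k → P k → ∃[ d ] (P d × (∀ i → P i → d ≤ i))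
least {P} P? zero    p = zero , p , (λ _ _ → z≤n)
least {P} P? (suc k) p with P? zero
... | yes p₀ = zero , p₀ , (λ _ _ → z≤n)
... | no ¬p₀ with least {P ∘ suc} (P? ∘ suc) k p
...   | d , q , min = suc d , q , (λ { zero r → contradiction r ¬p₀ ; (suc i) r → s≤s (min i r) })

Reach? : ∀ {n} (G : Graph n) k u v → Dec (Reach G k u v)
Reach? G zero u v with u ≟ v
... | yes refl = yes here
... | no u≢v   = no (λ { here → u≢v refl })
Reach? {n} G (suc k) u v with u ≟ v
... | yes refl = yes here
... | no u≢v with true? (any (λ w → adj G u w ∧ does (Reach? G k w v)))
...   | inj₁ p with any⁻ _ p
...     | w , q = yes (step (proj₁ (∧⁻ q)) (does⁻ (Reach? G k w v) (proj₂ (∧⁻ {adj G u w} q))))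
Reach? G (suc k) u v | no u≢v | inj₂ p = no λ
  { here → u≢v refl
  ; (step {w = w} a r) → true≢false (any⁺ _ w (∧⁺ a (dec-true (Reach? G k w v) r))) p }

module _ {n : ℕ} (G : Graph n) where

  private
    last-∷ʳ : ∀ (x : Fin n) xs z → lastOf x (xs ∷ʳ z) ≡ z
    last-∷ʳ x []       z = refl
    last-∷ʳ x (y ∷ xs) z = last-∷ʳ y xs z

    path-∷ʳ : ∀ x xs z → IsPath G (x ∷ xs) → adj G (lastOf x xs) z ≡ true → IsPath G (x ∷ (xs ∷ʳ z))
    path-∷ʳ x []       z _       a = a , tt
    path-∷ʳ x (y ∷ xs) z (b , p) a = b , path-∷ʳ y xs z p a

    unique-∷ʳ : ∀ (xs : List (Fin n)) z → Unique xs → All (_≢ z) xs → Unique (xs ∷ʳ z)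
    unique-∷ʳ []       z []       []       = [] ∷ []
    unique-∷ʳ (x ∷ xs) z (d ∷ u) (e ∷ es) = All.∷ʳ⁺ d e ∷ unique-∷ʳ xs z u es

  -- Two distinct vertices of equal depth that are joined by a path staying at
  -- that depth or deeper would, walking up to the root, close a cycle.
  module _ (acyclic : Acyclic G) (dep : Fin n → ℕ)
           (up : ∀ v k → dep v ≡ suc k → ∃[ u ] (adj G v u ≡ true × dep u ≡ k))
           (root-unique : ∀ u v → dep u ≡ 0 → dep v ≡ 0 → u ≡ v) where

    no-level-path : ∀ k x y ys → dep x ≡ k → dep (lastOf y ys) ≡ k → x ≢ lastOf y ys →
                    All (λ z → k ≤ dep z) (x ∷ y ∷ ys) → Unique (x ∷ y ∷ ys) → IsPath G (x ∷ y ∷ ys) → ⊥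
    no-level-path zero    x y ys dx dy x≢y deeper uniq path = x≢y (root-unique _ _ dx dy)
    no-level-path (suc k) x y ys dx dy x≢y deeper uniq path with up x k dx | up (lastOf y ys) k dy
    ... | p , ap , dp | q , aq , dq with p ≟ q
    ...   | yes refl = acyclic p x y ys
              (All.map (fresh p dp) deeper ∷ uniq , (trans (adj-sym G p x) ap , path) , aq)
      where
      fresh : ∀ p → dep p ≡ k → ∀ {z} → suc k ≤ dep z → p ≢ z
      fresh p dp h refl = <-irrefl (sym dp) h
    ...   | no p≢q = no-level-path k p x (y ∷ (ys ∷ʳ q)) dp
              (trans (cong dep (last-∷ʳ y ys q)) dq) (λ e → p≢q (trans e (last-∷ʳ y ys q)))
              (≤-reflexive (sym dp) ∷ All.∷ʳ⁺ (All.map (≤-trans (n≤1+n k)) deeper) (≤-reflexive (sym dq)))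
              (All.∷ʳ⁺ (All.map (fresh p dp) deeper) p≢q ∷ unique-∷ʳ (x ∷ y ∷ ys) q uniq (All.map (λ h e → fresh q dq h (sym e)) deeper))
              (trans (adj-sym G p x) ap , path-∷ʳ x (y ∷ ys) q path aq)
      where
      fresh : ∀ p → dep p ≡ k → ∀ {z} → suc k ≤ dep z → p ≢ z
      fresh p dp h refl = <-irrefl (sym dp) h

-- Depth is the distance to vertex `zero` and changes by at most 1 along an edge. `no-level-path`
-- excludes an edge inside a level and a second neighbour one level up, so every edge joins a vertex
-- to its parent.
root-tree : ∀ {n} (G : Graph n) → IsTree G → Rooted G
root-tree {zero}  G _ = record { par = λ () ; dep = λ () ; edge = λ () }
root-tree {suc n} G (connected , acyclic) = record { par = par ; dep = dep ; edge = edge }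
  where
  dist : ∀ v → ∃[ d ] (Reach G d v zero × (∀ i → Reach G i v zero → d ≤ i))
  dist v = least (λ k → Reach? G k v zero) (proj₁ (connected v zero)) (proj₂ (connected v zero))

  dep : Fin (suc n) → ℕ
  dep v = proj₁ (dist v)

  dep-step : ∀ u v → adj G u v ≡ true → dep u ≤ suc (dep v)
  dep-step u v a = proj₂ (proj₂ (dist u)) (suc (dep v)) (step a (proj₁ (proj₂ (dist v))))

  up : ∀ v k → dep v ≡ suc k → ∃[ u ] (adj G v u ≡ true × dep u ≡ k)
  up v k e with subst (λ d → Reach G d v zero) e (proj₁ (proj₂ (dist v)))
  ... | here = contradiction (trans (sym e) (n≤0⇒n≡0 (proj₂ (proj₂ (dist zero)) 0 here))) (λ ())
  ... | step {w = w} a r = w , a , ≤-antisym (proj₂ (proj₂ (dist w)) k r) (≤-pred (subst (_≤ suc (dep w)) e (dep-step v w a)))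

  root-unique : ∀ u v → dep u ≡ 0 → dep v ≡ 0 → u ≡ v
  root-unique u v e f with dep u | proj₁ (proj₂ (dist u)) | dep v | proj₁ (proj₂ (dist v))
  root-unique u v refl refl | zero | here | zero | here = refl

  par′ : ∀ v d → dep v ≡ d → Fin (suc n)
  par′ v zero    e = v
  par′ v (suc k) e = proj₁ (up v k e)

  par : Fin (suc n) → Fin (suc n)
  par v = par′ v (dep v) refl

  adj-irr : ∀ {u v} → adj G u v ≡ true → u ≢ v
  adj-irr a refl = true≢false a (adj-irrefl G _)

  parent : ∀ u v → adj G v u ≡ true → dep v ≡ suc (dep u) → par v ≡ u
  parent u v a e = go (dep v) refl
    where
    go : ∀ d (q : dep v ≡ d) → par′ v d q ≡ u
    go zero    q = contradiction (trans (sym q) e) (λ ())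
    go (suc k) q with up v k q
    ... | w , aw , dw with w ≟ u
    ...   | yes w≡u = w≡u
    ...   | no w≢u  = ⊥-elim (no-level-path G acyclic dep up root-unique (dep u) w v (u ∷ []) dw′ refl w≢u
                (≤-reflexive (sym dw′) ∷ ≤-trans (n≤1+n (dep u)) (≤-reflexive (sym e)) ∷ ≤-refl ∷ [])
                ((adj-irr (trans (adj-sym G w v) aw) ∷ w≢u ∷ []) ∷ (adj-irr a ∷ []) ∷ [] ∷ [])
                (trans (adj-sym G w v) aw , a , tt))
      where
      dw′ : dep w ≡ dep u
      dw′ = trans dw (suc-injective (trans (sym q) e))

  edge : ∀ u v → adj G u v ≡ true → (par v ≡ u × dep v ≡ suc (dep u)) ⊎ (par u ≡ v × dep u ≡ suc (dep v))
  edge u v a with <-cmp (dep u) (dep v)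
  ... | tri< lt _ _ = inj₁ (parent u v a′ e , e)
    where
    a′ = trans (adj-sym G v u) a
    e = ≤-antisym (dep-step v u a′) lt
  ... | tri> _ _ gt = inj₂ (parent v u a e , e)
    where
    e = ≤-antisym (dep-step u v a) gt
  ... | tri≈ _ eq _ = ⊥-elim (no-level-path G acyclic dep up root-unique (dep u) u v [] refl (sym eq) (adj-irr a)
            (≤-refl ∷ ≤-reflexive eq ∷ []) ((adj-irr a ∷ []) ∷ [] ∷ []) (a , tt))

module Subtree {n : ℕ} {G : Graph n} (RT : Rooted G) where
  open Rooted RT public

  kid : Fin n → Fin n → Bool
  kid v w = adj G v w ∧ does (dep w Data.Nat.≟ suc (dep v))

  kid-adj : ∀ {v w} → kid v w ≡ true → adj G v w ≡ true
  kid-adj k = proj₁ (∧⁻ k)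

  kid-dep : ∀ {v w} → kid v w ≡ true → dep w ≡ suc (dep v)
  kid-dep {v} {w} k = does⁻ (dep w Data.Nat.≟ suc (dep v)) (proj₂ (∧⁻ {adj G v w} k))

  kid-par : ∀ {v w} → kid v w ≡ true → par w ≡ v
  kid-par {v} {w} k with edge v w (kid-adj k)
  ... | inj₁ (p , _) = p
  ... | inj₂ (_ , e) = contradiction (trans (kid-dep k) (cong suc e)) (λ q → <-irrefl q (≤-trans (n≤1+n _) ≤-refl))

  nbr-kid : ∀ {v w} → adj G v w ≡ true → kid v w ≡ true ⊎ w ≡ par v
  nbr-kid {v} {w} a with edge v w a
  ... | inj₁ (_ , e) = inj₁ (∧⁺ a (dec-true (dep w Data.Nat.≟ suc (dep v)) e))
  ... | inj₂ (p , _) = inj₂ (sym p)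

  up : ℕ → Fin n → Fin n
  up zero    v = v
  up (suc k) v = up k (par v)

  par-up : ∀ k v → par (up k v) ≡ up (suc k) v
  par-up zero    v = refl
  par-up (suc k) v = par-up k (par v)

  sub : Fin n → Fin n → Bool
  sub v u = does (dep v ≤? dep u) ∧ (up (dep u ∸ dep v) u == v)

  sub⁻ : ∀ {v u} → sub v u ≡ true → dep v ≤ dep u × up (dep u ∸ dep v) u ≡ v
  sub⁻ {v} {u} s = does⁻ (dep v ≤? dep u) (proj₁ (∧⁻ s)) , does⁻ (_ ≟ v) (proj₂ (∧⁻ {does (dep v ≤? dep u)} s))

  sub⁺ : ∀ {v u} → dep v ≤ dep u → up (dep u ∸ dep v) u ≡ v → sub v u ≡ true
  sub⁺ {v} {u} p q = ∧⁺ (dec-true (dep v ≤? dep u) p) (dec-true (_ ≟ v) q)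

  sub-refl : ∀ v → sub v v ≡ true
  sub-refl v = sub⁺ ≤-refl (cong (λ k → up k v) (n∸n≡0 (dep v)))

  sub-kid : ∀ {v u w} → sub v u ≡ true → kid u w ≡ true → sub v w ≡ true
  sub-kid {v} {u} {w} s k with sub⁻ s
  ... | p , q = sub⁺ (≤-trans p (≤-trans (n≤1+n _) (≤-reflexive (sym e))))
                     (trans (cong (λ d → up d w) (trans (cong (_∸ dep v) e) (+-∸-assoc 1 p)))
                            (trans (cong (up (dep u ∸ dep v)) (kid-par k)) q))
    where
    e = kid-dep k

  sub-up : ∀ {v c u} → kid v c ≡ true → sub c u ≡ true → sub v u ≡ true
  sub-up {v} {c} {u} k s with sub⁻ s
  ... | p , q = sub⁺ (≤-trans (n≤1+n _) p′)
                     (trans (cong (λ d → up d u) e) (trans (sym (par-up (dep u ∸ dep c) u)) (trans (cong par q) (kid-par k))))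
    where
    p′ : suc (dep v) ≤ dep u
    p′ = subst (_≤ dep u) (kid-dep k) p
    e : dep u ∸ dep v ≡ suc (dep u ∸ dep c)
    e = trans (+-∸-assoc 1 p′) (cong (λ d → suc (dep u ∸ d)) (sym (kid-dep k)))

  -- A common descendant has only one ancestor at the depth that the two siblings share.
  sub-disjoint : ∀ {v c c′ u} → kid v c ≡ true → kid v c′ ≡ true → c ≢ c′ → sub c u ≡ true → sub c′ u ≡ false
  sub-disjoint {v} {c} {c′} {u} k k′ c≢c′ s = ¬true λ s′ →
    c≢c′ (trans (sym (proj₂ (sub⁻ s))) (trans (cong (λ d → up (dep u ∸ d) u) (trans (kid-dep k) (sym (kid-dep k′)))) (proj₂ (sub⁻ s′))))

-- The algorithm and its correctness when the peeling succeeds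

-- `mark j` is a marking step of rate 2^-j. `aside D` deactivates the vertices with at least D
-- active neighbours; they can still be covered later, or else take part in the peeling.
data Op : Set where
  mark aside : ℕ → Op

Ω : ℕ → List Op → Set
Ω n []              = ⊤
Ω n (mark j ∷ ops)  = Vec Bool n × Ω n ops
Ω n (aside D ∷ ops) = Ω n ops

odd : ℕ → Bool
odd zero    = false
odd (suc a) = not (odd a)

same : Bool → Bool → Bool
same true  a = a
same false a = not a

-- Cole–Vishkin: twice the position of the lowest bit where a and b differ, plus
-- that bit of a. The first argument is fuel and must bound the bit length.
cv : ℕ → ℕ → ℕ → ℕ
cv zero    a b = 0
cv (suc F) a b = if same (odd a) (odd b) then 2 + cv F ⌊ a /2⌋ ⌊ b /2⌋ else ⟦ odd a ⟧

nth : ∀ {n} → ℕ → (Fin n → Bool) → Maybe (Fin n)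
nth {zero}  k       P = nothing
nth {suc n} zero    P = if P zero then just zero else Maybe.map suc (nth zero (P ∘ suc))
nth {suc n} (suc k) P = Maybe.map suc (nth (if P zero then k else suc k) (P ∘ suc))

Colour : Set
Colour = ℕ × ℕ

_≟ᶜ_ : (x y : Colour) → Dec (x ≡ y)
_≟ᶜ_ = ≡-dec Data.Nat._≟_ Data.Nat._≟_

abstract
  -- Three bits per coordinate, the length at which the colour reduction stalls. Abstract, so that
  -- `length palette` stays symbolic in the round counts.
  palette : List Colour
  palette = cartesianProduct (upTo 8) (upTo 8)

  palette⁺ : ∀ {a b} → a < 8 → b < 8 → (a , b) ∈ palette
  palette⁺ p q = ∈-cartesianProduct⁺ (∈-upTo⁺ p) (∈-upTo⁺ q)

module Algorithm {n : ℕ} (G : Graph n) where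

  VSet : Set
  VSet = Fin n → Bool

  nb : VSet → VSet
  nb P v = any (λ u → adj G v u ∧ P u)

  deg : VSet → Fin n → ℕ
  deg P v = cnt (λ u → adj G v u ∧ P u)

  near1 near2 : VSet → VSet
  near1 P v = P v ∨ nb P v
  near2 P = near1 (near1 P)

  -- (M , R): the vertices chosen so far and the vertices still active.
  State : Set
  State = VSet × VSet

  part : ℕ → VSet → VSet
  part j R v = R v ∧ does (deg R v ≤? 2 ^ j)

  joins : ℕ → VSet → Vec Bool n → VSet
  joins j R m v = part j R v ∧ (lookup m v ∧ not (nb (λ u → part j R u ∧ lookup m u) v))

  shrink : ℕ → VSet → Vec Bool n → VSet
  shrink j R m v = R v ∧ not (near2 (joins j R m) v)

  keep : ℕ → VSet → VSet
  keep D R v = R v ∧ does (deg R v <? D)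

  run : ∀ ops → State → Ω n ops → State
  run []              st      _       = st
  run (mark j ∷ ops)  (M , R) (m , ω) = run ops ((λ v → M v ∨ joins j R m v) , shrink j R m) ω
  run (aside D ∷ ops) (M , R) ω       = run ops (M , keep D R) ω

  peel : VSet → VSet
  peel A v = A v ∧ does (2 <? deg A v)

  peels : ℕ → VSet → VSet
  peels zero    A = A
  peels (suc t) A = peels t (peel A)

  -- The out-neighbours of v are its neighbours still present when v is removed; adjacent vertices
  -- removed in the same round point at each other.
  out : ℕ → VSet → Fin n → VSet
  out zero    A v u = false
  out (suc t) A v u = if A v ∧ not (peel A v) then adj G v u ∧ A u else out t (peel A) v u

  cols : ℕ → (Fin n → Maybe (Fin n)) → ℕ → Fin n → ℕ
  cols F p zero    v = toℕ v
  -- A vertex without pointer acts as if it pointed to a colour that differs from its own in the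
  -- lowest bit.
  cols F p (suc k) v = maybe (λ u → cv F (cols F p k v) (cols F p k u)) ⟦ odd (cols F p k v) ⟧ (p v)

  sweep : List Colour → (Fin n → Colour) → VSet → VSet → VSet
  sweep []       col Q I = I
  sweep (x ∷ xs) col Q I = sweep xs col Q (λ v → I v ∨ (Q v ∧ (does (col v ≟ᶜ x) ∧ not (nb I v))))

  -- Out-degree 2 splits the orientation into two pointer functions, the first and the second
  -- out-neighbour. Each is coloured on its own, and every edge is separated by one of the two
  -- coordinates.
  colour : ℕ → ℕ → ℕ → VSet → Fin n → Colour
  colour t F K Q v = cols F (λ v → nth 0 (out t Q v)) K v , cols F (λ v → nth 1 (out t Q v)) K v

  finish : ℕ → ℕ → ℕ → VSet → VSet
  finish t F K M v = M v ∨ sweep palette (colour t F K Q) Q (λ _ → false) v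
    where
    Q : VSet
    Q u = not (near2 M u)

-- Cole-Vishkin colour reduction

odd-half-injective : ∀ a b → odd a ≡ odd b → ⌊ a /2⌋ ≡ ⌊ b /2⌋ → a ≡ b
odd-half-injective zero          zero          _ _ = refl
odd-half-injective zero          (suc zero)    () _
odd-half-injective zero          (suc (suc b)) _ ()
odd-half-injective (suc zero)    zero          () _
odd-half-injective (suc zero)    (suc zero)    _ _ = refl
odd-half-injective (suc zero)    (suc (suc b)) _ ()
odd-half-injective (suc (suc a)) zero          _ ()
odd-half-injective (suc (suc a)) (suc zero)    _ ()
odd-half-injective (suc (suc a)) (suc (suc b)) p q =
  cong (2 +_) (odd-half-injective a b (not-inj (not-inj p)) (Data.Nat.Properties.suc-injective q))
  where
  not-inj : ∀ {x y} → not x ≡ not y → x ≡ y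
  not-inj {true}  {true}  _ = refl
  not-inj {false} {false} _ = refl

half-< : ∀ a x → a < 2 * x → ⌊ a /2⌋ < x
half-< a (suc x) h = s≤s (≤-trans (⌊n/2⌋-mono (≤-pred h)) (≤-reflexive (eq x)))
  where
  eq : ∀ x → ⌊ x + suc (x + 0) /2⌋ ≡ x
  eq x = trans (cong ⌊_/2⌋ (trans (+-suc x (x + 0)) (cong (λ y → suc (x + y)) (+-identityʳ x)))) (h₂ x)
    where
    h₂ : ∀ x → ⌊ suc (x + x) /2⌋ ≡ x
    h₂ zero    = refl
    h₂ (suc x) = trans (cong (λ y → ⌊ suc (suc y) /2⌋) (+-suc x x)) (cong suc (h₂ x))

same⁻ : ∀ a b → same a b ≡ true → a ≡ b
same⁻ true  true  _ = refl
same⁻ false false _ = refl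

same-refl : ∀ a → same a a ≡ true
same-refl true  = refl
same-refl false = refl

⟦⟧-injective : ∀ a b → ⟦ a ⟧ ≡ ⟦ b ⟧ → a ≡ b
⟦⟧-injective true  true  _ = refl
⟦⟧-injective false false _ = refl

⟦⟧≢2+ : ∀ a {k} → ⟦ a ⟧ ≢ 2 + k
⟦⟧≢2+ true  ()
⟦⟧≢2+ false ()

-- Here b is the colour of a vertex without pointer, whose new colour is its lowest bit: `cv` is at
-- least 2 if a shares this bit and is the opposite bit otherwise.
cv-root : ∀ F a b → a < 2 ^ F → b < 2 ^ F → a ≢ b → cv F a b ≢ ⟦ odd b ⟧
cv-root zero    a b a< b< a≢b _ = a≢b (trans (n<1⇒n≡0 a<) (sym (n<1⇒n≡0 b<)))
cv-root (suc F) a b a< b< a≢b e with same (odd a) (odd b) in eq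
... | true  = ⟦⟧≢2+ (odd b) (sym e)
... | false = true≢false (subst (λ x → same (odd a) x ≡ true) (⟦⟧-injective _ _ e) (same-refl (odd a))) eq

-- Equal new colours would name the same position and the same bit there for a and b, although a and
-- b differ at this position.
cv-proper : ∀ F a b c → a < 2 ^ F → b < 2 ^ F → c < 2 ^ F → a ≢ b → b ≢ c → cv F a b ≢ cv F b c
cv-proper zero    a b c a< b< c< a≢b _ _ = a≢b (trans (n<1⇒n≡0 a<) (sym (n<1⇒n≡0 b<)))
cv-proper (suc F) a b c a< b< c< a≢b b≢c e with same (odd a) (odd b) in eq | same (odd b) (odd c) in eq′
... | true  | true  = cv-proper F ⌊ a /2⌋ ⌊ b /2⌋ ⌊ c /2⌋ (half-< a _ a<) (half-< b _ b<) (half-< c _ c<)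
                        (λ q → a≢b (odd-half-injective a b (same⁻ _ _ eq) q))
                        (λ q → b≢c (odd-half-injective b c (same⁻ _ _ eq′) q))
                        (+-cancelˡ-≡ 2 _ _ e)
... | true  | false = ⟦⟧≢2+ (odd b) (sym e)
... | false | true  = ⟦⟧≢2+ (odd a) e
... | false | false = true≢false (subst (λ x → same (odd a) x ≡ true) (⟦⟧-injective _ _ e) (same-refl (odd a))) eq

-- f is the actual bit length and F the fuel, which stays the same while the colours shrink. The
-- first difference sits at a position below f.
cv-< : ∀ F f a b → f ≤ F → a < 2 ^ f → b < 2 ^ f → a ≢ b → cv F a b < 2 * f
cv-< F       zero    a b f≤ a< b< a≢b = ⊥-elim (a≢b (trans (n<1⇒n≡0 a<) (sym (n<1⇒n≡0 b<))))
cv-< (suc F) (suc f) a b (s≤s f≤) a< b< a≢b with same (odd a) (odd b) in eq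
... | true  = subst (suc (suc (suc (cv F ⌊ a /2⌋ ⌊ b /2⌋))) ≤_) (sym (*-suc 2 f))
                (s≤s (s≤s (cv-< F f ⌊ a /2⌋ ⌊ b /2⌋ f≤ (half-< a _ a<) (half-< b _ b<)
                        (λ q → a≢b (odd-half-injective a b (same⁻ _ _ eq) q)))))
... | false = ≤-trans (s≤s (⟦⟧≤1 (odd a))) (subst (2 ≤_) (sym (*-suc 2 f)) (s≤s (s≤s z≤n)))

nth-complete : ∀ {n} (P : Fin n → Bool) u K → P u ≡ true → cnt P ≤ K → ∃[ k ] (k < K × nth k P ≡ just u)
nth-complete {suc n} P zero    zero    p h rewrite p = contradiction h (λ ())
nth-complete {suc n} P zero    (suc K) p h = 0 , s≤s z≤n , e
  where
  e : nth 0 P ≡ just zero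
  e rewrite p = refl
nth-complete {suc n} P (suc u) K p h with true? (P zero)
nth-complete {suc n} P (suc u) zero    p h | inj₁ q rewrite q = contradiction h (λ ())
nth-complete {suc n} P (suc u) (suc K) p h | inj₁ q with nth-complete (P ∘ suc) u K p (≤-pred (subst (λ b → ⟦ b ⟧ + cnt (P ∘ suc) ≤ suc K) q h))
... | k , k< , e = suc k , s≤s k< , e′
  where
  e′ : nth (suc k) P ≡ just (suc u)
  e′ rewrite q | e = refl
nth-complete {suc n} P (suc u) K p h | inj₂ q with nth-complete (P ∘ suc) u K p (subst (λ b → ⟦ b ⟧ + cnt (P ∘ suc) ≤ K) q h)
... | zero , k< , e = zero , k< , e′
  where
  e′ : nth zero P ≡ just (suc u)
  e′ rewrite q | e = refl
... | suc k , k< , e = suc k , k< , e′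
  where
  e′ : nth (suc k) P ≡ just (suc u)
  e′ rewrite q | e = refl

nth-sound : ∀ {n} (P : Fin n → Bool) u k → nth k P ≡ just u → P u ≡ true
nth-sound {suc n} P u zero e with P zero in eq
nth-sound {suc n} P .zero zero refl | true = eq
nth-sound {suc n} P u zero e | false with nth zero (P ∘ suc) in eq′
nth-sound {suc n} P .(suc w) zero refl | false | just w = nth-sound (P ∘ suc) w zero eq′
nth-sound {suc n} P u (suc k) e with nth (if P zero then k else suc k) (P ∘ suc) in eq′
nth-sound {suc n} P .(suc w) (suc k) refl | just w = nth-sound (P ∘ suc) w _ eq′

-- Independence and domination once the peeling has removed everything

module Correctness {n : ℕ} (G : Graph n) where
  open Algorithm G

  adj-swap : ∀ {u v} → adj G u v ≡ true → adj G v u ≡ true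
  adj-swap {u} {v} a = trans (adj-sym G v u) a

  nb⁺ : ∀ P {v u} → adj G v u ≡ true → P u ≡ true → nb P v ≡ true
  nb⁺ P {v} {u} a p = any⁺ (λ u → adj G v u ∧ P u) u (∧⁺ a p)

  nb⁻ : ∀ P {v} → nb P v ≡ true → ∃[ u ] (adj G v u ≡ true × P u ≡ true)
  nb⁻ P {v} h with any⁻ (λ u → adj G v u ∧ P u) h
  ... | u , q = u , ∧⁻ q

  deg-mono : ∀ {P Q : VSet} v → (∀ u → P u ≡ true → Q u ≡ true) → deg P v ≤ deg Q v
  deg-mono {P} {Q} v h = cnt-mono (λ u q → ∧⁺ (proj₁ (∧⁻ q)) (h u (proj₂ (∧⁻ {adj G v u} q))))

  near1-self : ∀ P {v} → P v ≡ true → near1 P v ≡ true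
  near1-self P p = ∨⁺ˡ p

  near1-nb : ∀ P {v u} → adj G v u ≡ true → P u ≡ true → near1 P v ≡ true
  near1-nb P {v} a p = ∨⁺ʳ (P v) (nb⁺ P a p)

  near1-mono : ∀ {P Q : VSet} → (∀ u → P u ≡ true → Q u ≡ true) → ∀ v → near1 P v ≡ true → near1 Q v ≡ true
  near1-mono {P} {Q} h v p with ∨⁻ {P v} p
  ... | inj₁ q = near1-self Q (h v q)
  ... | inj₂ q with nb⁻ P q
  ...   | u , a , r = near1-nb Q a (h u r)

  near2-mono : ∀ {P Q : VSet} → (∀ u → P u ≡ true → Q u ≡ true) → ∀ v → near2 P v ≡ true → near2 Q v ≡ true
  near2-mono h = near1-mono (near1-mono h)

  near2-cover : ∀ P v → near2 P v ≡ true → ∃[ u ] (P u ≡ true × Reach G 2 u v)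
  near2-cover P v h with ∨⁻ {near1 P v} h
  ... | inj₁ q with ∨⁻ {P v} q
  ...   | inj₁ p = v , p , here
  ...   | inj₂ p with nb⁻ P p
  ...     | u , a , r = u , r , step (adj-swap a) here
  near2-cover P v h | inj₂ q with nb⁻ (near1 P) q
  ... | w , a , r with ∨⁻ {P w} r
  ...   | inj₁ p = w , p , step (adj-swap a) here
  ...   | inj₂ p with nb⁻ P p
  ...     | u , b , s = u , s , step (adj-swap b) (step (adj-swap a) here)

  near2-∨ : ∀ P Q v → near2 (λ u → P u ∨ Q u) v ≡ true → near2 P v ≡ true ⊎ near2 Q v ≡ true
  near2-∨ P Q v h = near1-∨ (near1 P) (near1 Q) v (near1-mono (λ u p → [ ∨⁺ˡ , ∨⁺ʳ (near1 P u) ]′ (near1-∨ P Q u p)) v h)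
    where
    near1-∨ : ∀ P Q v → near1 (λ u → P u ∨ Q u) v ≡ true → near1 P v ≡ true ⊎ near1 Q v ≡ true
    near1-∨ P Q v h with ∨⁻ {P v ∨ Q v} h
    ... | inj₁ q = Data.Sum.map (near1-self P) (near1-self Q) (∨⁻ {P v} q)
    ... | inj₂ q with nb⁻ (λ u → P u ∨ Q u) q
    ...   | u , a , r = Data.Sum.map (near1-nb P a) (near1-nb Q a) (∨⁻ {P u} r)

  -- Active vertices are uncovered and so have no neighbour in `M`; hence whoever joins later is
  -- independent of the earlier members.
  Valid : State → Set
  Valid (M , R) = Independent G M × (∀ v → R v ≡ true → near2 M v ≡ false)

  joins-active : ∀ j R m v → joins j R m v ≡ true → R v ≡ true
  joins-active j R m v p = proj₁ (∧⁻ (proj₁ (∧⁻ p)))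

  run-valid : ∀ ops st ω → Valid st → Independent G (proj₁ (run ops st ω))
  run-valid []              st      _       (ind , _) = ind
  run-valid (aside D ∷ ops) (M , R) ω       (ind , unc) = run-valid ops (M , keep D R) ω (ind , λ v p → unc v (proj₁ (∧⁻ p)))
  run-valid (mark j ∷ ops)  (M , R) (m , ω) (ind , unc) = run-valid ops (M′ , shrink j R m) ω (ind′ , unc′)
    where
    J M′ : VSet
    J = joins j R m
    M′ v = M v ∨ J v
    apart : ∀ u v → adj G u v ≡ true → M u ≡ true → J v ≡ true → ⊥
    apart u v a p q = true≢false (near1-self (near1 M) (near1-nb M (adj-swap a) p)) (unc v (joins-active j R m v q))
    ind′ : Independent G M′
    ind′ u v a (p , q) with ∨⁻ {M u} p | ∨⁻ {M v} q
    ... | inj₁ x | inj₁ y = ind u v a (x , y)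
    ... | inj₁ x | inj₂ y = apart u v a x y
    ... | inj₂ x | inj₁ y = apart v u (adj-swap a) y x
    ... | inj₂ x | inj₂ y = true≢false
            (nb⁺ (λ u → part j R u ∧ lookup m u) a (∧⁺ {part j R v} (proj₁ (∧⁻ y)) (proj₁ (∧⁻ {lookup m v} (proj₂ (∧⁻ {part j R v} y))))))
            (not⁻ (proj₂ (∧⁻ {lookup m u} (proj₂ (∧⁻ {part j R u} x)))))
    unc′ : ∀ v → shrink j R m v ≡ true → near2 M′ v ≡ false
    unc′ v p = ¬true λ q → case near2-∨ M J v q of λ
      { (inj₁ r) → true≢false r (unc v (proj₁ (∧⁻ p)))
      ; (inj₂ r) → true≢false r (not⁻ (proj₂ (∧⁻ {R v} p))) }

  module Sweep (col : Fin n → Colour) (Q : VSet)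
               (proper : ∀ u v → adj G u v ≡ true → Q u ≡ true → Q v ≡ true → col u ≢ col v) where

    private
      next : Colour → VSet → VSet
      next x I v = I v ∨ (Q v ∧ (does (col v ≟ᶜ x) ∧ not (nb I v)))

      new : ∀ x I v → (Q v ∧ (does (col v ≟ᶜ x) ∧ not (nb I v))) ≡ true → Q v ≡ true × col v ≡ x × nb I v ≡ false
      new x I v p = proj₁ (∧⁻ p) , does⁻ (col v ≟ᶜ x) (proj₁ (∧⁻ r)) , not⁻ (proj₂ (∧⁻ {does (col v ≟ᶜ x)} r))
        where
        r = proj₂ (∧⁻ {Q v} p)

      next-ind : ∀ x I → Independent G I → Independent G (next x I)
      next-ind x I ind u v a (p , q) with ∨⁻ {I u} p | ∨⁻ {I v} q
      ... | inj₁ r | inj₁ s = ind u v a (r , s)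
      ... | inj₁ r | inj₂ s = true≢false (nb⁺ I (adj-swap a) r) (proj₂ (proj₂ (new x I v s)))
      ... | inj₂ r | inj₁ s = true≢false (nb⁺ I a s) (proj₂ (proj₂ (new x I u r)))
      ... | inj₂ r | inj₂ s with new x I u r | new x I v s
      ...   | Qu , cu , _ | Qv , cv′ , _ = proper u v a Qu Qv (trans cu (sym cv′))

    sweep-ind : ∀ xs I → Independent G I → Independent G (sweep xs col Q I)
    sweep-ind []       I ind = ind
    sweep-ind (x ∷ xs) I ind = sweep-ind xs (next x I) (next-ind x I ind)

    sweep-⊆ : ∀ xs I → (∀ v → I v ≡ true → Q v ≡ true) → ∀ v → sweep xs col Q I v ≡ true → Q v ≡ true
    sweep-⊆ []       I h = h
    sweep-⊆ (x ∷ xs) I h = sweep-⊆ xs (next x I) λ v p → case ∨⁻ {I v} p of λ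
      { (inj₁ q) → h v q ; (inj₂ q) → proj₁ (new x I v q) }

    private
      sweep-keeps : ∀ xs I v → near1 I v ≡ true → near1 (sweep xs col Q I) v ≡ true
      sweep-keeps []       I v p = p
      sweep-keeps (x ∷ xs) I v p = sweep-keeps xs (next x I) v (near1-mono (λ u q → ∨⁺ˡ q) v p)

    sweep-dom : ∀ xs I v → Q v ≡ true → col v ∈ xs → near1 (sweep xs col Q I) v ≡ true
    sweep-dom (x ∷ xs) I v Qv (there h) = sweep-dom xs (next x I) v Qv h
    sweep-dom (x ∷ xs) I v Qv (here e) = sweep-keeps xs (next x I) v now
      where
      now : near1 (next x I) v ≡ true
      now with true? (nb I v)
      ... | inj₁ p = near1-mono (λ u q → ∨⁺ˡ q) v (∨⁺ʳ (I v) p)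
      ... | inj₂ p = near1-self (next x I) (∨⁺ʳ (I v) (∧⁺ Qv (∧⁺ (dec-true (col v ≟ᶜ x) e) (cong not p))))

  out-adj : ∀ t A v u → out t A v u ≡ true → adj G v u ≡ true
  out-adj (suc t) A v u p with A v ∧ not (peel A v)
  ... | true  = proj₁ (∧⁻ p)
  ... | false = out-adj t (peel A) v u p

  out-cnt : ∀ t A v → cnt (out t A v) ≤ 2
  out-cnt zero    A v = ≤-trans (≤-reflexive (trans (∑-const n 0) (*-zeroʳ n))) z≤n
  out-cnt (suc t) A v with A v ∧ not (peel A v) in eq
  ... | false = out-cnt t (peel A) v
  ... | true  = ≮⇒≥ λ h → true≢false (∧⁺ (proj₁ (∧⁻ eq)) (dec-true (2 <? deg A v) h)) (not⁻ (proj₂ (∧⁻ {A v} eq)))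

  -- In the first round that removes u or v, the other endpoint is still present and becomes an
  -- out-neighbour.
  out-complete : ∀ t A → (∀ v → peels t A v ≡ false) → ∀ u v → adj G u v ≡ true → A u ≡ true → A v ≡ true →
                 out t A u v ≡ true ⊎ out t A v u ≡ true
  out-complete zero    A e u v a p q = ⊥-elim (true≢false p (e u))
  out-complete (suc t) A e u v a p q with true? (peel A u) | true? (peel A v)
  ... | inj₂ x | _ = inj₁ h
    where
    h : out (suc t) A u v ≡ true
    h rewrite x | p | a | q = refl
  ... | inj₁ _ | inj₂ y = inj₂ h
    where
    h : out (suc t) A v u ≡ true
    h rewrite y | q | adj-swap a | p = refl
  ... | inj₁ x | inj₁ y with out-complete t (peel A) e u v a x y
  ...   | inj₁ r = inj₁ h
    where
    h : out (suc t) A u v ≡ true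
    h rewrite p | x = r
  ...   | inj₂ r = inj₂ h
    where
    h : out (suc t) A v u ≡ true
    h rewrite q | y = r

  module Cols (F : ℕ) (n≤ : n ≤ 2 ^ F) (p : Fin n → Maybe (Fin n)) (loopless : ∀ v u → p v ≡ just u → v ≢ u)
              (w : ℕ → ℕ) (w₀ : w 0 ≡ F) (w≤ : ∀ k → w k ≤ F) (w≥ : ∀ k → 1 ≤ w k) (w-suc : ∀ k → 2 * w k ≤ 2 ^ w (suc k)) where

    cols-ok : ∀ k → (∀ v → cols F p k v < 2 ^ w k) × (∀ v u → p v ≡ just u → cols F p k v ≢ cols F p k u)
    cols-ok zero    = (λ v → ≤-trans (toℕ<n v) (subst (λ f → n ≤ 2 ^ f) (sym w₀) n≤)) , (λ v u e q → loopless v u e (toℕ-injective q))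
    cols-ok (suc k) with cols-ok k
    ... | bound , prop = bound′ , prop′
      where
      bd : ∀ v → cols F p k v < 2 ^ F
      bd v = ≤-trans (bound v) (^-monoʳ-≤ 2 (w≤ k))
      bound′ : ∀ v → cols F p (suc k) v < 2 ^ w (suc k)
      bound′ v with p v in eq
      ... | nothing = ≤-trans (s≤s (⟦⟧≤1 (odd (cols F p k v)))) (≤-trans (*-monoʳ-≤ 2 (w≥ k)) (w-suc k))
      ... | just u  = ≤-trans (cv-< F (w k) _ _ (w≤ k) (bound v) (bound u) (prop v u eq)) (w-suc k)
      prop′ : ∀ v u → p v ≡ just u → cols F p (suc k) v ≢ cols F p (suc k) u
      prop′ v u e rewrite e with p u in eq
      ... | nothing = cv-root F _ _ (bd v) (bd u) (prop v u e)
      ... | just x  = cv-proper F _ _ _ (bd v) (bd u) (bd x) (prop v u e) (prop u x eq)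

  module Finish (t F K : ℕ) (n≤ : n ≤ 2 ^ F) (w : ℕ → ℕ) (w₀ : w 0 ≡ F) (w≤ : ∀ k → w k ≤ F) (w≥ : ∀ k → 1 ≤ w k)
                (w-suc : ∀ k → 2 * w k ≤ 2 ^ w (suc k)) (wK : w K ≤ 3)
                (M : VSet) (M-ind : Independent G M) (peeled : ∀ v → peels t (λ u → not (near2 M u)) v ≡ false) where
    private
      Q : VSet
      Q u = not (near2 M u)

      p : ℕ → Fin n → Maybe (Fin n)
      p i v = nth i (out t Q v)

      loopless : ∀ i v u → p i v ≡ just u → v ≢ u
      loopless i v u e refl = true≢false (out-adj t Q v v (nth-sound (out t Q v) v i e)) (adj-irrefl G v)

      module C i = Cols F n≤ (p i) (loopless i) w w₀ w≤ w≥ w-suc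

      col : Fin n → Colour
      col = colour t F K Q

      oriented : ∀ u v → out t Q u v ≡ true → col u ≢ col v
      oriented u v o with nth-complete (out t Q u) v 2 o (out-cnt t Q u)
      ... | zero        , _ , e = λ q → proj₂ (C.cols-ok 0 K) u v e (cong proj₁ q)
      ... | suc zero    , _ , e = λ q → proj₂ (C.cols-ok 1 K) u v e (cong proj₂ q)
      ... | suc (suc _) , s≤s (s≤s ()) , _

      proper : ∀ u v → adj G u v ≡ true → Q u ≡ true → Q v ≡ true → col u ≢ col v
      proper u v a Qu Qv with out-complete t Q peeled u v a Qu Qv
      ... | inj₁ o = oriented u v o
      ... | inj₂ o = λ q → oriented v u o (sym q)

      in-palette : ∀ v → col v ∈ palette
      in-palette v = palette⁺ (bd 0) (bd 1)
        where
        bd : ∀ i → cols F (p i) K v < 8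
        bd i = ≤-trans (proj₁ (C.cols-ok i K) v) (^-monoʳ-≤ 2 wK)

      open Sweep col Q proper

      I : VSet
      I = sweep palette col Q (λ _ → false)

      I⊆Q : ∀ v → I v ≡ true → Q v ≡ true
      I⊆Q = sweep-⊆ palette (λ _ → false) (λ _ ())

      apart : ∀ u v → adj G u v ≡ true → M u ≡ true → I v ≡ true → ⊥
      apart u v a x y = true≢false (near1-self (near1 M) (near1-nb M (adj-swap a) x)) (not⁻ (I⊆Q v y))

    finish-ruling : IsRulingSet 2 G (finish t F K M)
    finish-ruling = ind , dom
      where
      ind : Independent G (finish t F K M)
      ind u v a (x , y) with ∨⁻ {M u} x | ∨⁻ {M v} y
      ... | inj₁ x′ | inj₁ y′ = M-ind u v a (x′ , y′)
      ... | inj₁ x′ | inj₂ y′ = apart u v a x′ y′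
      ... | inj₂ x′ | inj₁ y′ = apart v u (adj-swap a) y′ x′
      ... | inj₂ x′ | inj₂ y′ = sweep-ind palette (λ _ → false) (λ _ _ _ → λ { (() , _) }) u v a (x′ , y′)
      dom : ∀ v → ∃[ u ] (finish t F K M u ≡ true × Reach G 2 u v)
      dom v with true? (near2 M v)
      ... | inj₁ x = near2-cover (finish t F K M) v (near2-mono (λ u q → ∨⁺ˡ q) v x)
      ... | inj₂ x = near2-cover (finish t F K M) v (near2-mono (λ u q → ∨⁺ʳ (M u) q) v
                       (near1-self (near1 I) (sweep-dom palette (λ _ → false) v (cong not x) (in-palette v))))

-- One marking step

-- The event that x is marked and the rest of `U` is not. The test for x comes first, so `U` may
-- contain x.
spec : ∀ {n} → Fin n → (Fin n → Bool) → Fin n → Constraint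
spec x U u = if u == x then marked else (if U u then unmarked else free)

spec-self : ∀ {n} (x : Fin n) U → spec x U x ≡ marked
spec-self x U rewrite dec-true (x ≟ x) refl = refl

spec-other : ∀ {n} (x : Fin n) U u → x ≢ u → U u ≡ true → spec x U u ≡ unmarked
spec-other x U u x≢u p rewrite dec-false (u ≟ x) (x≢u ∘ sym) | p = refl

spec-free : ∀ {n} (x : Fin n) U u → x ≢ u → U u ≡ false → spec x U u ≡ free
spec-free x U u x≢u p rewrite dec-false (u ≟ x) (x≢u ∘ sym) | p = refl

spec-one : ∀ {n} (x : Fin n) U → cnt (isMarked ∘ spec x U) ≤ 1
spec-one x U = ≤-trans (cnt-mono h) (≤-reflexive (cnt-== x))
  where
  h : ∀ u → isMarked (spec x U u) ≡ true → (u == x) ≡ true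
  h u p with u == x | U u
  ... | true  | _     = refl
  ... | false | true  = p
  ... | false | false = p

spec-few : ∀ {n} (x : Fin n) U → cnt (isUnmarked ∘ spec x U) ≤ cnt U
spec-few x U = cnt-mono h
  where
  h : ∀ u → isUnmarked (spec x U u) ≡ true → U u ≡ true
  h u p with u == x | U u
  ... | false | true = refl

spec⁻ : ∀ {n} (x : Fin n) U m → 1 ≤ cyl (spec x U) m →
        lookup m x ≡ true × (∀ u → x ≢ u → U u ≡ true → lookup m u ≡ false)
spec⁻ x U m h = subst (λ c → satisfies c (lookup m x) ≡ true) (spec-self x U) (cyl⁻ (spec x U) m h x)
              , λ u x≢u p → not⁻ (subst (λ c → satisfies c (lookup m u) ≡ true) (spec-other x U u x≢u p) (cyl⁻ (spec x U) m h u))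

module Analysis {n : ℕ} {G : Graph n} (RT : Rooted G) where
  open Algorithm G
  open Correctness G
  open Subtree RT

  kids : VSet → Fin n → ℕ
  kids R v = cnt (λ u → kid v u ∧ R u)

  kids≤deg : ∀ R v → kids R v ≤ deg R v
  kids≤deg R v = cnt-mono (λ u q → ∧⁺ (kid-adj (proj₁ (∧⁻ {kid v u} q))) (proj₂ (∧⁻ {kid v u} q)))

  deg≤1+kids : ∀ R v → deg R v ≤ suc (kids R v)
  deg≤1+kids R v = ≤-trans (≤-trans (cnt-mono split) (cnt-∨ (_== par v) (λ u → kid v u ∧ R u)))
                           (≤-reflexive (cong (_+ kids R v) (cnt-== (par v))))
    where
    split : ∀ u → (adj G v u ∧ R u) ≡ true → ((u == par v) ∨ (kid v u ∧ R u)) ≡ true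
    split u q with nbr-kid (proj₁ (∧⁻ q))
    ... | inj₁ k = ∨⁺ʳ (u == par v) (∧⁺ k (proj₂ (∧⁻ {adj G v u} q)))
    ... | inj₂ e = ∨⁺ˡ (dec-true (u ≟ par v) e)

  MaxDeg : ℕ → VSet → Set
  MaxDeg a R = ∀ v → R v ≡ true → deg R v ≤ 2 ^ a

  part⁺ : ∀ {j} R {v} → R v ≡ true → deg R v ≤ 2 ^ j → part j R v ≡ true
  part⁺ {j} R {v} p q = ∧⁺ p (dec-true (deg R v ≤? 2 ^ j) q)

  part-deg : ∀ {j} R {v} → part j R v ≡ true → deg R v ≤ 2 ^ j
  part-deg {j} R {v} p = does⁻ (deg R v ≤? 2 ^ j) (proj₂ (∧⁻ {R v} p))

  joins⁺ : ∀ {j} R m {v} → part j R v ≡ true → lookup m v ≡ true →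
           (∀ u → adj G v u ≡ true → part j R u ≡ true → lookup m u ≡ false) → joins j R m v ≡ true
  joins⁺ {j} R m {v} p q h = ∧⁺ p (∧⁺ q (cong not (¬true λ r → case nb⁻ (λ u → part j R u ∧ lookup m u) r of λ
    { (u , a , s) → true≢false (proj₂ (∧⁻ {part j R u} s)) (h u a (proj₁ (∧⁻ s))) })))

  -- An upper bound, as a function of the marks, for the indicator that v survives.
  Survival : ℕ → VSet → Fin n → (Vec Bool n → ℕ) → Set
  Survival j R v X = ∀ m → near2 (joins j R m) v ≡ false → X m ≡ 1

  -- Common frame of the two child-based estimates. Each selected child w offers at least 2^c
  -- mutually exclusive events, determined inside the subtree of w (`loc`), each of which covers v
  -- (`sound`). The misses of different children are then independent.
  module Family (κ j′ c y : ℕ) (y+c : y + c ≡ suc j′ + κ) (R : VSet) (v : Fin n)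
                (W : VSet) (C : Fin n → VSet) (con : Fin n → Fin n → Fin n → Constraint)
                (W-kid : ∀ w → W w ≡ true → kid v w ≡ true)
                (C≥ : ∀ w → W w ≡ true → 2 ^ c ≤ cnt (C w))
                (one : ∀ w x → W w ≡ true → C w x ≡ true → cnt (isMarked ∘ con w x) ≤ 1)
                (few : ∀ w x → W w ≡ true → C w x ≡ true → cnt (isUnmarked ∘ con w x) ≤ 2 ^ j′ * κ)
                (excl : ∀ w x x′ → W w ≡ true → C w x ≡ true → C w x′ ≡ true →
                        con w x x ≡ marked × (x ≢ x′ → con w x x′ ≡ unmarked))
                (loc : ∀ w x u → W w ≡ true → C w x ≡ true → sub w u ≡ false → con w x u ≡ free)
                (sound : ∀ w x m → W w ≡ true → C w x ≡ true → 1 ≤ cyl (con w x) m → near2 (joins (suc j′) R m) v ≡ true) where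

    private
      b : ℕ
      b = odds (suc j′)

      module H w (p : W w ≡ true) = Hit κ j′ c y y+c (C w) (con w) (C≥ w p) (λ x → one w x p) (λ x → few w x p) (λ x x′ → excl w x x′ p)

      F : Fin n → Vec Bool n → ℕ
      F w m = if W w then missOf (C w) (con w) m else 1

      F≤1 : ∀ w m → F w m ≤ 1
      F≤1 w m with W w
      ... | true  = m∸n≤m 1 (hitsOf (C w) (con w) m)
      ... | false = ≤-refl

      mask : Fin n → VSet
      mask w u = W w ∧ sub w u

      F-dep : ∀ w → Dep (mask w) (F w)
      F-dep w m m′ h with W w in eq
      ... | true  = H.Dep-miss w eq (sub w) (λ x Cx u s → loc w x u eq Cx s) m m′ h
      ... | false = refl

      disjoint : ∀ i j u → i ≢ j → mask i u ≡ true → mask j u ≡ false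
      disjoint i j u i≢j p = ¬true λ q → true≢false (proj₂ (∧⁻ {W j} q))
        (sub-disjoint (W-kid i (proj₁ (∧⁻ p))) (W-kid j (proj₁ (∧⁻ q))) i≢j (proj₂ (∧⁻ {W i} p)))

      S-F : ∀ w → W w ≡ true → S b (F w) * suc (odds y) ≤ odds y * suc b ^ n
      S-F w p rewrite p = ≤-trans (≤-reflexive (cong (S b (missOf (C w) (con w)) *_) (suc-odds y))) (H.S-miss w p)

      F-survives : ∀ m → near2 (joins (suc j′) R m) v ≡ false → ∀ w → F w m ≡ 1
      F-survives m h w with W w in eq
      ... | false = refl
      ... | true with H.hit-or-miss w eq m
      ...   | inj₂ q = q
      ...   | inj₁ (x , Cx , q) = ⊥-elim (true≢false (sound w x m eq Cx q) h)

      ∏-1 : ∀ {k} (f : Fin k → ℕ) → (∀ i → f i ≡ 1) → ∏ f ≡ 1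
      ∏-1 {zero}  f h = refl
      ∏-1 {suc k} f h = cong₂ _*_ (h zero) (∏-1 (f ∘ suc) (h ∘ suc))

    X : Vec Bool n → ℕ
    X m = ∏ (λ w → F w m)

    X-survival : Survival (suc j′) R v X
    X-survival m h = ∏-1 _ (F-survives m h)

    X-dep : Dep (sub v) X
    X-dep = Dep-∏ F (λ w → Dep-⊆ (λ u p → sub-up (W-kid w (proj₁ (∧⁻ p))) (proj₂ (∧⁻ {W w} p))) (F-dep w))

    S-X : ∀ e → 2 ^ y * e ≤ cnt W → S b X * 2 ^ e ≤ suc b ^ n
    S-X e h = decay {S b X} (odds y) e (cnt W) (subst (λ z → z * e ≤ cnt W) (sym (suc-odds y)) h)
                (S-∏ b (odds y) (suc (odds y)) W F mask disjoint F-dep F≤1 S-F)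

  rich poor : ℕ → VSet → Fin n → VSet
  rich s R v w = kid v w ∧ (R w ∧ does (2 ^ s ≤? kids R w))
  poor s R v w = kid v w ∧ (R w ∧ does (kids R w <? 2 ^ s))

  -- v is reached from two steps away: a rich child w has 2ˢ children, any of which may join.
  rich-survival : ∀ j′ s y e R v → y + s ≡ suc j′ + 6 → MaxDeg (suc j′) R → 2 ^ y * e ≤ cnt (rich s R v) →
    ∃[ X ] (Survival (suc j′) R v X × Dep (sub v) X × S (odds (suc j′)) X * 2 ^ e ≤ suc (odds (suc j′)) ^ n)
  rich-survival j′ s y e R v y+s maxdeg enough = X , X-survival , X-dep , S-X e enough
    where
    j : ℕ
    j = suc j′
    C : Fin n → VSet
    C w x = kid w x ∧ R x
    -- w and the children of x are all the neighbours of x; the children of w are added so that the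
    -- candidates exclude one another.
    U : Fin n → Fin n → VSet
    U w x u = (u == w) ∨ ((kid w u ∧ R u) ∨ (kid x u ∧ R u))
    W-R : ∀ w → rich s R v w ≡ true → R w ≡ true
    W-R w p = proj₁ (∧⁻ (proj₂ (∧⁻ {kid v w} p)))
    W-kid : ∀ w → rich s R v w ≡ true → kid v w ≡ true
    W-kid w p = proj₁ (∧⁻ p)
    kid≢ : ∀ {w x} → kid w x ≡ true → x ≢ w
    kid≢ k refl = <-irrefl (kid-dep k) ≤-refl
    -- The origin of κ = 6: with 2^j = 2 * `2 ^ j′`, the sum 1 + 2^j + 2^j is at most 6 * `2 ^ j′`.
    few : ∀ w x → rich s R v w ≡ true → C w x ≡ true → cnt (isUnmarked ∘ spec x (U w x)) ≤ 2 ^ j′ * 6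
    few w x p q = ≤-trans (spec-few x (U w x)) (≤-trans (cnt-∨ (_== w) (λ u → (kid w u ∧ R u) ∨ (kid x u ∧ R u)))
      (≤-trans (+-mono-≤ (≤-trans (≤-reflexive (cnt-== w)) (m^n>0 2 j))
                 (≤-trans (cnt-∨ (λ u → kid w u ∧ R u) (λ u → kid x u ∧ R u))
                   (+-mono-≤ (≤-trans (kids≤deg R w) (maxdeg w (W-R w p)))
                             (≤-trans (kids≤deg R x) (maxdeg x (proj₂ (∧⁻ {kid w x} q)))))))
               (≤-reflexive (eq (2 ^ j′)))))
      where
      eq : ∀ z → 2 * z + (2 * z + 2 * z) ≡ z * 6
      eq = solve-∀
    loc : ∀ w x u → rich s R v w ≡ true → C w x ≡ true → sub w u ≡ false → spec x (U w x) u ≡ free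
    loc w x u p q h = spec-free x (U w x) u
      (λ { refl → true≢false (sub-kid (sub-refl w) kx) h })
      (¬true λ r → case ∨⁻ {u == w} r of λ
        { (inj₁ e) → true≢false (subst (λ z → sub w z ≡ true) (sym (does⁻ (u ≟ w) e)) (sub-refl w)) h
        ; (inj₂ r′) → case ∨⁻ {kid w u ∧ R u} r′ of λ
          { (inj₁ k) → true≢false (sub-kid (sub-refl w) (proj₁ (∧⁻ k))) h
          ; (inj₂ k) → true≢false (sub-kid (sub-kid (sub-refl w) kx) (proj₁ (∧⁻ k))) h } })
      where
      kx : kid w x ≡ true
      kx = proj₁ (∧⁻ q)
    sound : ∀ w x m → rich s R v w ≡ true → C w x ≡ true → 1 ≤ cyl (spec x (U w x)) m → near2 (joins j R m) v ≡ true
    sound w x m p q h = near1-nb (near1 (joins j R m)) (kid-adj (W-kid w p)) (near1-nb (joins j R m) (kid-adj kx)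
      (joins⁺ {j} R m (part⁺ {j} R Rx (maxdeg x Rx)) (proj₁ (spec⁻ x (U w x) m h)) quiet))
      where
      kx : kid w x ≡ true
      kx = proj₁ (∧⁻ q)
      Rx : R x ≡ true
      Rx = proj₂ (∧⁻ {kid w x} q)
      quiet : ∀ u → adj G x u ≡ true → part j R u ≡ true → lookup m u ≡ false
      quiet u a pu with nbr-kid a
      ... | inj₁ k = proj₂ (spec⁻ x (U w x) m h) u (λ e → kid≢ k (sym e)) (∨⁺ʳ (u == w) (∨⁺ʳ (kid w u ∧ R u) (∧⁺ k (proj₁ (∧⁻ pu)))))
      ... | inj₂ e = proj₂ (spec⁻ x (U w x) m h) u (λ x≡u → kid≢ kx (trans x≡u u≡w)) (∨⁺ˡ (dec-true (u ≟ w) u≡w))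
        where
        u≡w : u ≡ w
        u≡w = trans e (kid-par kx)
    open Family 6 j′ s y y+s R v (rich s R v) C (λ w x → spec x (U w x)) W-kid
           (λ w p → does⁻ (2 ^ s ≤? kids R w) (proj₂ (∧⁻ {R w} (proj₂ (∧⁻ {kid v w} p)))))
           (λ w x _ _ → spec-one x (U w x)) few
           (λ w x x′ p q q′ → spec-self x (U w x) , λ x≢x′ → spec-other x (U w x) x′ x≢x′ (∨⁺ʳ (x′ == w) (∨⁺ˡ q′)))
           loc sound

  -- A poor child has degree at most 2^s, so it participates and joins with probability at least
  -- 2^-(s+6). This event must not involve the mark of v, which all children share; the hypothesis
  -- on the degree of v keeps v from participating at this rate.
  poor-survival : ∀ s′ e R v → 2 ^ suc s′ < deg R v → 2 ^ (suc s′ + 6) * e ≤ cnt (poor (suc s′) R v) →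
    ∃[ X ] (Survival (suc s′) R v X × Dep (sub v) X × S (odds (suc s′)) X * 2 ^ e ≤ suc (odds (suc s′)) ^ n)
  poor-survival s′ e R v big enough = X , X-survival , X-dep , S-X e enough
    where
    s : ℕ
    s = suc s′
    U : Fin n → VSet
    U w u = kid w u ∧ R u
    W : VSet
    W = poor s R v
    W-kid : ∀ w → W w ≡ true → kid v w ≡ true
    W-kid w p = proj₁ (∧⁻ p)
    kids< : ∀ w → W w ≡ true → kids R w < 2 ^ s
    kids< w p = does⁻ (kids R w <? 2 ^ s) (proj₂ (∧⁻ {R w} (proj₂ (∧⁻ {kid v w} p))))
    few : ∀ w x → W w ≡ true → (x == w) ≡ true → cnt (isUnmarked ∘ spec w (U w)) ≤ 2 ^ s′ * 6
    few w x p q = ≤-trans (spec-few w (U w)) (≤-trans (<⇒≤ (kids< w p)) (≤-trans (≤-reflexive (*-comm 2 (2 ^ s′))) (*-monoʳ-≤ (2 ^ s′) (s≤s (s≤s z≤n)))))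
    loc : ∀ w x u → W w ≡ true → (x == w) ≡ true → sub w u ≡ false → spec w (U w) u ≡ free
    loc w x u p q h = spec-free w (U w) u (λ { refl → true≢false (sub-refl w) h })
      (¬true λ k → true≢false (sub-kid (sub-refl w) (proj₁ (∧⁻ k))) h)
    sound : ∀ w x m → W w ≡ true → (x == w) ≡ true → 1 ≤ cyl (spec w (U w)) m → near2 (joins s R m) v ≡ true
    sound w x m p q h = near1-self (near1 (joins s R m)) (near1-nb (joins s R m) (kid-adj (W-kid w p))
      (joins⁺ {s} R m (part⁺ {s} R (proj₁ (∧⁻ (proj₂ (∧⁻ {kid v w} p)))) (≤-trans (deg≤1+kids R w) (kids< w p))) (proj₁ (spec⁻ w (U w) m h)) quiet))
      where
      quiet : ∀ u → adj G w u ≡ true → part s R u ≡ true → lookup m u ≡ false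
      quiet u a pu with nbr-kid a
      ... | inj₁ k = proj₂ (spec⁻ w (U w) m h) u (λ { refl → <-irrefl (kid-dep k) ≤-refl }) (∧⁺ k (proj₁ (∧⁻ pu)))
      ... | inj₂ e = ⊥-elim (<⇒≱ big (part-deg {s} R (subst (λ z → part s R z ≡ true) (trans e (kid-par (W-kid w p))) pu)))
    open Family 6 s′ 0 (suc s′ + 6) (+-identityʳ _) R v W (λ w x → x == w) (λ w x → spec w (U w)) W-kid
           (λ w p → ≤-reflexive (sym (cnt-== w)))
           (λ w x _ _ → spec-one w (U w)) few
           (λ w x x′ p q q′ → subst (λ z → spec w (U w) z ≡ marked) (sym (does⁻ (x ≟ w) q)) (spec-self w (U w))
                            , λ x≢x′ → ⊥-elim (x≢x′ (trans (does⁻ (x ≟ w) q) (sym (does⁻ (x′ ≟ w) q′)))))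
           loc sound

  -- v joins if it is marked and its active neighbours are not. The parent is one of these
  -- neighbours, hence the dependence on the subtree of the parent.
  self-survival : ∀ j′ R v → R v ≡ true → MaxDeg (suc j′) R →
    ∃[ X ] (Survival (suc j′) R v X × (∀ p → kid p v ≡ true → Dep (sub p) X) ×
            S (odds (suc j′)) X * 2 ^ (suc j′ + 6) ≤ odds (suc j′ + 6) * suc (odds (suc j′)) ^ n)
  self-survival j′ R v Rv maxdeg = missOf C con , surv , dep′ , S-miss
    where
    j : ℕ
    j = suc j′
    C U : VSet
    C x = x == v
    U u = adj G v u ∧ R u
    con : Fin n → Fin n → Constraint
    con x = spec v U
    open Hit 6 j′ 0 (suc j′ + 6) (+-identityʳ _) C con (≤-reflexive (sym (cnt-== v))) (λ _ _ → spec-one v U)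
           (λ x _ → ≤-trans (spec-few v U) (≤-trans (maxdeg v Rv) (≤-trans (≤-reflexive (*-comm 2 (2 ^ j′))) (*-monoʳ-≤ (2 ^ j′) (s≤s (s≤s z≤n))))))
           (λ x x′ q q′ → subst (λ z → spec v U z ≡ marked) (sym (does⁻ (x ≟ v) q)) (spec-self v U)
                        , λ x≢x′ → ⊥-elim (x≢x′ (trans (does⁻ (x ≟ v) q) (sym (does⁻ (x′ ≟ v) q′)))))
    surv : Survival j R v (missOf C con)
    surv m h with hit-or-miss m
    ... | inj₂ q = q
    ... | inj₁ (x , Cx , q) = ⊥-elim (true≢false (near1-self (near1 (joins j R m)) (near1-self (joins j R m)
            (joins⁺ {j} R m (part⁺ {j} R Rv (maxdeg v Rv)) (proj₁ (spec⁻ v U m q))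
              (λ u a pu → proj₂ (spec⁻ v U m q) u (λ { refl → true≢false a (adj-irrefl G v) }) (∧⁺ a (proj₁ (∧⁻ pu))))))) h)
    dep′ : ∀ p → kid p v ≡ true → Dep (sub p) (missOf C con)
    dep′ p k = Dep-miss (sub p) λ x Cx u s → spec-free v U u
      (λ { refl → true≢false (sub-kid (sub-refl p) k) s })
      (¬true λ q → case nbr-kid (proj₁ (∧⁻ q)) of λ
        { (inj₁ k′) → true≢false (sub-kid (sub-kid (sub-refl p) k) k′) s
        ; (inj₂ e)  → true≢false (subst (λ z → sub p z ≡ true) (sym (trans e (kid-par k))) (sub-refl p)) s })

-- Potentials along a schedule

SS : ∀ {n} ops → (Ω n ops → ℕ) → ℕ
SS []              f = f tt
SS (mark j ∷ ops)  f = S (odds j) (λ m → SS ops (λ ω → f (m , ω)))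
SS (aside D ∷ ops) f = SS ops f

mass : ℕ → List Op → ℕ
mass n []              = 1
mass n (mark j ∷ ops)  = suc (odds j) ^ n * mass n ops
mass n (aside D ∷ ops) = mass n ops

SS-mono : ∀ {n} ops {f g : Ω n ops → ℕ} → (∀ ω → f ω ≤ g ω) → SS ops f ≤ SS ops g
SS-mono []              h = h tt
SS-mono (mark j ∷ ops)  h = S-mono (odds j) (λ m → SS-mono ops (λ ω → h (m , ω)))
SS-mono (aside D ∷ ops) h = SS-mono ops h

SS-const : ∀ {n} ops c → SS {n} ops (λ _ → c) ≡ mass n ops * c
SS-const []              c = sym (+-identityʳ c)
SS-const {n} (mark j ∷ ops) c = trans (S-cong (odds j) {n} {λ _ → SS {n} ops (λ _ → c)} (λ m → SS-const {n} ops c)) (trans (S-const (odds j) n (mass n ops * c)) (sym (*-assoc (suc (odds j) ^ n) (mass n ops) c)))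
SS-const (aside D ∷ ops) c = SS-const ops c

SS-*ʳ : ∀ {n} ops (f : Ω n ops → ℕ) c → SS ops (λ ω → f ω * c) ≡ SS ops f * c
SS-*ʳ []              f c = refl
SS-*ʳ (mark j ∷ ops)  f c = trans (S-cong (odds j) (λ m → SS-*ʳ ops (λ ω → f (m , ω)) c)) (S-*ʳ (odds j) (λ m → SS ops (λ ω → f (m , ω))) c)
SS-*ʳ (aside D ∷ ops) f c = SS-*ʳ ops f c

SS-+ : ∀ {n} ops (f g : Ω n ops → ℕ) → SS ops (λ ω → f ω + g ω) ≡ SS ops f + SS ops g
SS-+ []              f g = refl
SS-+ (mark j ∷ ops)  f g = trans (S-cong (odds j) (λ m → SS-+ ops (λ ω → f (m , ω)) (λ ω → g (m , ω)))) (S-+ (odds j) (λ m → SS ops (λ ω → f (m , ω))) (λ m → SS ops (λ ω → g (m , ω))))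
SS-+ (aside D ∷ ops) f g = SS-+ ops f g

SS-∑ : ∀ {n k} ops (f : Fin k → Ω n ops → ℕ) → SS ops (λ ω → ∑ (λ i → f i ω)) ≡ ∑ (λ i → SS ops (f i))
SS-∑ {n} {zero}  ops f = trans (SS-const ops 0) (*-zeroʳ (mass n ops))
SS-∑ {n} {suc k} ops f = trans (SS-+ ops (f zero) (λ ω → ∑ (λ i → f (suc i) ω))) (cong (SS ops (f zero) +_) (SS-∑ ops (f ∘ suc)))

iterate : ℕ → ℕ → ℕ → List Op → List Op
iterate a s zero    rest = rest
iterate a s (suc T) rest = mark a ∷ mark s ∷ iterate a s T rest

-- The final `aside 0` retires every vertex, so that afterwards the potential equals Z exactly at
-- the uncovered vertices.
lastOps : ℕ → ℕ → List Op
lastOps a zero    = aside 0 ∷ []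
lastOps a (suc T) = mark a ∷ lastOps a T

module Potential {n : ℕ} {G : Graph n} (RT : Rooted G) where
  open Algorithm G
  open Correctness G
  open Subtree RT
  open Analysis RT

  -- The functionals through which a vertexwise supermartingale estimate passes. Evaluation at a
  -- vertex qualifies by linearity; products qualify if the subtrees on which their factors depend
  -- are disjoint.
  record Admissible (Λ : (Fin n → ℕ) → ℕ) : Set where
    field
      mono : ∀ {f g : Fin n → ℕ} → (∀ v → f v ≤ g v) → Λ f ≤ Λ g
      avg  : ∀ b (ψ : Fin n → Vec Bool n → ℕ) (φ : Fin n → ℕ) → (∀ v p → kid p v ≡ true → Dep (sub p) (ψ v)) →
             (∀ v → S b (ψ v) ≤ suc b ^ n * φ v) → S b (λ m → Λ (λ v → ψ v m)) ≤ suc b ^ n * Λ φ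

  at-admissible : ∀ v → Admissible (λ f → f v)
  at-admissible v = record { mono = λ h → h v ; avg = λ b ψ φ _ h → h v }

  Weight : Set
  Weight = VSet → Fin n → ℕ

  module _ (Z : ℕ) where

    -- Scaled bound on the probability that v ends up set aside and uncovered:
    -- aw weighs the active vertices, vertices already set aside weigh Z.
    pot : Weight → State → Fin n → ℕ
    pot aw (M , R) v = if near2 M v then 0 else (if R v then aw R v else Z)

    pot-covered : ∀ aw M R v → near2 M v ≡ true → pot aw (M , R) v ≡ 0
    pot-covered aw M R v p rewrite p = refl

    pot-active : ∀ aw M R v → near2 M v ≡ false → R v ≡ true → pot aw (M , R) v ≡ aw R v
    pot-active aw M R v p q rewrite p | q = refl

    pot-aside : ∀ aw M R v → near2 M v ≡ false → R v ≡ false → pot aw (M , R) v ≡ Z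
    pot-aside aw M R v p q rewrite p | q = refl

    pot≤Z : ∀ aw M R v → R v ≡ false → pot aw (M , R) v ≤ Z
    pot≤Z aw M R v q rewrite q with near2 M v
    ... | true  = z≤n
    ... | false = ≤-refl

    -- Covered vertices have potential 0, so ψ has to dominate the next weight only when v survives,
    -- while its average must not exceed the present weight.
    MarkOK : ℕ → (VSet → Set) → Weight → Weight → Set
    MarkOK j I aw aw′ = ∀ R → I R → ∀ v → R v ≡ true → ∃[ ψ ]
      ((∀ m → near2 (joins j R m) v ≡ false → aw′ (shrink j R m) v ≤ ψ m) ×
       (∀ p → kid p v ≡ true → Dep (sub p) ψ) ×
       S (odds j) ψ ≤ suc (odds j) ^ n * aw R v)

    -- A derivation of the supermartingale property along a schedule. `I` is an invariant of the
    -- active set, `aw` the weight before the schedule; `Iₑ` and `awₑ` are their values at its end.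
    data Cert (Iₑ : VSet → Set) (awₑ : Weight) : List Op → (VSet → Set) → Weight → Set₁ where
      done  : Cert Iₑ awₑ [] Iₑ awₑ
      weak  : ∀ {ops I I⁺} {aw aw⁺ : Weight} → (∀ R → I⁺ R → I R) → (∀ R v → I⁺ R → R v ≡ true → aw R v ≤ aw⁺ R v) →
              Cert Iₑ awₑ ops I aw → Cert Iₑ awₑ ops I⁺ aw⁺
      mark  : ∀ {j ops I I′} {aw aw′ : Weight} → (∀ R m → I R → I′ (shrink j R m)) → MarkOK j I aw aw′ →
              Cert Iₑ awₑ ops I′ aw′ → Cert Iₑ awₑ (mark j ∷ ops) I aw
      aside : ∀ {D ops I I′} {aw aw′ : Weight} → (∀ R → I R → I′ (keep D R)) →
              (∀ R v → I R → R v ≡ true → (deg R v < D → aw′ (keep D R) v ≤ aw R v) × (D ≤ deg R v → Z ≤ aw R v)) →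
              Cert Iₑ awₑ ops I′ aw′ → Cert Iₑ awₑ (aside D ∷ ops) I aw

    cert-end : ∀ {Iₑ awₑ ops I aw} → Cert Iₑ awₑ ops I aw → ∀ st → I (proj₂ st) → ∀ ω → Iₑ (proj₂ (run ops st ω))
    cert-end done              st      i ω       = i
    cert-end (weak I⊆ _ c)     st      i ω       = cert-end c st (I⊆ _ i) ω
    cert-end (mark pres _ c)   (M , R) i (m , ω) = cert-end c _ (pres R m i) ω
    cert-end (aside pres _ c)  (M , R) i ω       = cert-end c _ (pres R i) ω

    -- Induction averages over the later marks for each outcome of the first step; `avg` then
    -- averages over the first marks, with the present state fixed.
    cert-bound : ∀ {Iₑ awₑ ops I aw} {Λ : (Fin n → ℕ) → ℕ} → Admissible Λ → Cert Iₑ awₑ ops I aw → ∀ st → I (proj₂ st) →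
                 SS ops (λ ω → Λ (pot awₑ (run ops st ω))) ≤ mass n ops * Λ (pot aw st)
    cert-bound A done st i = ≤-reflexive (sym (+-identityʳ _))
    cert-bound {ops = ops} {Λ = Λ} A (weak {aw = aw} {aw⁺} I⊆ le c) (M , R) i =
      ≤-trans (cert-bound A c (M , R) (I⊆ R i)) (*-monoʳ-≤ (mass n ops) (Admissible.mono A h))
      where
      h : ∀ v → pot aw (M , R) v ≤ pot aw⁺ (M , R) v
      h v with near2 M v | R v in eq
      ... | true  | _     = z≤n
      ... | false | true  = le R v i eq
      ... | false | false = ≤-refl
    cert-bound {Λ = Λ} A (aside {D} {ops} {aw = aw} {aw′} pres ok c) (M , R) i =
      ≤-trans (cert-bound A c (M , keep D R) (pres R i)) (*-monoʳ-≤ (mass n ops) (Admissible.mono A h))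
      where
      h : ∀ v → pot aw′ (M , keep D R) v ≤ pot aw (M , R) v
      h v with near2 M v | R v in eq
      ... | true  | _     = z≤n
      ... | false | false = ≤-refl
      ... | false | true with does (deg R v <? D) in eq′
      ...   | true  = proj₁ (ok R v i eq) (does⁻ (deg R v <? D) eq′)
      ...   | false = proj₂ (ok R v i eq) (≮⇒≥ (does⁻-false (deg R v <? D) eq′))
    cert-bound {awₑ = awₑ} {Λ = Λ} A (mark {j} {ops} {aw = aw} {aw′} pres ok c) (M , R) i = begin
      S b (λ m → SS ops (λ ω → Λ (pot awₑ (run ops (next m) ω))))
        ≤⟨ S-mono b (λ m → cert-bound A c (next m) (pres R m i)) ⟩
      S b (λ m → mass n ops * Λ (pot aw′ (next m)))
        ≤⟨ S-mono b (λ m → ≤-trans (*-monoʳ-≤ (mass n ops) (Admissible.mono A (λ v → proj₁ (proj₂ (local v)) m)))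
                                   (≤-reflexive (*-comm (mass n ops) _))) ⟩
      S b (λ m → Λ (λ v → proj₁ (local v) m) * mass n ops)
        ≡⟨ S-*ʳ b (λ m → Λ (λ v → proj₁ (local v) m)) (mass n ops) ⟩
      S b (λ m → Λ (λ v → proj₁ (local v) m)) * mass n ops
        ≤⟨ *-monoˡ-≤ (mass n ops) (Admissible.avg A b (λ v → proj₁ (local v)) (pot aw (M , R))
             (λ v → proj₁ (proj₂ (proj₂ (local v)))) (λ v → proj₂ (proj₂ (proj₂ (local v))))) ⟩
      suc b ^ n * Λ (pot aw (M , R)) * mass n ops
        ≡⟨ eq (suc b ^ n) (Λ (pot aw (M , R))) (mass n ops) ⟩
      suc b ^ n * mass n ops * Λ (pot aw (M , R)) ∎
      where
      open ≤-Reasoning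
      b : ℕ
      b = odds j
      eq : ∀ x y z → x * y * z ≡ x * z * y
      eq = solve-∀
      next : Vec Bool n → State
      next m = (λ v → M v ∨ joins j R m v) , shrink j R m
      covered : ∀ m v → near2 M v ≡ true → near2 (proj₁ (next m)) v ≡ true
      covered m v = near2-mono (λ u p → ∨⁺ˡ p) v
      -- A covered vertex stays at 0 and one set aside stays at Z or drops to 0; only active
      -- uncovered vertices use `MarkOK`.
      local : ∀ v → ∃[ ψ ] ((∀ m → pot aw′ (next m) v ≤ ψ m) × (∀ p → kid p v ≡ true → Dep (sub p) ψ) ×
                            S b ψ ≤ suc b ^ n * pot aw (M , R) v)
      local v with true? (near2 M v) | true? (R v)
      ... | inj₁ cov | _ = (λ _ → 0) , (λ m → ≤-reflexive (pot-covered aw′ (proj₁ (next m)) (proj₂ (next m)) v (covered m v cov))) ,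
              (λ _ _ _ _ _ → refl) , ≤-trans (≤-reflexive (trans (S-const b n 0) (*-zeroʳ (suc b ^ n)))) z≤n
      ... | inj₂ unc | inj₂ q = (λ _ → Z) , (λ m → pot≤Z aw′ (proj₁ (next m)) (proj₂ (next m)) v (¬true λ r → true≢false (proj₁ (∧⁻ {R v} r)) q)) ,
              (λ _ _ _ _ _ → refl) , ≤-reflexive (trans (S-const b n Z) (cong (suc b ^ n *_) (sym (pot-aside aw M R v unc q))))
      ... | inj₂ unc | inj₁ q with ok R i v q
      ...   | ψ , le , dep′ , bound = ψ , le′ , dep′ , ≤-trans bound (≤-reflexive (cong (suc b ^ n *_) (sym (pot-active aw M R v unc q))))
        where
        le′ : ∀ m → pot aw′ (next m) v ≤ ψ m
        le′ m with true? (near2 (proj₁ (next m)) v)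
        ... | inj₁ cov = ≤-trans (≤-reflexive (pot-covered aw′ (proj₁ (next m)) (proj₂ (next m)) v cov)) z≤n
        ... | inj₂ unc′ = ≤-trans (≤-reflexive (pot-active aw′ (proj₁ (next m)) (proj₂ (next m)) v unc′ (∧⁺ q (cong not unhit)))) (le m unhit)
          where
          unhit : near2 (joins j R m) v ≡ false
          unhit = ¬true λ h → true≢false (near2-mono (λ u p → ∨⁺ʳ (M u) p) v h) unc′

    shrink-⊆ : ∀ j R m v → shrink j R m v ≡ true → R v ≡ true
    shrink-⊆ j R m v p = proj₁ (∧⁻ p)

    shrink-deg : ∀ j R m v → deg (shrink j R m) v ≤ deg R v
    shrink-deg j R m v = deg-mono {shrink j R m} {R} v (shrink-⊆ j R m)

    keep-deg : ∀ D R v → deg (keep D R) v ≤ deg R v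
    keep-deg D R v = deg-mono {keep D R} {R} v (λ u p → proj₁ (∧⁻ p))

    DegLt : ℕ → VSet → Set
    DegLt D R = ∀ v → R v ≡ true → deg R v < D

    shrink-MaxDeg : ∀ a j R m → MaxDeg a R → MaxDeg a (shrink j R m)
    shrink-MaxDeg a j R m h v p = ≤-trans (shrink-deg j R m v) (h v (shrink-⊆ j R m v p))

    average : ∀ {x B} e W w w′ → x * 2 ^ e ≤ B → w ≤ 2 ^ e * w′ → x * (W + w) ≤ B * (W + w′)
    average {x} {B} e W w w′ h k = begin
      x * (W + w)                       ≤⟨ *-monoʳ-≤ x (+-mono-≤ (m≤n*m W (2 ^ e) {{m^n≢0 2 e}}) k) ⟩
      x * (2 ^ e * W + 2 ^ e * w′)      ≡⟨ cong (x *_) (sym (*-distribˡ-+ (2 ^ e) W w′)) ⟩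
      x * (2 ^ e * (W + w′))            ≡⟨ sym (*-assoc x (2 ^ e) (W + w′)) ⟩
      x * 2 ^ e * (W + w′)              ≤⟨ *-monoˡ-≤ (W + w′) h ⟩
      B * (W + w′) ∎
      where
      open ≤-Reasoning

    -- One level brings the active degrees from at most 2^a to below 2 * H. Each iteration gains a
    -- factor 2^-e once for a vertex that stays big: at the first mark if it has H rich children, at
    -- the second mark otherwise. W is the weight with which the remaining schedule starts.
    module Level (E a′ s′ y e H W : ℕ) (Z≡ : Z ≡ 2 ^ E) (y+s : y + suc s′ ≡ suc a′ + 6)
                 (H-rich : 2 ^ y * e ≤ H) (H-poor : 2 ^ (suc s′ + 6) * e ≤ H) (H-big : 2 ^ suc s′ < 2 * H) where
      private
        a s : ℕ
        a = suc a′
        s = suc s′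

      -- The price Z of being set aside, reduced by 2^-e for each of the i iterations still ahead;
      -- the truncated subtraction can only make it larger.
      wt : ℕ → ℕ
      wt i = 2 ^ (E ∸ e * i)

      private
        wt-step : ∀ i → wt i ≤ 2 ^ e * wt (suc i)
        wt-step i = ≤-trans (^-monoʳ-≤ 2 le) (≤-reflexive (^-distribˡ-+-* 2 e (E ∸ e * suc i)))
          where
          le : E ∸ e * i ≤ e + (E ∸ e * suc i)
          le = subst (λ z → E ∸ e * i ≤ e + z) (trans (∸-+-assoc E (e * i) e) (cong (E ∸_) (trans (+-comm (e * i) e) (sym (*-suc e i)))))
                 (m≤n+m∸n (E ∸ e * i) e)

        wt-anti : ∀ i → wt (suc i) ≤ wt i
        wt-anti i = ^-monoʳ-≤ 2 (∸-monoʳ-≤ E (*-monoʳ-≤ e (n≤1+n i)))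

        big : VSet → Fin n → Bool
        big R v = does (2 * H ≤? deg R v)

        many : VSet → Fin n → Bool
        many R v = does (H ≤? cnt (poor s R v))

        -- `awI i` is the weight with i iterations ahead, `awM i` the weight between the two marks
        -- of an iteration that i more follow. A vertex with many poor children still expects the
        -- gain of the current iteration, hence `wt (suc i)`.
        awI awM : ℕ → Weight
        awI i R v = W + (if big R v then wt i else 0)
        awM i R v = W + (if big R v then (if many R v then wt (suc i) else wt i) else 0)

        awI≤ : ∀ i R v → awI i R v ≤ W + wt i
        awI≤ i R v with big R v
        ... | true  = ≤-refl
        ... | false = +-monoʳ-≤ W z≤n

        awM≤ : ∀ i R v → awM i R v ≤ W + wt i
        awM≤ i R v with big R v | many R v
        ... | true  | true  = +-monoʳ-≤ W (wt-anti i)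
        ... | true  | false = ≤-refl
        ... | false | _     = +-monoʳ-≤ W z≤n

        small-after : ∀ j R m v → big R v ≡ false → big (shrink j R m) v ≡ false
        small-after j R m v h = ¬true λ p → true≢false
          (dec-true (2 * H ≤? deg R v) (≤-trans (does⁻ (2 * H ≤? deg (shrink j R m) v) p) (shrink-deg j R m v))) h

        constant : ∀ b c w → c ≤ w → S b {n} (λ _ → c) ≤ suc b ^ n * w
        constant b c w h = ≤-trans (≤-reflexive (S-const b n c)) (*-monoʳ-≤ (suc b ^ n) h)

        lift : ∀ {v X} → Dep (sub v) X → ∀ p → kid p v ≡ true → ∀ c → Dep (sub p) (λ m → X m * c)
        lift d p k c m m′ h = cong (_* c) (Dep-⊆ (λ u → sub-up k) d m m′ h)

        -- If few children are rich, the children left after the step are mostly poor.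
        poor-after : ∀ j R m v → cnt (rich s R v) < H → 2 * H ≤ deg (shrink j R m) v → H ≤ cnt (poor s (shrink j R m) v)
        poor-after j R m v few h = +-cancelˡ-≤ H _ _ (begin
          H + H                                              ≡⟨ cong (H +_) (sym (+-identityʳ H)) ⟩
          2 * H                                              ≤⟨ h ⟩
          deg R′ v                                           ≤⟨ deg≤1+kids R′ v ⟩
          suc (kids R′ v)                                    ≤⟨ s≤s (cnt-mono split) ⟩
          suc (cnt (λ w → rich s R v w ∨ poor s R′ v w))     ≤⟨ s≤s (cnt-∨ (rich s R v) (poor s R′ v)) ⟩
          suc (cnt (rich s R v)) + cnt (poor s R′ v)         ≤⟨ +-monoˡ-≤ (cnt (poor s R′ v)) few ⟩
          H + cnt (poor s R′ v) ∎)
          where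
          open ≤-Reasoning
          R′ : VSet
          R′ = shrink j R m
          split : ∀ w → (kid v w ∧ R′ w) ≡ true → (rich s R v w ∨ poor s R′ v w) ≡ true
          split w q with ∧⁻ {kid v w} q
          ... | k , r with 2 ^ s ≤? kids R w
          ...   | yes p = ∨⁺ˡ (∧⁺ k (∧⁺ (shrink-⊆ j R m w r) (dec-true (2 ^ s ≤? kids R w) p)))
          ...   | no ¬p = ∨⁺ʳ (rich s R v w) (∧⁺ k (∧⁺ {R′ w} r (dec-true (kids R′ w <? 2 ^ s)
                  (≤-trans (s≤s (cnt-mono (λ u t → ∧⁺ (proj₁ (∧⁻ {kid w u} t)) (shrink-⊆ j R m u (proj₂ (∧⁻ {kid w u} t)))))) (≰⇒> ¬p)))))

        rich-ok : ∀ i → MarkOK a (MaxDeg a) (awI (suc i)) (awM i)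
        rich-ok i R maxdeg v Rv with big R v in eqB
        ... | false = (λ _ → W) , (λ m _ → le m) , (λ _ _ _ _ _ → refl) , constant (odds a) W (W + 0) (m≤m+n W 0)
          where
          le : ∀ m → awM i (shrink a R m) v ≤ W
          le m rewrite small-after a R m v eqB = ≤-reflexive (+-identityʳ W)
        ... | true with H ≤? cnt (rich s R v)
        ...   | yes enough with rich-survival a′ s y e R v y+s maxdeg (≤-trans H-rich enough)
        ...     | X , surv , d , SX = (λ m → X m * (W + wt i)) ,
                    (λ m h → subst (λ x → awM i (shrink a R m) v ≤ x * (W + wt i)) (sym (surv m h)) (≤-trans (awM≤ i _ v) (≤-reflexive (sym (+-identityʳ _))))) ,
                    (λ p k → lift d p k (W + wt i)) ,
                    ≤-trans (≤-reflexive (S-*ʳ (odds a) X (W + wt i))) (average {S (odds a) X} e W (wt i) (wt (suc i)) SX (wt-step i))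
        rich-ok i R maxdeg v Rv | true | no few = (λ _ → W + wt (suc i)) , (λ m _ → le m) , (λ _ _ _ _ _ → refl) , constant (odds a) _ _ ≤-refl
          where
          le : ∀ m → awM i (shrink a R m) v ≤ W + wt (suc i)
          le m with big (shrink a R m) v in eq
          ... | false = +-monoʳ-≤ W z≤n
          ... | true rewrite dec-true (H ≤? cnt (poor s (shrink a R m) v))
                               (poor-after a R m v (≰⇒> few) (does⁻ (2 * H ≤? deg (shrink a R m) v) eq)) = ≤-refl

        poor-ok : ∀ i → MarkOK s (MaxDeg a) (awM i) (awI i)
        poor-ok i R maxdeg v Rv with big R v in eqB
        ... | false = (λ _ → W) , (λ m _ → le m) , (λ _ _ _ _ _ → refl) , constant (odds s) W (W + 0) (m≤m+n W 0)
          where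
          le : ∀ m → awI i (shrink s R m) v ≤ W
          le m rewrite small-after s R m v eqB = ≤-reflexive (+-identityʳ W)
        ... | true with many R v in eqM
        ...   | false = (λ _ → W + wt i) , (λ m _ → awI≤ i _ v) , (λ _ _ _ _ _ → refl) , constant (odds s) _ _ ≤-refl
        ...   | true with poor-survival s′ e R v (<-≤-trans H-big (does⁻ (2 * H ≤? deg R v) eqB)) (≤-trans H-poor (does⁻ (H ≤? cnt (poor s R v)) eqM))
        ...     | X , surv , d , SX = (λ m → X m * (W + wt i)) ,
                    (λ m h → subst (λ x → awI i (shrink s R m) v ≤ x * (W + wt i)) (sym (surv m h)) (≤-trans (awI≤ i _ v) (≤-reflexive (sym (+-identityʳ _))))) ,
                    (λ p k → lift d p k (W + wt i)) ,
                    ≤-trans (≤-reflexive (S-*ʳ (odds s) X (W + wt i))) (average {S (odds s) X} e W (wt i) (wt (suc i)) SX (wt-step i))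

      level : ∀ {Iₑ awₑ rest} T → Cert Iₑ awₑ rest (DegLt (2 * H)) (λ _ _ → W) →
              Cert Iₑ awₑ (iterate a s T (aside (2 * H) ∷ rest)) (MaxDeg a) (λ _ _ → W + wt T)
      level {Iₑ} {awₑ} {rest} T c = weak (λ R i → i) (λ R v _ _ → awI≤ T R v) (go T)
        where
        go : ∀ T → Cert Iₑ awₑ (iterate a s T (aside (2 * H) ∷ rest)) (MaxDeg a) (awI T)
        go zero = aside {I = MaxDeg a} {I′ = DegLt (2 * H)} {aw = awI 0} {aw′ = λ _ _ → W}
          (λ R _ v p → ≤-<-trans (keep-deg (2 * H) R v) (does⁻ (deg R v <? 2 * H) (proj₂ (∧⁻ {R v} p))))
          (λ R v _ _ → (λ _ → m≤m+n W _) , λ h → ≤-trans (≤-reflexive (trans Z≡ (cong (λ z → 2 ^ (E ∸ z)) (sym (*-zeroʳ e))))) (top R v h)) c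
          where
          top : ∀ R v → 2 * H ≤ deg R v → wt 0 ≤ awI 0 R v
          top R v h rewrite dec-true (2 * H ≤? deg R v) h = m≤n+m (wt 0) W
        go (suc T) = mark {I = MaxDeg a} {I′ = MaxDeg a} {aw = awI (suc T)} {aw′ = awM T} (λ R m → shrink-MaxDeg a a R m) (rich-ok T)
                    (mark {I = MaxDeg a} {I′ = MaxDeg a} {aw = awM T} {aw′ = awI T} (λ R m → shrink-MaxDeg a s R m) (poor-ok T) (go T))

    -- A vertex of degree at most 2^a joins in one step with probability at least 2^-y for y = a +
    -- 6. For i ≤ `Tₗ` the weight `wl i` is Z * (1 - 2^-y)^i.
    module Last (a′ Tₗ : ℕ) (Z≡ : Z ≡ (2 ^ (suc a′ + 6)) ^ Tₗ) where
      private
        a y : ℕ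
        a = suc a′
        y = a + 6

      wl : ℕ → ℕ
      wl i = odds y ^ i * (2 ^ y) ^ (Tₗ ∸ i)

      private
        wl-step : ∀ i → odds y * wl i ≤ 2 ^ y * wl (suc i)
        wl-step i = begin
          odds y * (odds y ^ i * (2 ^ y) ^ (Tₗ ∸ i))              ≡⟨ sym (*-assoc (odds y) (odds y ^ i) _) ⟩
          odds y ^ suc i * (2 ^ y) ^ (Tₗ ∸ i)                     ≤⟨ *-monoʳ-≤ (odds y ^ suc i) (^-monoʳ-≤ (2 ^ y) {{m^n≢0 2 y}} le) ⟩
          odds y ^ suc i * (2 ^ y * (2 ^ y) ^ (Tₗ ∸ suc i))       ≡⟨ eq (odds y ^ suc i) (2 ^ y) ((2 ^ y) ^ (Tₗ ∸ suc i)) ⟩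
          2 ^ y * (odds y ^ suc i * (2 ^ y) ^ (Tₗ ∸ suc i)) ∎
          where
          open ≤-Reasoning
          eq : ∀ x y z → x * (y * z) ≡ y * (x * z)
          eq = solve-∀
          le : Tₗ ∸ i ≤ suc (Tₗ ∸ suc i)
          le = subst (λ z → Tₗ ∸ i ≤ suc z) (trans (∸-+-assoc Tₗ i 1) (cong (Tₗ ∸_) (+-comm i 1))) (m≤n+m∸n (Tₗ ∸ i) 1)

      last : ∀ T → Cert (λ R → ∀ v → R v ≡ false) (λ _ _ → 0) (lastOps a T) (MaxDeg a) (λ _ _ → wl T)
      last zero = aside {I = MaxDeg a} {I′ = λ R → ∀ v → R v ≡ false} {aw = λ _ _ → wl 0} {aw′ = λ _ _ → 0}
        (λ R _ v → ¬true λ p → true≢false (proj₂ (∧⁻ {R v} p)) (dec-false (deg R v <? 0) (λ ())))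
        (λ R v _ _ → (λ ()) , λ _ → ≤-reflexive (trans Z≡ (sym (+-identityʳ _)))) done
      last (suc T) = mark {I = MaxDeg a} {I′ = MaxDeg a} {aw = λ _ _ → wl (suc T)} {aw′ = λ _ _ → wl T} (λ R m → shrink-MaxDeg a a R m) ok (last T)
        where
        ok : MarkOK a (MaxDeg a) (λ _ _ → wl (suc T)) (λ _ _ → wl T)
        ok R maxdeg v Rv with self-survival a′ R v Rv maxdeg
        ... | X , surv , d , SX = (λ m → X m * wl T) ,
                (λ m h → subst (λ x → wl T ≤ x * wl T) (sym (surv m h)) (≤-reflexive (sym (+-identityʳ _)))) ,
                (λ p k m m′ h → cong (_* wl T) (d p k m m′ h)) ,
                *-cancelˡ-≤ (2 ^ y) {{m^n≢0 2 y}} (begin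
                  2 ^ y * S (odds a) (λ m → X m * wl T)   ≡⟨ cong (2 ^ y *_) (S-*ʳ (odds a) X (wl T)) ⟩
                  2 ^ y * (S (odds a) X * wl T)           ≡⟨ eq₁ (2 ^ y) (S (odds a) X) (wl T) ⟩
                  S (odds a) X * 2 ^ y * wl T             ≤⟨ *-monoˡ-≤ (wl T) SX ⟩
                  odds y * suc (odds a) ^ n * wl T        ≡⟨ eq₂ (odds y) (suc (odds a) ^ n) (wl T) ⟩
                  suc (odds a) ^ n * (odds y * wl T)      ≤⟨ *-monoʳ-≤ (suc (odds a) ^ n) (wl-step T) ⟩
                  suc (odds a) ^ n * (2 ^ y * wl (suc T)) ≡⟨ eq₃ (suc (odds a) ^ n) (2 ^ y) (wl (suc T)) ⟩
                  2 ^ y * (suc (odds a) ^ n * wl (suc T)) ∎)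
          where
          open ≤-Reasoning
          eq₁ : ∀ x y z → x * (y * z) ≡ y * x * z
          eq₁ = solve-∀
          eq₂ : ∀ x y z → x * y * z ≡ y * (x * z)
          eq₂ = solve-∀
          eq₃ : ∀ x y z → x * (y * z) ≡ y * (x * z)
          eq₃ = solve-∀

-- Binary trees of survivors

-- Vertices surviving t + 1 peelings carry a complete binary tree of depth t below
-- them; Ψ t counts such trees inside U, weighting each by φ at children of its leaves.
module Branching {n : ℕ} {G : Graph n} (RT : Rooted G) (U : Fin n → Bool) where
  open Algorithm G
  open Correctness G
  open Subtree RT
  open Analysis RT
  open Potential RT

  private
    k : Fin n → Fin n → Bool
    k v c = kid v c ∧ U c

    k-kid : ∀ {v c} → k v c ≡ true → kid v c ≡ true
    k-kid p = proj₁ (∧⁻ p)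

  Ψ : ℕ → (Fin n → ℕ) → Fin n → ℕ
  Ψ zero    φ v = ∑ (λ g → ⟦ k v g ⟧ * φ g)
  Ψ (suc t) φ v = ∑ (λ c → ∑ (λ c′ → ⟦ k v c ∧ (k v c′ ∧ not (c == c′)) ⟧ * (Ψ t φ c * Ψ t φ c′)))

  private
    Ψ-mono : ∀ t {f g : Fin n → ℕ} → (∀ v → f v ≤ g v) → ∀ v → Ψ t f v ≤ Ψ t g v
    Ψ-mono zero    h v = ∑-mono (λ g → *-monoʳ-≤ ⟦ k v g ⟧ (h g))
    Ψ-mono (suc t) h v = ∑-mono (λ c → ∑-mono (λ c′ → *-monoʳ-≤ ⟦ k v c ∧ (k v c′ ∧ not (c == c′)) ⟧ (*-mono-≤ (Ψ-mono t h c) (Ψ-mono t h c′))))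

    split : ∀ v c c′ → (k v c ∧ (k v c′ ∧ not (c == c′))) ≡ true → kid v c ≡ true × kid v c′ ≡ true × c ≢ c′
    split v c c′ p = k-kid (proj₁ (∧⁻ p)) , k-kid (proj₁ (∧⁻ q)) , does⁻-false (c ≟ c′) (not⁻ (proj₂ (∧⁻ {k v c′} q)))
      where
      q : (k v c′ ∧ not (c == c′)) ≡ true
      q = proj₂ (∧⁻ {k v c} p)

    guard-cong : ∀ a {x y} → (a ≡ true → x ≡ y) → ⟦ a ⟧ * x ≡ ⟦ a ⟧ * y
    guard-cong true  h = cong (1 *_) (h refl)
    guard-cong false h = refl

    module _ (ψ : Fin n → Vec Bool n → ℕ) (ψ-dep : ∀ v p → kid p v ≡ true → Dep (sub p) (ψ v)) where

      -- A weight ψ g sits at a child g of a leaf and depends on the subtree of that leaf, which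
      -- lies below v.
      Ψ-dep : ∀ t v → Dep (sub v) (λ m → Ψ t (λ u → ψ u m) v)
      Ψ-dep zero    v m m′ h = ∑-cong (λ g → guard-cong (k v g) (λ p → ψ-dep g v (k-kid p) m m′ h))
      Ψ-dep (suc t) v m m′ h = ∑-cong (λ c → ∑-cong (λ c′ → guard-cong (k v c ∧ (k v c′ ∧ not (c == c′))) λ p →
        cong₂ _*_ (below (proj₁ (split v c c′ p))) (below (proj₁ (proj₂ (split v c c′ p))))))
        where
        below : ∀ {c} → kid v c ≡ true → Ψ t (λ u → ψ u m) c ≡ Ψ t (λ u → ψ u m′) c
        below q = Dep-⊆ (λ u → sub-up q) (Ψ-dep t _) m m′ h

      -- Sums are handled by linearity. Distinct siblings have disjoint subtrees, so `S-indep`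
      -- splits each product of two counts.
      Ψ-avg : ∀ b φ → (∀ v → S b (ψ v) ≤ suc b ^ n * φ v) → ∀ t v → S b (λ m → Ψ t (λ u → ψ u m) v) ≤ suc b ^ n * Ψ t φ v
      Ψ-avg b φ h zero v = begin
        S b (λ m → ∑ (λ g → ⟦ k v g ⟧ * ψ g m))     ≡⟨ S-∑ b (λ g m → ⟦ k v g ⟧ * ψ g m) ⟩
        ∑ (λ g → S b (λ m → ⟦ k v g ⟧ * ψ g m))     ≤⟨ ∑-mono (λ g → guarded b (k v g) (ψ g) (φ g) (λ _ → h g)) ⟩
        ∑ (λ g → ⟦ k v g ⟧ * φ g * B)               ≡⟨ ∑-*ʳ (λ g → ⟦ k v g ⟧ * φ g) B ⟩
        Ψ zero φ v * B                              ≡⟨ *-comm (Ψ zero φ v) B ⟩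
        B * Ψ zero φ v ∎
        where
        open ≤-Reasoning
        B : ℕ
        B = suc b ^ n
        guarded : ∀ b a (f : Vec Bool n → ℕ) x → (a ≡ true → S b f ≤ suc b ^ n * x) → S b (λ m → ⟦ a ⟧ * f m) ≤ ⟦ a ⟧ * x * suc b ^ n
        guarded b true  f x h = ≤-trans (≤-reflexive (S-1* b f)) (≤-trans (h refl) (≤-reflexive (trans (*-comm (suc b ^ n) x) (cong (_* suc b ^ n) (sym (+-identityʳ x))))))
        guarded b false f x h = ≤-reflexive (trans (S-const b n 0) (*-zeroʳ (suc b ^ n)))
      Ψ-avg b φ h (suc t) v = begin
        S b (λ m → ∑ (λ c → ∑ (λ c′ → term c c′ m)))     ≡⟨ S-∑ b (λ c m → ∑ (λ c′ → term c c′ m)) ⟩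
        ∑ (λ c → S b (λ m → ∑ (λ c′ → term c c′ m)))     ≡⟨ ∑-cong (λ c → S-∑ b (term c)) ⟩
        ∑ (λ c → ∑ (λ c′ → S b (term c c′)))             ≤⟨ ∑-mono (λ c → ∑-mono (λ c′ → bound c c′)) ⟩
        ∑ (λ c → ∑ (λ c′ → val c c′ * B))                ≡⟨ ∑-cong (λ c → ∑-*ʳ (val c) B) ⟩
        ∑ (λ c → ∑ (val c) * B)                          ≡⟨ ∑-*ʳ (λ c → ∑ (val c)) B ⟩
        Ψ (suc t) φ v * B                                ≡⟨ *-comm (Ψ (suc t) φ v) B ⟩
        B * Ψ (suc t) φ v ∎
        where
        open ≤-Reasoning
        B : ℕ
        B = suc b ^ n
        g : Fin n → Fin n → Bool
        g c c′ = k v c ∧ (k v c′ ∧ not (c == c′))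
        X : Fin n → Vec Bool n → ℕ
        X c m = Ψ t (λ u → ψ u m) c
        term : Fin n → Fin n → Vec Bool n → ℕ
        term c c′ m = ⟦ g c c′ ⟧ * (X c m * X c′ m)
        val : Fin n → Fin n → ℕ
        val c c′ = ⟦ g c c′ ⟧ * (Ψ t φ c * Ψ t φ c′)
        eq : ∀ B x y → B * x * (B * y) ≡ B * (B * (x * y))
        eq = solve-∀
        eq₂ : ∀ B z → B * z ≡ (z + 0) * B
        eq₂ = solve-∀
        bound : ∀ c c′ → S b (term c c′) ≤ val c c′ * B
        bound c c′ with g c c′ in eqg
        ... | false = ≤-reflexive (trans (S-const b n 0) (*-zeroʳ B))
        ... | true with split v c c′ eqg
        ...   | kc , kc′ , c≢c′ = ≤-trans (≤-reflexive (S-1* b (λ m → X c m * X c′ m))) (≤-trans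
                  (*-cancelˡ-≤ B {{m^n≢0 (suc b) n}} (begin
                    B * S b (λ m → X c m * X c′ m)
                      ≡⟨ S-indep b (sub c) (X c) (X c′) (Ψ-dep t c) (Dep-⊆ (λ u s → cong not (sub-disjoint kc′ kc (c≢c′ ∘ sym) s)) (Ψ-dep t c′)) ⟩
                    S b (X c) * S b (X c′)               ≤⟨ *-mono-≤ (Ψ-avg b φ h t c) (Ψ-avg b φ h t c′) ⟩
                    B * Ψ t φ c * (B * Ψ t φ c′)         ≡⟨ eq B (Ψ t φ c) (Ψ t φ c′) ⟩
                    B * (B * (Ψ t φ c * Ψ t φ c′)) ∎))
                  (≤-reflexive (eq₂ B (Ψ t φ c * Ψ t φ c′))))

  Ψ-admissible : ∀ t v → Admissible (λ φ → Ψ t φ v)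
  Ψ-admissible t v = record { mono = λ h → Ψ-mono t h v ; avg = λ b ψ φ d h → Ψ-avg ψ d b φ h t v }

  peels-⊆ : ∀ i A v → peels i A v ≡ true → A v ≡ true
  peels-⊆ zero    A v p = p
  peels-⊆ (suc i) A v p = proj₁ (∧⁻ (peels-⊆ i (peel A) v p))

  private
    peels⁻ : ∀ i A v → peels (suc i) A v ≡ true → 2 < deg (peels i A) v
    peels⁻ zero    A v p = does⁻ (2 <? deg A v) (proj₂ (∧⁻ {A v} p))
    peels⁻ (suc i) A v p = peels⁻ i (peel A) v p

    two-kids : ∀ i A v → peels (suc i) A v ≡ true → 2 ≤ kids (peels i A) v
    two-kids i A v p = ≤-pred (≤-trans (peels⁻ i A v p) (deg≤1+kids (peels i A) v))

  -- Surviving one more peeling takes degree at least 3, hence two children that survived up to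
  -- then. The complete binary tree found in this way is one summand, with 2^t factors of at least
  -- Z.
  Ψ-lower : ∀ Z φ A → (∀ v → A v ≡ true → U v ≡ true × Z ≤ φ v) → ∀ t v → peels (suc t) A v ≡ true → Z ^ 2 ^ t ≤ Ψ t φ v
  Ψ-lower Z φ A h zero v p with cnt≥1 (λ u → kid v u ∧ A u) (≤-trans (s≤s z≤n) (two-kids 0 A v p))
  ... | g , q = begin
    Z * 1                       ≡⟨ *-identityʳ Z ⟩
    Z                           ≤⟨ proj₂ (h g Ag) ⟩
    φ g                         ≡⟨ sym (*-identityˡ (φ g)) ⟩
    1 * φ g                     ≡⟨ cong (λ a → ⟦ a ⟧ * φ g) (sym (∧⁺ (proj₁ (∧⁻ {kid v g} q)) (proj₁ (h g Ag)))) ⟩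
    ⟦ k v g ⟧ * φ g             ≤⟨ ≤∑ (λ g → ⟦ k v g ⟧ * φ g) g ⟩
    Ψ zero φ v ∎
    where
    open ≤-Reasoning
    Ag : A g ≡ true
    Ag = proj₂ (∧⁻ {kid v g} q)
  Ψ-lower Z φ A h (suc t) v p with cnt≥2 (λ u → kid v u ∧ peels (suc t) A u) (two-kids (suc t) A v p)
  ... | c , c′ , c≢c′ , q , q′ = begin
    Z ^ (2 * 2 ^ t)                   ≡⟨ cong (Z ^_) (cong (2 ^ t +_) (+-identityʳ (2 ^ t))) ⟩
    Z ^ (2 ^ t + 2 ^ t)               ≡⟨ ^-distribˡ-+-* Z (2 ^ t) (2 ^ t) ⟩
    Z ^ 2 ^ t * Z ^ 2 ^ t             ≤⟨ *-mono-≤ (Ψ-lower Z φ A h t c pc) (Ψ-lower Z φ A h t c′ pc′) ⟩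
    Ψ t φ c * Ψ t φ c′                ≡⟨ sym (*-identityˡ _) ⟩
    1 * (Ψ t φ c * Ψ t φ c′)          ≡⟨ cong (λ a → ⟦ a ⟧ * (Ψ t φ c * Ψ t φ c′)) (sym guard) ⟩
    term c c′                         ≤⟨ ≤∑ (term c) c′ ⟩
    ∑ (term c)                        ≤⟨ ≤∑ (λ c → ∑ (term c)) c ⟩
    Ψ (suc t) φ v ∎
    where
    open ≤-Reasoning
    term : Fin n → Fin n → ℕ
    term c c′ = ⟦ k v c ∧ (k v c′ ∧ not (c == c′)) ⟧ * (Ψ t φ c * Ψ t φ c′)
    pc : peels (suc t) A c ≡ true
    pc = proj₂ (∧⁻ {kid v c} q)
    pc′ : peels (suc t) A c′ ≡ true
    pc′ = proj₂ (∧⁻ {kid v c′} q′)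
    inU : ∀ u → peels (suc t) A u ≡ true → U u ≡ true
    inU u r = proj₁ (h u (peels-⊆ (suc t) A u r))
    guard : (k v c ∧ (k v c′ ∧ not (c == c′))) ≡ true
    guard = ∧⁺ (∧⁺ (proj₁ (∧⁻ {kid v c} q)) (inU c pc)) (∧⁺ (∧⁺ (proj₁ (∧⁻ {kid v c′} q′)) (inU c′ pc′)) (cong not (dec-false (c ≟ c′) c≢c′)))

  module Upper (a : ℕ) (U-deg : MaxDeg a U) (φ : Fin n → ℕ) (w Z : ℕ) (φ≤ : ∀ v → U v ≡ true → φ v ≤ w)
               (small : 2 ^ a * 2 ^ a * (2 ^ a * w) * 2 ≤ Z) where
    private
      D : ℕ
      D = 2 ^ a

      k≤ : ∀ v → U v ≡ true → cnt (k v) ≤ D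
      k≤ v p = ≤-trans (kids≤deg U v) (U-deg v p)

      guard-≤ : ∀ g {x y} → (g ≡ true → x ≤ y) → ⟦ g ⟧ * x ≤ ⟦ g ⟧ * y
      guard-≤ true  h = *-monoʳ-≤ 1 (h refl)
      guard-≤ false h = z≤n

    -- A vertex has at most D * D ordered pairs of children. Carrying this factor along on the left
    -- makes the left side at most square from one depth to the next, exactly as the right side
    -- does.
    Ψ-upper : ∀ t v → U v ≡ true → D * D * Ψ t φ v * 2 ^ 2 ^ t ≤ Z ^ 2 ^ t
    Ψ-upper zero v p = begin
      D * D * Ψ zero φ v * 2                   ≤⟨ *-monoˡ-≤ 2 (*-monoʳ-≤ (D * D) base) ⟩
      D * D * (D * w) * 2                      ≤⟨ small ⟩
      Z                                        ≡⟨ sym (*-identityʳ Z) ⟩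
      Z * 1 ∎
      where
      open ≤-Reasoning
      base : Ψ zero φ v ≤ D * w
      base = begin
        ∑ (λ g → ⟦ k v g ⟧ * φ g)    ≤⟨ ∑-mono (λ g → guard-≤ (k v g) (λ q → φ≤ g (proj₂ (∧⁻ {kid v g} q)))) ⟩
        ∑ (λ g → ⟦ k v g ⟧ * w)      ≡⟨ ∑-*ʳ (λ g → ⟦ k v g ⟧) w ⟩
        cnt (k v) * w                ≤⟨ *-monoˡ-≤ w (k≤ v p) ⟩
        D * w ∎
    Ψ-upper (suc t) v p = *-cancelˡ-≤ P {{m*n≢0 D D {{m^n≢0 2 a}} {{m^n≢0 2 a}}}} (begin
      P * (P * Ψ (suc t) φ v * 2 ^ (2 * 2 ^ t))
        ≡⟨ cong (λ e → P * (P * Ψ (suc t) φ v * e)) (square 2) ⟩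
      P * (P * Ψ (suc t) φ v * (q * q))
        ≡⟨ eq₁ P (Ψ (suc t) φ v) q ⟩
      Ψ (suc t) φ v * (P * P * (q * q))
        ≡⟨ sym (trans (∑-cong (λ c → ∑-*ʳ (term c) (P * P * (q * q)))) (∑-*ʳ (λ c → ∑ (term c)) (P * P * (q * q)))) ⟩
      ∑ (λ c → ∑ (λ c′ → term c c′ * (P * P * (q * q))))
        ≤⟨ ∑-mono (λ c → ∑-mono (λ c′ → bound c c′)) ⟩
      ∑ (λ c → ∑ (λ c′ → ⟦ k v c′ ⟧ * (⟦ k v c ⟧ * (Y * Y))))
        ≡⟨ ∑-cong (λ c → ∑-*ʳ (λ c′ → ⟦ k v c′ ⟧) (⟦ k v c ⟧ * (Y * Y))) ⟩
      ∑ (λ c → cnt (k v) * (⟦ k v c ⟧ * (Y * Y)))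
        ≡⟨ ∑-cong (λ c → eq₂ (cnt (k v)) ⟦ k v c ⟧ (Y * Y)) ⟩
      ∑ (λ c → ⟦ k v c ⟧ * (cnt (k v) * (Y * Y)))
        ≡⟨ ∑-*ʳ (λ c → ⟦ k v c ⟧) (cnt (k v) * (Y * Y)) ⟩
      cnt (k v) * (cnt (k v) * (Y * Y))
        ≤⟨ *-mono-≤ (k≤ v p) (*-monoˡ-≤ (Y * Y) (k≤ v p)) ⟩
      D * (D * (Y * Y))
        ≡⟨ trans (sym (*-assoc D D (Y * Y))) (cong (P *_) (sym (square Z))) ⟩
      P * Z ^ (2 * 2 ^ t) ∎)
      where
      open ≤-Reasoning
      P q Y : ℕ
      P = D * D
      q = 2 ^ 2 ^ t
      Y = Z ^ 2 ^ t
      square : ∀ z → z ^ (2 * 2 ^ t) ≡ z ^ 2 ^ t * z ^ 2 ^ t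
      square z = trans (cong (z ^_) (cong (2 ^ t +_) (+-identityʳ (2 ^ t)))) (^-distribˡ-+-* z (2 ^ t) (2 ^ t))
      term : Fin n → Fin n → ℕ
      term c c′ = ⟦ k v c ∧ (k v c′ ∧ not (c == c′)) ⟧ * (Ψ t φ c * Ψ t φ c′)
      eq₁ : ∀ P z q → P * (P * z * (q * q)) ≡ z * (P * P * (q * q))
      eq₁ = solve-∀
      eq₂ : ∀ c g x → c * (g * x) ≡ g * (c * x)
      eq₂ = solve-∀
      eq₃ : ∀ P q x x′ → (x * x′ + 0) * (P * P * (q * q)) ≡ P * x * q * (P * x′ * q)
      eq₃ = solve-∀
      bound : ∀ c c′ → term c c′ * (P * P * (q * q)) ≤ ⟦ k v c′ ⟧ * (⟦ k v c ⟧ * (Y * Y))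
      bound c c′ with k v c in eqc | k v c′ in eqc′ | c == c′
      ... | false | _     | _     = z≤n
      ... | true  | false | _     = z≤n
      ... | true  | true  | true  = z≤n
      ... | true  | true  | false = ≤-trans (≤-reflexive (eq₃ P q (Ψ t φ c) (Ψ t φ c′)))
              (≤-trans (*-mono-≤ (Ψ-upper t c (proj₂ (∧⁻ {kid v c} eqc))) (Ψ-upper t c′ (proj₂ (∧⁻ {kid v c′} eqc′))))
                       (≤-reflexive (sym (trans (+-identityʳ _) (+-identityʳ _)))))

-- Counting random assignments

V : ∀ {m n} → (Vec (Fin m) n → ℕ) → ℕ
V {n = zero}  f = f []
V {n = suc n} f = ∑ (λ a → V (λ r → f (a ∷ r)))

V-cong : ∀ {m n} {f g : Vec (Fin m) n → ℕ} → (∀ r → f r ≡ g r) → V f ≡ V g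
V-cong {n = zero}  h = h []
V-cong {n = suc n} h = ∑-cong (λ a → V-cong (λ r → h (a ∷ r)))

V-+ : ∀ {m n} (f g : Vec (Fin m) n → ℕ) → V (λ r → f r + g r) ≡ V f + V g
V-+ {n = zero}  f g = refl
V-+ {n = suc n} f g = trans (∑-cong (λ a → V-+ (λ r → f (a ∷ r)) (λ r → g (a ∷ r)))) (∑-+ (λ a → V (λ r → f (a ∷ r))) (λ a → V (λ r → g (a ∷ r))))

V-const : ∀ m n c → V {m} {n} (λ _ → c) ≡ m ^ n * c
V-const m zero    c = sym (+-identityʳ c)
V-const m (suc n) c = trans (∑-cong {m} {λ _ → V {m} {n} (λ _ → c)} (λ a → V-const m n c)) (trans (∑-const m (m ^ n * c)) (sym (*-assoc m (m ^ n) c)))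

V-∑ : ∀ {m n k} (f : Fin k → Vec (Fin m) n → ℕ) → V (λ r → ∑ (λ i → f i r)) ≡ ∑ (λ i → V (f i))
V-∑ {m} {n} {zero}  f = trans (V-const m n 0) (*-zeroʳ (m ^ n))
V-∑ {m} {n} {suc k} f = trans (V-+ (f zero) (λ r → ∑ (λ i → f (suc i) r))) (cong (V (f zero) +_) (V-∑ (f ∘ suc)))

∑-++ : ∀ a b (f : Fin (a + b) → ℕ) → ∑ f ≡ ∑ (λ i → f (i ↑ˡ b)) + ∑ (λ i → f (a ↑ʳ i))
∑-++ zero    b f = refl
∑-++ (suc a) b f = trans (cong (f zero +_) (∑-++ a b (f ∘ suc))) (sym (+-assoc (f zero) _ _))

∑-combine : ∀ a b (f : Fin (a * b) → ℕ) → ∑ f ≡ ∑ (λ i → ∑ (λ j → f (combine {a} {b} i j)))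
∑-combine zero    b f = refl
∑-combine (suc a) b f = trans (∑-++ b (a * b) f) (cong (∑ (λ i → f (i ↑ˡ (a * b))) +_) (∑-combine a b (λ i → f (b ↑ʳ i))))

module _ (a b : ℕ) where
  digit : Fin (a * b) → Fin a
  digit i = proj₁ (remQuot {a} b i)

  rest : Fin (a * b) → Fin b
  rest i = proj₂ (remQuot {a} b i)

  ∑-digits : ∀ (g : Fin a → Fin b → ℕ) → ∑ (λ i → g (digit i) (rest i)) ≡ ∑ (λ i → ∑ (λ j → g i j))
  ∑-digits g = trans (∑-combine a b _) (∑-cong (λ i → ∑-cong (λ j → cong (λ p → g (proj₁ p) (proj₂ p)) (remQuot-combine i j))))

  V-digits : ∀ {n} (f : Vec (Fin a) n → Vec (Fin b) n → ℕ) → V (λ r → f (map digit r) (map rest r)) ≡ V (λ x → V (λ y → f x y))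
  V-digits {zero}  f = refl
  V-digits {suc n} f = trans (∑-cong (λ i → V-digits (λ x y → f (digit i ∷ x) (rest i ∷ y))))
    (trans (∑-digits (λ i j → V (λ x → V (λ y → f (i ∷ x) (j ∷ y)))))
           (∑-cong (λ i → sym (V-∑ (λ j x → V (λ y → f (i ∷ x) (j ∷ y)))))))

isZero : ∀ {n} → Fin n → Bool
isZero zero    = true
isZero (suc _) = false

V-marks : ∀ b {n} (f : Vec Bool n → ℕ) → V {suc b} (λ r → f (map isZero r)) ≡ S b f
V-marks b {zero}  f = refl
V-marks b {suc n} f = cong₂ _+_ (V-marks b (f ∘ (true ∷_)))
  (trans (∑-const b _) (cong (b *_) (V-marks b (f ∘ (false ∷_)))))

size : List Op → ℕ
size []              = 1
size (mark j ∷ ops)  = suc (odds j) * size ops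
size (aside D ∷ ops) = size ops

size≥1 : ∀ ops → 1 ≤ size ops
size≥1 []              = ≤-refl
size≥1 (mark j ∷ ops)  = *-mono-≤ {1} {suc (odds j)} (s≤s z≤n) (size≥1 ops)
size≥1 (aside D ∷ ops) = size≥1 ops

mass≡ : ∀ n ops → mass n ops ≡ size ops ^ n
mass≡ n []              = sym (^-zeroˡ n)
mass≡ n (mark j ∷ ops)  = trans (cong (suc (odds j) ^ n *_) (mass≡ n ops)) (sym (^-distribʳ-* n (suc (odds j)) (size ops)))
mass≡ n (aside D ∷ ops) = mass≡ n ops

-- Each node draws a single number, read in mixed radix with one digit per marking step. Digit 0
-- means marked, which has probability 2^-j.
decode : ∀ {n} ops → Vec (Fin (size ops)) n → Ω n ops
decode []              r = tt
decode (mark j ∷ ops)  r = map isZero (map (digit (suc (odds j)) (size ops)) r) , decode ops (map (rest (suc (odds j)) (size ops)) r)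
decode (aside D ∷ ops) r = decode ops r

V-decode : ∀ {n} ops (f : Ω n ops → ℕ) → V (λ r → f (decode ops r)) ≡ SS ops f
V-decode {n} [] f = trans (V-const 1 n (f tt)) (trans (cong (_* f tt) (^-zeroˡ n)) (*-identityˡ (f tt)))
V-decode (mark j ∷ ops) f = begin
  V (λ r → f (map isZero (map (digit B m) r) , decode ops (map (rest B m) r)))
    ≡⟨ V-digits B m (λ x y → f (map isZero x , decode ops y)) ⟩
  V (λ x → V (λ y → f (map isZero x , decode ops y)))
    ≡⟨ V-cong (λ x → V-decode ops (λ ω → f (map isZero x , ω))) ⟩
  V (λ x → SS ops (λ ω → f (map isZero x , ω)))
    ≡⟨ V-marks (odds j) (λ m → SS ops (λ ω → f (m , ω))) ⟩
  S (odds j) (λ m → SS ops (λ ω → f (m , ω))) ∎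
  where
  open ≡-Reasoning
  B m : ℕ
  B = suc (odds j)
  m = size ops
V-decode (aside D ∷ ops) f = V-decode ops f

lsum : ∀ {A : Set} → (A → ℕ) → List A → ℕ
lsum f []       = 0
lsum f (x ∷ xs) = f x + lsum f xs

lsum-++ : ∀ {A : Set} (f : A → ℕ) xs ys → lsum f (xs ++ ys) ≡ lsum f xs + lsum f ys
lsum-++ f []       ys = refl
lsum-++ f (x ∷ xs) ys = trans (cong (f x +_) (lsum-++ f xs ys)) (sym (+-assoc (f x) (lsum f xs) (lsum f ys)))

lsum-map : ∀ {A B : Set} (f : B → ℕ) (g : A → B) xs → lsum f (List.map g xs) ≡ lsum (f ∘ g) xs
lsum-map f g []       = refl
lsum-map f g (x ∷ xs) = cong (f (g x) +_) (lsum-map f g xs)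

lsum-tabulate : ∀ {A : Set} {n} (f : A → ℕ) (g : Fin n → A) → lsum f (tabulate g) ≡ ∑ (f ∘ g)
lsum-tabulate {n = zero}  f g = refl
lsum-tabulate {n = suc n} f g = cong (f (g zero) +_) (lsum-tabulate f (g ∘ suc))

lsum-product : ∀ {A B C : Set} (h : A → B → C) (f : C → ℕ) xs ys →
               lsum f (cartesianProductWith h xs ys) ≡ lsum (λ x → lsum (f ∘ h x) ys) xs
lsum-product h f []       ys = refl
lsum-product h f (x ∷ xs) ys = trans (lsum-++ f (List.map (h x) ys) _) (cong₂ _+_ (lsum-map f (h x) ys) (lsum-product h f xs ys))

vectors : ∀ m n → List (Vec (Fin m) n)
vectors m zero    = [] ∷ []
vectors m (suc n) = cartesianProductWith _∷_ (allFin m) (vectors m n)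

vectors-unique : ∀ m n → Unique (vectors m n)
vectors-unique m zero    = All.[] ∷ []
vectors-unique m (suc n) = Unique.cartesianProductWith⁺ _∷_ ∷-injective (Unique.allFin⁺ m) (vectors-unique m n)

lsum-vectors : ∀ m n (f : Vec (Fin m) n → ℕ) → lsum f (vectors m n) ≡ V f
lsum-vectors m zero    f = +-identityʳ (f [])
lsum-vectors m (suc n) f = trans (lsum-product _∷_ f (allFin m) (vectors m n))
  (trans (lsum-tabulate {n = m} (λ x → lsum (f ∘ (x ∷_)) (vectors m n)) id) (∑-cong (λ a → lsum-vectors m n (λ r → f (a ∷ r)))))

length-filter : ∀ {A : Set} (bad : A → Bool) xs → lsum (λ _ → 1) xs ≤ length (filter (λ x → T? (not (bad x))) xs) + lsum (λ x → ⟦ bad x ⟧) xs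
length-filter bad []       = z≤n
length-filter bad (x ∷ xs) with bad x
... | true  = ≤-trans (s≤s (length-filter bad xs)) (≤-reflexive (sym (+-suc _ _)))
... | false = s≤s (length-filter bad xs)

whp : ∀ {n m} (A : RandAlg n m) (G : Graph n) (Good : Graph n → (Fin n → Bool) → Set) (bad : Vec (Fin m) n → Bool) →
      (∀ r → bad r ≡ false → Good G (A G r)) → V (λ r → ⟦ bad r ⟧) * (n * n) ≤ m ^ n → SucceedsWHP 2 1 A G Good
whp {n} {m} A G Good bad good few = L , Unique.filter⁺ P? (vectors-unique m n) ,
  All.map (λ {r} p → good r (not⁻ (Equivalence.to T-≡ p))) (All.all-filter P? (vectors m n)) ,
  (begin
    (m ^ n ∸ length L) ^ 1 * n ^ 2       ≡⟨ cong₂ _*_ (^-identityʳ (m ^ n ∸ length L)) (cong (n *_) (*-identityʳ n)) ⟩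
    (m ^ n ∸ length L) * (n * n)         ≤⟨ *-monoˡ-≤ (n * n) (m≤n+o⇒m∸n≤o (m ^ n) (length L) total) ⟩
    V (λ r → ⟦ bad r ⟧) * (n * n)        ≤⟨ few ⟩
    m ^ n                                ≡⟨ sym (^-identityʳ (m ^ n)) ⟩
    (m ^ n) ^ 1 ∎)
  where
  open ≤-Reasoning
  P? = λ r → T? (not (bad r))
  L : List (Vec (Fin m) n)
  L = filter P? (vectors m n)
  total : m ^ n ≤ length L + V (λ r → ⟦ bad r ⟧)
  total = begin
    m ^ n                                              ≡⟨ sym (trans (V-const m n 1) (*-identityʳ (m ^ n))) ⟩
    V {m} {n} (λ _ → 1)                                ≡⟨ sym (lsum-vectors m n (λ _ → 1)) ⟩
    lsum (λ _ → 1) (vectors m n)                       ≤⟨ length-filter bad (vectors m n) ⟩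
    length L + lsum (λ r → ⟦ bad r ⟧) (vectors m n)    ≡⟨ cong (length L +_) (lsum-vectors m n (λ r → ⟦ bad r ⟧)) ⟩
    length L + V (λ r → ⟦ bad r ⟧) ∎

-- Locality

nth-cong : ∀ {n} k {P P′ : Fin n → Bool} → (∀ i → P i ≡ P′ i) → nth k P ≡ nth k P′
nth-cong {zero}  k       h = refl
nth-cong {suc n} zero {P} {P′} h rewrite h zero | nth-cong {n} zero {P ∘ suc} {P′ ∘ suc} (h ∘ suc) = refl
nth-cong {suc n} (suc k) {P} {P′} h rewrite h zero | nth-cong {n} (if P′ zero then k else suc k) {P ∘ suc} {P′ ∘ suc} (h ∘ suc) = refl

Reach-snoc : ∀ {n} {G : Graph n} {k u v w} → Reach G k u v → adj G v w ≡ true → Reach G (suc k) u w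
Reach-snoc here       a = step a here
Reach-snoc (step b r) a = step b (Reach-snoc r a)

Reach-mono : ∀ {n} {G : Graph n} {k l u v} → k ≤ l → Reach G k u v → Reach G l u v
Reach-mono h       here       = here
Reach-mono (s≤s h) (step a r) = step a (Reach-mono h r)

module Locality {n : ℕ} (G G′ : Graph n) (v₀ : Fin n) (T : ℕ)
                (rows : ∀ u → Reach G T v₀ u → ∀ w → adj G u w ≡ adj G′ u w) where
  private
    module A = Algorithm G
    module B = Algorithm G′
    VSet : Set
    VSet = Fin n → Bool

  -- Locality is tracked as agreement on shrinking balls around v₀: every look at the neighbours
  -- costs one unit of radius.
  Agr : ∀ {X : Set} → ℕ → (Fin n → X) → (Fin n → X) → Set
  Agr k f f′ = ∀ u → Reach G k v₀ u → f u ≡ f′ u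

  Agr-≤ : ∀ {X : Set} {k l} {f f′ : Fin n → X} → k ≤ l → Agr l f f′ → Agr k f f′
  Agr-≤ h a u r = a u (Reach-mono h r)

  nbrs : ∀ {k} {P P′ : VSet} → k ≤ T → Agr (suc k) P P′ → ∀ u → Reach G k v₀ u → ∀ w → (adj G u w ∧ P w) ≡ (adj G′ u w ∧ P′ w)
  nbrs h a u r w rewrite sym (rows u (Reach-mono h r) w) with adj G u w in eq
  ... | true  = a w (Reach-snoc r eq)
  ... | false = refl

  nb-agr : ∀ {k} {P P′ : VSet} → k ≤ T → Agr (suc k) P P′ → Agr k (A.nb P) (B.nb P′)
  nb-agr h a u r = any-cong (nbrs h a u r)

  deg-agr : ∀ {k} {P P′ : VSet} → k ≤ T → Agr (suc k) P P′ → Agr k (A.deg P) (B.deg P′)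
  deg-agr h a u r = ∑-cong (λ w → cong ⟦_⟧ (nbrs h a u r w))

  near1-agr : ∀ {k} {P P′ : VSet} → k ≤ T → Agr (suc k) P P′ → Agr k (A.near1 P) (B.near1 P′)
  near1-agr {k} h a u r = cong₂ _∨_ (Agr-≤ (n≤1+n k) a u r) (nb-agr h a u r)

  near2-agr : ∀ {k} {P P′ : VSet} → suc k ≤ T → Agr (suc (suc k)) P P′ → Agr k (A.near2 P) (B.near2 P′)
  near2-agr {k} h a = near1-agr (≤-trans (n≤1+n k) h) (near1-agr h a)

  part-agr : ∀ {k} j {R R′ : VSet} → k ≤ T → Agr (suc k) R R′ → Agr k (A.part j R) (B.part j R′)
  part-agr {k} j h a u r = cong₂ (λ x d → x ∧ does (d ≤? 2 ^ j)) (Agr-≤ (n≤1+n k) a u r) (deg-agr h a u r)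

  joins-agr : ∀ {k} j {R R′ : VSet} m m′ → suc k ≤ T → Agr (2 + k) R R′ → Agr (1 + k) (lookup m) (lookup m′) →
              Agr k (A.joins j R m) (B.joins j R′ m′)
  joins-agr {k} j m m′ h a b u r = cong₂ _∧_ (Agr-≤ (n≤1+n k) p u r) (cong₂ (λ x y → x ∧ not y) (Agr-≤ (n≤1+n k) b u r)
    (nb-agr (≤-trans (n≤1+n k) h) (λ w s → cong₂ _∧_ (p w s) (b w s)) u r))
    where
    p = part-agr j h a

  AgrΩ : ∀ ops → Ω n ops → Ω n ops → Set
  AgrΩ []              _       _         = ⊤
  AgrΩ (mark j ∷ ops)  (m , ω) (m′ , ω′) = Agr T (lookup m) (lookup m′) × AgrΩ ops ω ω′
  AgrΩ (aside D ∷ ops) ω       ω′        = AgrΩ ops ω ω′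

  decode-agr : ∀ ops (r r′ : Vec (Fin (size ops)) n) → Agr T (lookup r) (lookup r′) → AgrΩ ops (decode ops r) (decode ops r′)
  decode-agr []              r r′ a = tt
  decode-agr (aside D ∷ ops) r r′ a = decode-agr ops r r′ a
  decode-agr (mark j ∷ ops)  r r′ a = map-agr isZero (map d r) (map d r′) (map-agr d r r′ a) , decode-agr ops _ _ (map-agr (rest (suc (odds j)) (size ops)) r r′ a)
    where
    d = digit (suc (odds j)) (size ops)
    map-agr : ∀ {X Y : Set} (f : X → Y) (r r′ : Vec X n) → Agr T (lookup r) (lookup r′) → Agr T (lookup (map f r)) (lookup (map f r′))
    map-agr f r r′ a u s = trans (lookup-map u f r) (trans (cong f (a u s)) (sym (lookup-map u f r′)))

  -- A marking step costs 4 units: one for the degrees, one for marked neighbours and two for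
  -- `near2`. `aside` is charged the same.
  run-agr : ∀ ops k {M R M′ R′} ω ω′ → length ops * 4 + k ≤ T → AgrΩ ops ω ω′ → Agr (length ops * 4 + k) M M′ → Agr (length ops * 4 + k) R R′ →
            Agr k (proj₁ (A.run ops (M , R) ω)) (proj₁ (B.run ops (M′ , R′) ω′))
  run-agr []              k ω ω′ h aΩ aM aR = aM
  run-agr (aside D ∷ ops) k {M} {R} {M′} {R′} ω ω′ h aΩ aM aR = run-agr ops k ω ω′ h′ aΩ (Agr-≤ (m≤n+m l 4) aM)
    (λ u r → cong₂ (λ x d → x ∧ does (d <? D)) (aR u (Reach-mono (m≤n+m l 4) r)) (deg-agr h′ (Agr-≤ (m≤n+m (1 + l) 3) aR) u r))
    where
    l : ℕ
    l = length ops * 4 + k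
    h′ : l ≤ T
    h′ = ≤-trans (m≤n+m l 4) h
  run-agr (mark j ∷ ops) k {M} {R} {M′} {R′} (m , ω) (m′ , ω′) h (am , aΩ) aM aR =
    run-agr ops k ω ω′ (≤-trans (m≤n+m l 4) h) aΩ
      (λ u r → cong₂ _∨_ (aM u (Reach-mono (m≤n+m l 4) r)) (aJ u (Reach-mono (m≤n+m l 2) r)))
      (λ u r → cong₂ (λ x y → x ∧ not y) (aR u (Reach-mono (m≤n+m l 4) r)) (near2-agr (≤-trans (m≤n+m (1 + l) 3) h) aJ u r))
    where
    l : ℕ
    l = length ops * 4 + k
    aJ : Agr (2 + l) (A.joins j R m) (B.joins j R′ m′)
    aJ = joins-agr j m m′ (≤-trans (m≤n+m (3 + l) 1) h) aR (Agr-≤ (≤-trans (m≤n+m (3 + l) 1) h) am)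

  peel-agr : ∀ {k} {P P′ : VSet} → k ≤ T → Agr (suc k) P P′ → Agr k (A.peel P) (B.peel P′)
  peel-agr {k} h a u r = cong₂ (λ x d → x ∧ does (2 <? d)) (Agr-≤ (n≤1+n k) a u r) (deg-agr h a u r)

  out-agr : ∀ t k {P P′ : VSet} → t + k ≤ T → Agr (t + k) P P′ → ∀ v → Reach G k v₀ v → ∀ u → A.out t P v u ≡ B.out t P′ v u
  out-agr zero    k h a v r u = refl
  out-agr (suc t) k {P} {P′} h a v r u = if-cong
    (cong₂ (λ x y → x ∧ not y) (a v (Reach-mono (m≤n+m k (suc t)) r)) (peel-agr h′ a v (Reach-mono (m≤n+m k t) r)))
    (nbrs (≤-trans (m≤n+m k (suc t)) h) (Agr-≤ (s≤s (m≤n+m k t)) a) v r u)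
    (out-agr t k h′ (peel-agr h′ a) v r u)
    where
    h′ : t + k ≤ T
    h′ = ≤-trans (n≤1+n (t + k)) h
    if-cong : ∀ {c c′ x x′ y y′ : Bool} → c ≡ c′ → x ≡ x′ → y ≡ y′ → (if c then x else y) ≡ (if c′ then x′ else y′)
    if-cong refl refl refl = refl

  cols-agr : ∀ F i k {p p′ : Fin n → Maybe (Fin n)} → (∀ v u → p v ≡ just u → adj G v u ≡ true) → Agr (i + k) p p′ →
             Agr k (A.cols F p i) (B.cols F p′ i)
  cols-agr F zero    k h a v r = refl
  cols-agr F (suc i) k {p} {p′} h a v r rewrite sym (a v (Reach-mono (m≤n+m k (suc i)) r)) with p v in eq
  ... | nothing = cong (λ x → ⟦ odd x ⟧) (cols-agr F i k h (Agr-≤ (n≤1+n (i + k)) a) v r)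
  ... | just u  = cong₂ (cv F) (cols-agr F i k h (Agr-≤ (n≤1+n (i + k)) a) v r)
                               (cols-agr F i (suc k) h (Agr-≤ (≤-reflexive (+-suc i k)) a) u (Reach-snoc r (h v u eq)))

  sweep-agr : ∀ xs k {col col′ : Fin n → Colour} {Q Q′ I I′ : VSet} → length xs + k ≤ T → Agr (length xs + k) col col′ →
              Agr (length xs + k) Q Q′ → Agr (length xs + k) I I′ → Agr k (A.sweep xs col Q I) (B.sweep xs col′ Q′ I′)
  sweep-agr []       k h ac aQ aI = aI
  sweep-agr (x ∷ xs) k h ac aQ aI = sweep-agr xs k h′ (Agr-≤ (n≤1+n l) ac) (Agr-≤ (n≤1+n l) aQ) λ u r →
    cong₂ _∨_ (Agr-≤ (n≤1+n l) aI u r) (cong₂ _∧_ (Agr-≤ (n≤1+n l) aQ u r)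
      (cong₂ (λ c y → does (c ≟ᶜ x) ∧ not y) (Agr-≤ (n≤1+n l) ac u r) (nb-agr h′ aI u r)))
    where
    l : ℕ
    l = length xs + k
    h′ : l ≤ T
    h′ = ≤-trans (n≤1+n l) h

  finish-agr : ∀ t F K {M M′ : VSet} → 2 + (t + (K + (length palette + 0))) ≤ T → Agr (2 + (t + (K + (length palette + 0)))) M M′ →
               Agr 0 (A.finish t F K M) (B.finish t F K M′)
  finish-agr t F K {M} {M′} h a v r = cong₂ _∨_ (a v (Reach-mono z≤n r))
    (sweep-agr palette 0 (≤-trans (≤-trans (m≤n+m l K) (m≤n+m (K + l) t)) h₂) aC (Agr-≤ (≤-trans (m≤n+m l K) (m≤n+m (K + l) t)) aQ) (λ _ _ → refl) v r)
    where
    l : ℕ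
    l = length palette + 0
    Q Q′ : VSet
    Q u = not (A.near2 M u)
    Q′ u = not (B.near2 M′ u)
    h₂ : t + (K + l) ≤ T
    h₂ = ≤-trans (m≤n+m (t + (K + l)) 2) h
    aQ : Agr (t + (K + l)) Q Q′
    aQ u s = cong not (near2-agr (≤-trans (m≤n+m (1 + (t + (K + l))) 1) h) a u s)
    aP : ∀ i → Agr (K + l) (λ v → nth i (A.out t Q v)) (λ v → nth i (B.out t Q′ v))
    aP i u s = nth-cong i (out-agr t (K + l) h₂ aQ u s)
    aC : Agr l (A.colour t F K Q) (B.colour t F K Q′)
    aC u s = cong₂ _,_ (cols-agr F K l (λ v w e → Correctness.out-adj G t Q v w (nth-sound (A.out t Q v) w 0 e)) (aP 0) u s)
                       (cols-agr F K l (λ v w e → Correctness.out-adj G t Q v w (nth-sound (A.out t Q v) w 1 e)) (aP 1) u s)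

algorithm : ∀ {n} ops (t F K : ℕ) → RandAlg n (size ops)
algorithm ops t F K G r = Algorithm.finish G t F K (proj₁ (Algorithm.run G ops ((λ _ → false) , (λ _ → true)) (decode ops r)))

rounds : List Op → ℕ → ℕ → ℕ
rounds ops t K = length ops * 4 + (2 + (t + (K + (length palette + 0))))

algorithm-local : ∀ {n} ops t F K → IsLocal {n} (rounds ops t K) (algorithm ops t F K)
algorithm-local ops t F K G G′ r r′ v same =
  finish-agr t F K (m≤n+m _ (length ops * 4))
    (run-agr ops (2 + (t + (K + (length palette + 0)))) (decode ops r) (decode ops r′) ≤-refl (decode-agr ops r r′ (λ u s → proj₁ (same u s))) (λ _ _ → refl) (λ _ _ → refl))
    v here
  where
  open Locality G G′ v (rounds ops t K) (λ u s → proj₂ (same u s))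

-- The schedule

-- On active degrees at most 2^(2s): with s half the exponent, rich and poor children
-- are equally effective. A vertex of degree at least 2^(s+7+k) survives one iteration
-- with probability at most 2^-(2^k).
sqOps : ℕ → ℕ → ℕ → List Op → List Op
sqOps s k T rest = iterate (s + s) s T (aside (2 * 2 ^ (s + 6 + k)) ∷ rest)

module _ {n : ℕ} {G : Graph n} (RT : Rooted G) where
  open Algorithm G
  open Subtree RT
  open Analysis RT
  open Potential RT

  -- `Level` with a = 2s, y = s + 6 and e = 2^k, for which the rich and the poor threshold both
  -- equal H.
  square-level : ∀ Z E s′ k W a T {Iₑ awₑ rest} → Z ≡ 2 ^ E → suc (suc s′ + 6 + k) ≤ a →
    Cert Z Iₑ awₑ rest (MaxDeg a) (λ _ _ → W) →
    Cert Z Iₑ awₑ (sqOps (suc s′) k T rest) (MaxDeg (suc s′ + suc s′)) (λ _ _ → W + 2 ^ (E ∸ 2 ^ k * T))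
  square-level Z E s′ k W a T {Iₑ} {awₑ} {rest} Z≡ a≥ c =
    level T (weak (λ R h v p → <⇒≤ (<-≤-trans (h v p) (^-monoʳ-≤ 2 a≥))) (λ _ _ _ _ → ≤-refl) c)
    where
    s H : ℕ
    s = suc s′
    H = 2 ^ (s + 6 + k)
    H≡ : 2 ^ (s + 6) * 2 ^ k ≡ H
    H≡ = sym (^-distribˡ-+-* 2 (s + 6) k)
    y+s : s + 6 + s ≡ s + s + 6
    y+s = trans (+-assoc s 6 s) (trans (cong (s +_) (+-comm 6 s)) (sym (+-assoc s s 6)))
    big : 2 ^ s < 2 * H
    big = <-≤-trans (^-monoʳ-< 2 (s≤s (s≤s z≤n)) (n<1+n s)) (^-monoʳ-≤ 2 (s≤s (≤-trans (m≤m+n s 6) (m≤m+n (s + 6) k))))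
    open Level Z E (s′ + suc s′) s′ (s + 6) (2 ^ k) H W Z≡ y+s (≤-reflexive H≡) (≤-reflexive H≡) big

-- Phase 1 halves the exponent of the maximum degree in each level, with failure
-- probability 2^-(2^(ℓ+3)), at most n⁻⁴ because n ≤ 2^(2^(ℓ+1)). In phase 2 the degree bound
-- is 2^(2(9+i)), and one iteration of level i fails with probability 2^-(2^i); so 2⁻ⁱ Y
-- iterations give 2^-Y, and the total number of iterations is a geometric sum.
module Schedule (ℓ a′ : ℕ) (a≥ : 16 ≤ suc a′) where

  -- A level on degrees 2^(2s) leaves degrees below 2^(s+7+k). For k = ℓ + 3 the map s to (s+7+k)/2
  -- has the fixed point ℓ + 10, and `suc (s₁ i)` exceeds it by 2^i, so each level lowers i by
  -- exactly 1.
  s₁ : ℕ → ℕ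
  s₁ i = ℓ + 9 + 2 ^ i

  phase₁ : ℕ → List Op
  phase₁ zero    = []
  phase₁ (suc i) = sqOps (suc (s₁ (suc i))) (ℓ + 3) 1 (phase₁ i)

  -- 2^Y equals D^3 * 2^(4+ℓ) * 2 for the degree bound D = 2^(2(ℓ+11)) at the start of phase 2, as
  -- `small` requires. `Tₗ` is 2^y * Y, so that (1 - 2^-y)^Tₗ ≤ 2^-Y, and E makes 2^E = (2^y)^Tₗ a
  -- common scale for the levels and the last steps.
  Y y Tₗ E : ℕ
  Y = ℓ * 7 + 71
  y = suc a′ + 6
  Tₗ = suc (odds y) * Y
  E = y * Tₗ

  T₂ : ℕ → ℕ
  T₂ zero    = Y
  T₂ (suc i) = ⌈ T₂ i /2⌉

  phase₂ : ℕ → List Op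
  phase₂ zero    = sqOps 9 0 (T₂ 0) (lastOps (suc a′) Tₗ)
  phase₂ (suc i) = sqOps (9 + suc i) (suc i) (T₂ (suc i)) (phase₂ i)

  ops : List Op
  ops = phase₁ ℓ ++ phase₂ (2 + ℓ)

  -- 2^(2^t) is the fourth power of the bound 2^(2^(ℓ+1)) on n. Identifiers fit into F bits, and K
  -- is the number of colour reductions.
  t K F : ℕ
  t = ℓ + 3
  K = suc ℓ
  F = 2 ^ suc ℓ

  T₂-enough : ∀ i → Y ≤ 2 ^ i * T₂ i
  T₂-enough zero    = ≤-reflexive (sym (+-identityʳ Y))
  T₂-enough (suc i) = begin
    Y                             ≤⟨ T₂-enough i ⟩
    2 ^ i * T₂ i                  ≤⟨ *-monoʳ-≤ (2 ^ i) (half-≤ (T₂ i)) ⟩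
    2 ^ i * (2 * ⌈ T₂ i /2⌉)      ≡⟨ eq (2 ^ i) ⌈ T₂ i /2⌉ ⟩
    2 * 2 ^ i * ⌈ T₂ i /2⌉ ∎
    where
    open ≤-Reasoning
    eq : ∀ x y → x * (2 * y) ≡ 2 * x * y
    eq = solve-∀
    half-≤ : ∀ x → x ≤ 2 * ⌈ x /2⌉
    half-≤ x = ≤-trans (≤-reflexive (sym (⌊n/2⌋+⌈n/2⌉≡n x)))
      (≤-trans (+-monoˡ-≤ ⌈ x /2⌉ (⌊n/2⌋≤⌈n/2⌉ x)) (≤-reflexive (cong (⌈ x /2⌉ +_) (sym (+-identityʳ ⌈ x /2⌉)))))

  module Bounds {n : ℕ} {G : Graph n} (RT : Rooted G) where
    open Algorithm G
    open Correctness G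
    open Subtree RT
    open Analysis RT
    open Potential RT

    Z₁ Z₂ : ℕ
    Z₁ = 2 ^ 2 ^ (ℓ + 3)
    Z₂ = 2 ^ E

    -- Each level is a single iteration whose gain 2^-e is 1/Z₁, so it adds weight 1.
    cert₁ : ∀ i → Cert Z₁ (MaxDeg (suc (s₁ 0) + suc (s₁ 0))) (λ _ _ → 0) (phase₁ i) (MaxDeg (suc (s₁ i) + suc (s₁ i))) (λ _ _ → i)
    cert₁ zero    = done
    cert₁ (suc i) = weak (λ _ h → h)
      (λ _ _ _ _ → ≤-reflexive (trans (cong (λ z → i + 2 ^ z) (trans (cong (2 ^ (ℓ + 3) ∸_) (*-identityʳ (2 ^ (ℓ + 3)))) (n∸n≡0 (2 ^ (ℓ + 3))))) (+-comm i 1)))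
      (square-level RT Z₁ (2 ^ (ℓ + 3)) (s₁ (suc i)) (ℓ + 3) i (suc (s₁ i) + suc (s₁ i)) 1 refl (≤-reflexive (eq ℓ (2 ^ i))) (cert₁ i))
      where
      eq : ∀ l x → 1 + (1 + (l + 9 + 2 * x) + 6 + (l + 3)) ≡ 1 + (l + 9 + x) + (1 + (l + 9 + x))
      eq = solve-∀

    u : ℕ
    u = 2 ^ (E ∸ Y)

    private
      Y≤Tₗ : Y ≤ Tₗ
      Y≤Tₗ = m≤m+n Y (odds y * Y)

      Y≤E : Y ≤ E
      Y≤E = ≤-trans Y≤Tₗ (m≤n*m Tₗ y)

      Z₂≡ : Z₂ ≡ (2 ^ y) ^ Tₗ
      Z₂≡ = sym (^-*-assoc 2 y Tₗ)

      u*2^Y : u * 2 ^ Y ≡ Z₂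
      u*2^Y = trans (sym (^-distribˡ-+-* 2 (E ∸ Y) Y)) (cong (2 ^_) (m∸n+n≡m Y≤E))

    last-weight : odds y ^ Tₗ * (2 ^ y) ^ (Tₗ ∸ Tₗ) ≤ u
    last-weight = *-cancelʳ-≤ _ u (2 ^ Y) {{m^n≢0 2 Y}} (begin
      odds y ^ Tₗ * (2 ^ y) ^ (Tₗ ∸ Tₗ) * 2 ^ Y    ≡⟨ cong (λ z → odds y ^ Tₗ * (2 ^ y) ^ z * 2 ^ Y) (n∸n≡0 Tₗ) ⟩
      odds y ^ Tₗ * 1 * 2 ^ Y                      ≡⟨ cong (_* 2 ^ Y) (*-identityʳ (odds y ^ Tₗ)) ⟩
      odds y ^ Tₗ * 2 ^ Y                          ≤⟨ power-decay (odds y) Y Tₗ ≤-refl ⟩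
      suc (odds y) ^ Tₗ                            ≡⟨ cong (_^ Tₗ) (suc-odds y) ⟩
      (2 ^ y) ^ Tₗ                                 ≡⟨ sym Z₂≡ ⟩
      Z₂                                           ≡⟨ sym u*2^Y ⟩
      u * 2 ^ Y ∎)
      where
      open ≤-Reasoning

    Ends : VSet → Set
    Ends R = ∀ v → R v ≡ false

    -- The last steps and each of the i + 1 levels contribute at most u = Z₂ * 2^-Y.
    cert₂ : ∀ i → Cert Z₂ Ends (λ _ _ → 0) (phase₂ i) (MaxDeg (9 + i + (9 + i))) (λ _ _ → (2 + i) * u)
    cert₂ zero = weak (λ _ h → h) (λ _ _ _ _ → +-mono-≤ last-weight (≤-trans (^-monoʳ-≤ 2 (∸-monoʳ-≤ E (T₂-enough 0))) (≤-reflexive (sym (+-identityʳ u)))))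
      (square-level RT Z₂ E 8 0 (odds y ^ Tₗ * (2 ^ y) ^ (Tₗ ∸ Tₗ)) (suc a′) (T₂ 0) refl a≥ (Last.last Z₂ a′ Tₗ Z₂≡ Tₗ))
    cert₂ (suc i) = weak (λ _ h → h)
      (λ _ _ _ _ → ≤-trans (+-monoʳ-≤ ((2 + i) * u) (^-monoʳ-≤ 2 (∸-monoʳ-≤ E (T₂-enough (suc i))))) (≤-reflexive (+-comm ((2 + i) * u) u)))
      (square-level RT Z₂ E (8 + suc i) (suc i) ((2 + i) * u) (9 + i + (9 + i)) (T₂ (suc i)) refl (≤-reflexive (eq i)) (cert₂ i))
      where
      eq : ∀ i → 1 + (1 + (8 + (1 + i)) + 6 + (1 + i)) ≡ 9 + i + (9 + i)
      eq = solve-∀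

    D : ℕ
    D = 2 ^ (9 + (2 + ℓ) + (9 + (2 + ℓ)))

    small : D * D * (D * ((2 + (2 + ℓ)) * u)) * 2 ≤ Z₂
    small = begin
      D * D * (D * ((4 + ℓ) * u)) * 2          ≤⟨ *-monoˡ-≤ 2 (*-monoʳ-≤ (D * D) (*-monoʳ-≤ D (*-monoˡ-≤ u (<⇒≤ (n<2^n (4 + ℓ)))))) ⟩
      D * D * (D * (2 ^ (4 + ℓ) * u)) * 2      ≡⟨ eq₁ D (2 ^ (4 + ℓ)) u ⟩
      u * (D * (D * (D * (2 ^ (4 + ℓ) * 2))))  ≡⟨ cong (u *_) powers ⟩
      u * 2 ^ Y                                ≡⟨ u*2^Y ⟩
      Z₂ ∎
      where
      open ≤-Reasoning
      d : ℕ
      d = 9 + (2 + ℓ) + (9 + (2 + ℓ))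
      eq₁ : ∀ D x u → D * D * (D * (x * u)) * 2 ≡ u * (D * (D * (D * (x * 2))))
      eq₁ = solve-∀
      eq₂ : ∀ l → 9 + (2 + l) + (9 + (2 + l)) + (9 + (2 + l) + (9 + (2 + l)) + (9 + (2 + l) + (9 + (2 + l)) + (4 + l + 1))) ≡ l * 7 + 71
      eq₂ = solve-∀
      powers : D * (D * (D * (2 ^ (4 + ℓ) * 2))) ≡ 2 ^ Y
      powers = trans (cong (λ z → D * (D * (D * z))) (sym (^-distribˡ-+-* 2 (4 + ℓ) 1)))
        (trans (cong (λ z → D * (D * z)) (sym (^-distribˡ-+-* 2 d (4 + ℓ + 1))))
        (trans (cong (D *_) (sym (^-distribˡ-+-* 2 d (d + (4 + ℓ + 1)))))
        (trans (sym (^-distribˡ-+-* 2 d (d + (d + (4 + ℓ + 1))))) (cong (2 ^_) (eq₂ ℓ)))))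

-- The failure probability

module _ {n : ℕ} (G : Graph n) where
  open Algorithm G

  SS-run-++ : ∀ ops₁ ops₂ st (f : State → ℕ) →
    SS (ops₁ ++ ops₂) (λ ω → f (run (ops₁ ++ ops₂) st ω)) ≡ SS ops₁ (λ ω₁ → SS ops₂ (λ ω₂ → f (run ops₂ (run ops₁ st ω₁) ω₂)))
  SS-run-++ []               ops₂ st      f = refl
  SS-run-++ (mark j ∷ ops₁)  ops₂ (M , R) f = S-cong (odds j) (λ m → SS-run-++ ops₁ ops₂ ((λ v → M v ∨ joins j R m v) , shrink j R m) f)
  SS-run-++ (aside D ∷ ops₁) ops₂ (M , R) f = SS-run-++ ops₁ ops₂ (M , keep D R) f

  run-grows : ∀ ops st ω v → proj₁ st v ≡ true → proj₁ (run ops st ω) v ≡ true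
  run-grows []              st      _       v p = p
  run-grows (mark j ∷ ops)  (M , R) (m , ω) v p = run-grows ops _ ω v (∨⁺ˡ p)
  run-grows (aside D ∷ ops) (M , R) ω       v p = run-grows ops _ ω v p

mass-++ : ∀ n ops₁ ops₂ → mass n (ops₁ ++ ops₂) ≡ mass n ops₁ * mass n ops₂
mass-++ n []               ops₂ = sym (+-identityʳ _)
mass-++ n (mark j ∷ ops₁)  ops₂ = trans (cong (suc (odds j) ^ n *_) (mass-++ n ops₁ ops₂)) (sym (*-assoc (suc (odds j) ^ n) (mass n ops₁) (mass n ops₂)))
mass-++ n (aside D ∷ ops₁) ops₂ = mass-++ n ops₁ ops₂

module Failure {n : ℕ} (G : Graph n) (RT : Rooted G) (t ℓ E d a₁ w : ℕ) (ops₁ ops₂ : List Op)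
               (n≤ : n ≤ 2 ^ a₁)
               (cert₁ : Potential.Cert RT (2 ^ 2 ^ t) (Analysis.MaxDeg RT d) (λ _ _ → 0) ops₁ (Analysis.MaxDeg RT a₁) (λ _ _ → ℓ))
               (cert₂ : Potential.Cert RT (2 ^ E) (λ R → ∀ v → R v ≡ false) (λ _ _ → 0) ops₂ (Analysis.MaxDeg RT d) (λ _ _ → w))
               (small : 2 ^ d * 2 ^ d * (2 ^ d * w) * 2 ≤ 2 ^ E) where
  open Algorithm G
  open Correctness G
  open Subtree RT
  open Analysis RT
  open Potential RT

  init : State
  init = (λ _ → false) , (λ _ → true)

  fails : State → Bool
  fails (M , _) = any (peels (suc t) (λ v → not (near2 M v)))

  private
    ops : List Op
    ops = ops₁ ++ ops₂

    q Z₁ Z₂ D : ℕ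
    q = 2 ^ 2 ^ t
    Z₁ = 2 ^ 2 ^ t
    Z₂ = 2 ^ E
    D = 2 ^ d

    pot₁ : State → Fin n → ℕ
    pot₁ = pot Z₁ (λ _ _ → 0)

    phase₂-fails : State → ℕ
    phase₂-fails st = SS ops₂ (λ ω → ⟦ fails (run ops₂ st ω) ⟧)

    -- No vertex was set aside in phase 1, so the uncovered vertices lie in the
    -- active set, on which the degrees are polylogarithmic.
    module Clean (M R : VSet) (R-deg : MaxDeg d R) (clean : ∀ v → near2 M v ≡ false → R v ≡ true) where
      open Branching RT R

      pot₂ : Weight → State → Fin n → ℕ
      pot₂ = pot Z₂

      pot₂≤ : ∀ v → R v ≡ true → pot₂ (λ _ _ → w) (M , R) v ≤ w
      pot₂≤ v p rewrite p with near2 M v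
      ... | true  = z≤n
      ... | false = ≤-refl

      open Upper d R-deg (pot₂ (λ _ _ → w) (M , R)) w Z₂ pot₂≤ small

      Zt : ℕ
      Zt = Z₂ ^ 2 ^ t

      -- A vertex left by the peeling is the root of a tree counted by `Ψ`. Its weights are Z₂
      -- because phase 2 ends without active vertices and the tree consists of uncovered ones.
      trees : ∀ ω → ⟦ fails (run ops₂ (M , R) ω) ⟧ * Zt ≤ ∑ (λ v → ⟦ R v ⟧ * Ψ t (pot₂ (λ _ _ → 0) (run ops₂ (M , R) ω)) v)
      trees ω with fails (run ops₂ (M , R) ω) in eq
      ... | false = z≤n
      ... | true with any⁻ (peels (suc t) (λ v → not (near2 (proj₁ (run ops₂ (M , R) ω)) v))) eq
      ...   | v , p = begin
        1 * Zt                   ≡⟨ *-identityˡ Zt ⟩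
        Zt                       ≤⟨ Ψ-lower Z₂ (pot₂ (λ _ _ → 0) (run ops₂ (M , R) ω)) Q inside t v p ⟩
        ψ v                      ≡⟨ sym (*-identityˡ (ψ v)) ⟩
        1 * ψ v                  ≡⟨ cong (λ b → ⟦ b ⟧ * ψ v) (sym (proj₁ (inside v (peels-⊆ (suc t) Q v p)))) ⟩
        ⟦ R v ⟧ * ψ v            ≤⟨ ≤∑ (λ v → ⟦ R v ⟧ * ψ v) v ⟩
        ∑ (λ v → ⟦ R v ⟧ * ψ v) ∎
        where
        open ≤-Reasoning
        M′ R′ Q : VSet
        M′ = proj₁ (run ops₂ (M , R) ω)
        R′ = proj₂ (run ops₂ (M , R) ω)
        Q v = not (near2 M′ v)
        ψ : Fin n → ℕ
        ψ = Ψ t (pot₂ (λ _ _ → 0) (M′ , R′))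
        inside : ∀ v → Q v ≡ true → R v ≡ true × Z₂ ≤ pot₂ (λ _ _ → 0) (M′ , R′) v
        inside v unc = clean v (¬true λ c → true≢false (near2-mono (run-grows G ops₂ (M , R) ω) v c) (not⁻ unc))
                     , ≤-reflexive (sym (pot-aside Z₂ (λ _ _ → 0) M′ R′ v (not⁻ unc) (cert-end Z₂ cert₂ (M , R) R-deg ω v)))

      few-trees : ∀ v → ⟦ R v ⟧ * (mass n ops₂ * Ψ t (pot₂ (λ _ _ → w) (M , R)) v) * q ≤ mass n ops₂ * Zt
      few-trees v with R v in eq
      ... | false = z≤n
      ... | true  = begin
        1 * (mass n ops₂ * x) * q     ≡⟨ cong (_* q) (*-identityˡ (mass n ops₂ * x)) ⟩
        mass n ops₂ * x * q           ≡⟨ *-assoc (mass n ops₂) x q ⟩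
        mass n ops₂ * (x * q)         ≤⟨ *-monoʳ-≤ (mass n ops₂) (*-monoˡ-≤ q (m≤n*m x (D * D) {{m*n≢0 D D {{D≢0}} {{D≢0}}}})) ⟩
        mass n ops₂ * (D * D * x * q) ≤⟨ *-monoʳ-≤ (mass n ops₂) (Ψ-upper t v eq) ⟩
        mass n ops₂ * Zt ∎
        where
        open ≤-Reasoning
        x : ℕ
        x = Ψ t (pot₂ (λ _ _ → w) (M , R)) v
        D≢0 : Data.Nat.NonZero D
        D≢0 = m^n≢0 2 d

      clean-bound : phase₂-fails (M , R) * q ≤ mass n ops₂ * n
      clean-bound = *-cancelʳ-≤ _ _ Zt {{m^n≢0 Z₂ (2 ^ t) {{m^n≢0 2 E}}}} (begin
        phase₂-fails (M , R) * q * Zt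
          ≡⟨ eq₁ (phase₂-fails (M , R)) q Zt ⟩
        phase₂-fails (M , R) * Zt * q
          ≡⟨ cong (_* q) (sym (SS-*ʳ ops₂ (λ ω → ⟦ fails (run ops₂ (M , R) ω) ⟧) Zt)) ⟩
        SS ops₂ (λ ω → ⟦ fails (run ops₂ (M , R) ω) ⟧ * Zt) * q
          ≤⟨ *-monoˡ-≤ q (SS-mono ops₂ trees) ⟩
        SS ops₂ (λ ω → ∑ (λ v → ⟦ R v ⟧ * ψ ω v)) * q
          ≡⟨ cong (_* q) (SS-∑ ops₂ (λ v ω → ⟦ R v ⟧ * ψ ω v)) ⟩
        ∑ (λ v → SS ops₂ (λ ω → ⟦ R v ⟧ * ψ ω v)) * q
          ≤⟨ *-monoˡ-≤ q (∑-mono averaged) ⟩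
        ∑ (λ v → ⟦ R v ⟧ * (mass n ops₂ * Ψ t (pot₂ (λ _ _ → w) (M , R)) v)) * q
          ≡⟨ sym (∑-*ʳ (λ v → ⟦ R v ⟧ * (mass n ops₂ * Ψ t (pot₂ (λ _ _ → w) (M , R)) v)) q) ⟩
        ∑ (λ v → ⟦ R v ⟧ * (mass n ops₂ * Ψ t (pot₂ (λ _ _ → w) (M , R)) v) * q)
          ≤⟨ ∑-mono few-trees ⟩
        ∑ {n} (λ v → mass n ops₂ * Zt)
          ≡⟨ ∑-const n (mass n ops₂ * Zt) ⟩
        n * (mass n ops₂ * Zt)
          ≡⟨ eq₂ n (mass n ops₂) Zt ⟩
        mass n ops₂ * n * Zt ∎)
        where
        open ≤-Reasoning
        eq₁ : ∀ x y z → x * y * z ≡ x * z * y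
        eq₁ = solve-∀
        eq₂ : ∀ x y z → x * (y * z) ≡ y * x * z
        eq₂ = solve-∀
        ψ : Ω n ops₂ → Fin n → ℕ
        ψ ω = Ψ t (pot₂ (λ _ _ → 0) (run ops₂ (M , R) ω))
        averaged : ∀ v → SS ops₂ (λ ω → ⟦ R v ⟧ * ψ ω v) ≤ ⟦ R v ⟧ * (mass n ops₂ * Ψ t (pot₂ (λ _ _ → w) (M , R)) v)
        averaged v = ≤-trans (≤-reflexive (trans (cong-SS v) (trans (SS-*ʳ ops₂ (λ ω → ψ ω v) ⟦ R v ⟧) (*-comm _ ⟦ R v ⟧))))
          (*-monoʳ-≤ ⟦ R v ⟧ (cert-bound Z₂ (Ψ-admissible t v) cert₂ (M , R) R-deg))
          where
          cong-SS : ∀ v → SS ops₂ (λ ω → ⟦ R v ⟧ * ψ ω v) ≡ SS ops₂ (λ ω → ψ ω v * ⟦ R v ⟧)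
          cong-SS v = ≤-antisym (SS-mono ops₂ (λ ω → ≤-reflexive (*-comm ⟦ R v ⟧ (ψ ω v)))) (SS-mono ops₂ (λ ω → ≤-reflexive (*-comm (ψ ω v) ⟦ R v ⟧)))

    -- If phase 1 left an uncovered vertex set aside, its potential Z₁ = q already pays for the
    -- trivial bound; otherwise `Clean` applies.
    phase₂-bound : ∀ st → MaxDeg d (proj₂ st) → phase₂-fails st * q ≤ mass n ops₂ * (∑ (pot₁ st) + n)
    phase₂-bound (M , R) deg≤ with true? (any (λ v → not (near2 M v) ∧ not (R v)))
    ... | inj₂ none = ≤-trans (Clean.clean-bound M R deg≤ clean) (*-monoʳ-≤ (mass n ops₂) (m≤n+m n _))
      where
      clean : ∀ v → near2 M v ≡ false → R v ≡ true
      clean v p with true? (R v)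
      ... | inj₁ r = r
      ... | inj₂ r = ⊥-elim (true≢false (any⁺ (λ v → not (near2 M v) ∧ not (R v)) v (∧⁺ (cong not p) (cong not r))) none)
    ... | inj₁ some with any⁻ (λ v → not (near2 M v) ∧ not (R v)) some
    ...   | v , p = *-mono-≤ trivial (≤-trans (≤-trans (≤-reflexive (sym here′)) (≤∑ (pot₁ (M , R)) v)) (m≤m+n _ n))
      where
      trivial : phase₂-fails (M , R) ≤ mass n ops₂
      trivial = ≤-trans (SS-mono ops₂ (λ ω → ⟦⟧≤1 (fails (run ops₂ (M , R) ω)))) (≤-reflexive (trans (SS-const ops₂ 1) (*-identityʳ _)))
      here′ : pot₁ (M , R) v ≡ Z₁
      here′ = pot-aside Z₁ (λ _ _ → 0) M R v (not⁻ (proj₁ (∧⁻ p))) (not⁻ (proj₂ (∧⁻ {not (near2 M v)} p)))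

    deg≤n : ∀ R v → deg R v ≤ n
    deg≤n R v = ≤-trans (∑-mono (λ w → ⟦⟧≤1 (adj G v w ∧ R w))) (≤-reflexive (trans (∑-const n 1) (*-identityʳ n)))

    start-deg : MaxDeg a₁ (λ _ → true)
    start-deg v _ = ≤-trans (deg≤n (λ _ → true) v) n≤

    end-deg : ∀ ω → MaxDeg d (proj₂ (run ops₁ init ω))
    end-deg ω = cert-end Z₁ cert₁ init start-deg ω

    start-pot : ∀ v → pot Z₁ (λ _ _ → ℓ) init v ≤ ℓ
    start-pot v with near2 (λ _ → false) v
    ... | true  = z≤n
    ... | false = ≤-refl

  -- Summed over the n vertices, phase 1 contributes ℓ each and the trees of phase 2 contribute 1
  -- each.
  fails-bound : SS ops (λ ω → ⟦ fails (run ops init ω) ⟧) * q ≤ mass n ops * (n * suc ℓ)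
  fails-bound = begin
    SS ops (λ ω → ⟦ fails (run ops init ω) ⟧) * q
      ≡⟨ cong (_* q) (SS-run-++ G ops₁ ops₂ init (λ st → ⟦ fails st ⟧)) ⟩
    SS ops₁ (λ ω → phase₂-fails (run ops₁ init ω)) * q
      ≡⟨ sym (SS-*ʳ ops₁ (λ ω → phase₂-fails (run ops₁ init ω)) q) ⟩
    SS ops₁ (λ ω → phase₂-fails (run ops₁ init ω) * q)
      ≤⟨ SS-mono ops₁ (λ ω → ≤-trans (phase₂-bound (run ops₁ init ω) (end-deg ω)) (≤-reflexive (*-comm (mass n ops₂) _))) ⟩
    SS ops₁ (λ ω → (∑ (pot₁ (run ops₁ init ω)) + n) * mass n ops₂)
      ≡⟨ SS-*ʳ ops₁ (λ ω → ∑ (pot₁ (run ops₁ init ω)) + n) (mass n ops₂) ⟩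
    SS ops₁ (λ ω → ∑ (pot₁ (run ops₁ init ω)) + n) * mass n ops₂
      ≡⟨ cong (_* mass n ops₂) (trans (SS-+ ops₁ (λ ω → ∑ (pot₁ (run ops₁ init ω))) (λ _ → n))
           (cong₂ _+_ (SS-∑ ops₁ (λ v ω → pot₁ (run ops₁ init ω) v)) (SS-const ops₁ n))) ⟩
    (∑ (λ v → SS ops₁ (λ ω → pot₁ (run ops₁ init ω) v)) + mass n ops₁ * n) * mass n ops₂
      ≤⟨ *-monoˡ-≤ (mass n ops₂) (+-monoˡ-≤ (mass n ops₁ * n) (∑-mono (λ v →
           ≤-trans (cert-bound Z₁ (at-admissible v) cert₁ init start-deg) (*-monoʳ-≤ (mass n ops₁) (start-pot v))))) ⟩
    (∑ {n} (λ v → mass n ops₁ * ℓ) + mass n ops₁ * n) * mass n ops₂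
      ≡⟨ cong (λ x → (x + mass n ops₁ * n) * mass n ops₂) (∑-const n (mass n ops₁ * ℓ)) ⟩
    (n * (mass n ops₁ * ℓ) + mass n ops₁ * n) * mass n ops₂
      ≡⟨ eq n (mass n ops₁) ℓ (mass n ops₂) ⟩
    mass n ops₁ * mass n ops₂ * (n * suc ℓ)
      ≡⟨ cong (_* (n * suc ℓ)) (sym (mass-++ n ops₁ ops₂)) ⟩
    mass n ops * (n * suc ℓ) ∎
    where
    open ≤-Reasoning
    eq : ∀ n x l y → (n * (x * l) + x * n) * y ≡ x * y * (n * (1 + l))
    eq = solve-∀

-- Round complexity and the theorem

n<2^[1+log] : ∀ n → n < 2 ^ suc ⌊log₂ n ⌋
n<2^[1+log] n = ≰⇒> λ h → 1+n≰n (≤-trans (≤-reflexive (sym (⌊log₂[2^n]⌋≡n (suc ⌊log₂ n ⌋)))) (⌊log₂⌋-mono-≤ h))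

loglog : ℕ → ℕ
loglog n = ⌊log₂ ⌊log₂ n ⌋ ⌋

n≤2^2^[1+loglog] : ∀ n → n ≤ 2 ^ 2 ^ suc (loglog n)
n≤2^2^[1+loglog] n = ≤-trans (<⇒≤ (n<2^[1+log] n)) (^-monoʳ-≤ 2 (n<2^[1+log] ⌊log₂ n ⌋))

-- Bit lengths of the Cole–Vishkin colours after k rounds, starting from identifiers of 2^(1+ℓ) bits.
module Widths (ℓ : ℕ) where
  -- From w ≥ 4 bits each round is credited with a single bit, by 2w ≤ 2^(w-1); this reaches 3 bits
  -- within the O(ℓ) rounds available.
  next : ℕ → ℕ
  next (suc (suc (suc (suc w)))) = 3 + w
  next w                         = w

  width : ℕ → ℕ
  width zero          = 2 ^ suc ℓ
  -- The first round is exact: 2 * 2^(ℓ+1) = 2^(ℓ+2).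
  width (suc zero)    = suc (suc ℓ)
  width (suc (suc k)) = next (width (suc k))

  private
    4+≤ : ∀ w → 4 + w ≤ 2 ^ (2 + w)
    4+≤ zero    = ≤-refl
    4+≤ (suc w) = ≤-trans (+-mono-≤ {1} (m^n>0 2 (2 + w)) (4+≤ w)) (≤-reflexive (cong (2 ^ (2 + w) +_) (sym (+-identityʳ (2 ^ (2 + w))))))

    next-ok : ∀ w → 1 ≤ w → 1 ≤ next w × next w ≤ w × 2 * w ≤ 2 ^ next w
    next-ok 1 _ = s≤s z≤n , ≤-refl , ≤-refl
    next-ok 2 _ = s≤s z≤n , ≤-refl , ≤-refl
    next-ok 3 _ = s≤s z≤n , ≤-refl , m≤m+n 6 2
    next-ok (suc (suc (suc (suc w)))) _ = s≤s z≤n , n≤1+n (3 + w) , *-monoʳ-≤ 2 (4+≤ w)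

    later-≥ : ∀ k → 1 ≤ width (suc k)
    later-≥ zero    = s≤s z≤n
    later-≥ (suc k) = proj₁ (next-ok (width (suc k)) (later-≥ k))

    later-≤ : ∀ k → width (suc k) ≤ suc (suc ℓ)
    later-≤ zero    = ≤-refl
    later-≤ (suc k) = ≤-trans (proj₁ (proj₂ (next-ok (width (suc k)) (later-≥ k)))) (later-≤ k)

  width-≥ : ∀ k → 1 ≤ width k
  width-≥ zero    = m^n>0 2 (suc ℓ)
  width-≥ (suc k) = later-≥ k

  width-≤ : ∀ k → width k ≤ 2 ^ suc ℓ
  width-≤ zero    = ≤-refl
  width-≤ (suc k) = ≤-trans (later-≤ k) (n<2^n (suc ℓ))

  width-suc : ∀ k → 2 * width k ≤ 2 ^ width (suc k)
  width-suc zero    = ≤-refl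
  width-suc (suc k) = proj₂ (proj₂ (next-ok (width (suc k)) (later-≥ k)))

  private
    drops : ∀ k → width (suc k) ≤ 3 ⊎ width (suc k) + k ≤ suc (suc ℓ)
    drops zero    = inj₂ (≤-reflexive (+-identityʳ _))
    drops (suc k) with width (suc k) | drops k
    ... | w | inj₁ p = inj₁ (stays w p)
      where
      stays : ∀ w → w ≤ 3 → next w ≤ 3
      stays 0 p = p
      stays 1 p = p
      stays 2 p = p
      stays 3 p = p
      stays (suc (suc (suc (suc w)))) p = ≤-trans (n≤1+n (3 + w)) p
    ... | 0 | inj₂ p = inj₁ z≤n
    ... | 1 | inj₂ p = inj₁ (s≤s z≤n)
    ... | 2 | inj₂ p = inj₁ (s≤s (s≤s z≤n))
    ... | 3 | inj₂ p = inj₁ ≤-refl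
    ... | suc (suc (suc (suc w))) | inj₂ p = inj₂ (≤-trans (≤-reflexive (+-suc (3 + w) k)) p)

  width-end : width (suc ℓ) ≤ 3
  width-end with drops ℓ
  ... | inj₁ p = p
  ... | inj₂ p = ≤-trans (+-cancelʳ-≤ ℓ _ 2 p) (s≤s (s≤s z≤n))

length-iterate : ∀ a s T rest → length (iterate a s T rest) ≡ 2 * T + length rest
length-iterate a s zero    rest = refl
length-iterate a s (suc T) rest = trans (cong (2 +_) (length-iterate a s T rest)) (cong (_+ length rest) (sym (*-suc 2 T)))

length-lastOps : ∀ a T → length (lastOps a T) ≡ suc T
length-lastOps a zero    = refl
length-lastOps a (suc T) = cong suc (length-lastOps a T)

module Main (a′ : ℕ) (a≥ : 16 ≤ suc a′) where

  module _ (ℓ : ℕ) where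
    open Schedule ℓ a′ a≥

    private
      length-phase₁ : ∀ i → length (phase₁ i) ≡ 3 * i
      length-phase₁ zero    = refl
      length-phase₁ (suc i) = trans (cong (3 +_) (length-phase₁ i)) (sym (*-suc 3 i))

      double-half : ∀ x → ⌈ x /2⌉ + ⌈ x /2⌉ ≤ suc x
      double-half zero          = z≤n
      double-half (suc zero)    = ≤-refl
      double-half (suc (suc x)) = s≤s (≤-trans (≤-reflexive (+-suc ⌈ x /2⌉ ⌈ x /2⌉)) (s≤s (double-half x)))

      -- Amortisation of the geometric sum: a new level takes twice its number of iterations, and up
      -- to rounding this is what the summand 2 * `T₂ i` loses. The rounding goes into 3 * i.
      length-phase₂ : ∀ i → length (phase₂ i) + 2 * T₂ i ≤ 4 * Y + 2 + Tₗ + 3 * i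
      length-phase₂ zero = ≤-reflexive (trans (cong (_+ 2 * Y) (trans (length-iterate 18 9 Y _) (cong (λ z → 2 * Y + suc z) (length-lastOps (suc a′) Tₗ)))) (eq Y Tₗ))
        where
        eq : ∀ Y T → 2 * Y + (1 + (1 + T)) + 2 * Y ≡ 4 * Y + 2 + T + 0
        eq = solve-∀
      length-phase₂ (suc i) = begin
        length (phase₂ (suc i)) + 2 * h                 ≡⟨ cong (_+ 2 * h) (length-iterate _ _ h _) ⟩
        2 * h + suc (length (phase₂ i)) + 2 * h         ≡⟨ eq₁ h (length (phase₂ i)) ⟩
        suc (length (phase₂ i)) + 2 * (h + h)           ≤⟨ +-monoʳ-≤ (suc (length (phase₂ i))) (*-monoʳ-≤ 2 (double-half (T₂ i))) ⟩
        suc (length (phase₂ i)) + 2 * suc (T₂ i)        ≡⟨ eq₂ (length (phase₂ i)) (T₂ i) ⟩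
        length (phase₂ i) + 2 * T₂ i + 3                ≤⟨ +-monoˡ-≤ 3 (length-phase₂ i) ⟩
        4 * Y + 2 + Tₗ + 3 * i + 3                      ≡⟨ eq₃ (4 * Y + 2 + Tₗ) i ⟩
        4 * Y + 2 + Tₗ + 3 * suc i ∎
        where
        open ≤-Reasoning
        h : ℕ
        h = ⌈ T₂ i /2⌉
        eq₁ : ∀ h L → 2 * h + (1 + L) + 2 * h ≡ 1 + L + 2 * (h + h)
        eq₁ = solve-∀
        eq₂ : ∀ L T → 1 + L + 2 * (1 + T) ≡ L + 2 * T + 3
        eq₂ = solve-∀
        eq₃ : ∀ x i → x + 3 * i + 3 ≡ x + 3 * (1 + i)
        eq₃ = solve-∀

    κ slope : ℕ
    κ = suc (odds y)
    slope = (6 + (4 + κ) * 7) * 4 + 2 + ((8 + (4 + κ) * 71) * 4 + (7 + length palette))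

    rounds-bound : 1 ≤ ℓ → rounds ops (suc t) K ≤ slope * ℓ
    rounds-bound 1≤ℓ = begin
      length ops * 4 + (2 + (suc t + (K + (length palette + 0))))
        ≤⟨ +-monoˡ-≤ _ (*-monoˡ-≤ 4 len) ⟩
      (3 * ℓ + (4 * Y + 2 + Tₗ + 3 * (2 + ℓ))) * 4 + (2 + (suc t + (K + (length palette + 0))))
        ≡⟨ eq ℓ κ (length palette) ⟩
      A * ℓ + B
        ≤⟨ +-monoʳ-≤ (A * ℓ) (m≤m*n B ℓ {{Data.Nat.>-nonZero 1≤ℓ}}) ⟩
      A * ℓ + B * ℓ
        ≡⟨ sym (*-distribʳ-+ ℓ A B) ⟩
      slope * ℓ ∎
      where
      open ≤-Reasoning
      A B : ℕ
      A = (6 + (4 + κ) * 7) * 4 + 2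
      B = (8 + (4 + κ) * 71) * 4 + (7 + length palette)
      eq : ∀ l k p → (3 * l + (4 * (l * 7 + 71) + 2 + k * (l * 7 + 71) + 3 * (2 + l))) * 4 + (2 + (1 + (l + 3) + (1 + l + (p + 0))))
                     ≡ ((6 + (4 + k) * 7) * 4 + 2) * l + ((8 + (4 + k) * 71) * 4 + (7 + p))
      eq = solve-∀
      len : length ops ≤ 3 * ℓ + (4 * Y + 2 + Tₗ + 3 * (2 + ℓ))
      len = ≤-trans (≤-reflexive (trans (length-++ (phase₁ ℓ)) (cong (_+ length (phase₂ (2 + ℓ))) (length-phase₁ ℓ))))
                    (+-monoʳ-≤ (3 * ℓ) (≤-trans (m≤m+n _ (2 * T₂ (2 + ℓ))) (length-phase₂ (2 + ℓ))))

    module _ {n : ℕ} (G : Graph n) (tree : IsTree G) (n≤ : n ≤ 2 ^ 2 ^ suc ℓ) where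
      open Algorithm G
      private
        RT : Rooted G
        RT = root-tree G tree

        d a₁ : ℕ
        d = suc (s₁ 0) + suc (s₁ 0)
        a₁ = suc (s₁ ℓ) + suc (s₁ ℓ)

        open Schedule.Bounds ℓ a′ a≥ RT

        d≡ : 9 + (2 + ℓ) + (9 + (2 + ℓ)) ≡ d
        d≡ = eq ℓ
          where
          eq : ∀ l → 9 + (2 + l) + (9 + (2 + l)) ≡ 1 + (l + 9 + 1) + (1 + (l + 9 + 1))
          eq = solve-∀

        n≤a₁ : n ≤ 2 ^ a₁
        n≤a₁ = ≤-trans n≤ (^-monoʳ-≤ 2 (+-mono-≤ le (≤-trans (≤-reflexive (+-identityʳ (2 ^ ℓ))) le)))
          where
          le : 2 ^ ℓ ≤ suc (s₁ ℓ)
          le = ≤-trans (m≤n+m (2 ^ ℓ) (ℓ + 9)) (n≤1+n _)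

        open Failure G RT t ℓ E d a₁ ((2 + (2 + ℓ)) * u) (phase₁ ℓ) (phase₂ (2 + ℓ)) n≤a₁ (cert₁ ℓ)
               (subst (λ d → Potential.Cert RT (2 ^ E) (λ R → ∀ v → R v ≡ false) (λ _ _ → 0) (phase₂ (2 + ℓ)) (Analysis.MaxDeg RT d) (λ _ _ → (2 + (2 + ℓ)) * u)) d≡ (cert₂ (2 + ℓ)))
               (subst (λ d → 2 ^ d * 2 ^ d * (2 ^ d * ((2 + (2 + ℓ)) * u)) * 2 ≤ 2 ^ E) d≡ small)

        q P x : ℕ
        q = 2 ^ 2 ^ t
        P = 2 ^ 2 ^ suc ℓ
        x = SS ops (λ ω → ⟦ fails (run ops init ω) ⟧)

        fourth : P * P * (P * P) ≡ q
        fourth = trans (cong₂ _*_ (sym (^-distribˡ-+-* 2 e e)) (sym (^-distribˡ-+-* 2 e e)))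
          (trans (sym (^-distribˡ-+-* 2 (e + e) (e + e))) (cong (2 ^_) (trans (eq (2 ^ ℓ)) (sym (^-distribˡ-+-* 2 ℓ 3)))))
          where
          e : ℕ
          e = 2 ^ suc ℓ
          eq : ∀ z → 2 * z + 2 * z + (2 * z + 2 * z) ≡ z * 8
          eq = solve-∀

        -- n^3 * (ℓ+1) ≤ P^4 = q, so the failure probability n * (ℓ+1) / q is at most n^-2.
        fails-rare : x * (n * n) ≤ mass n ops
        fails-rare = *-cancelʳ-≤ _ _ q {{m^n≢0 2 (2 ^ t)}} (begin
          x * (n * n) * q                        ≡⟨ eq₁ x (n * n) q ⟩
          x * q * (n * n)                        ≤⟨ *-monoˡ-≤ (n * n) fails-bound ⟩
          mass n ops * (n * suc ℓ) * (n * n)     ≡⟨ *-assoc (mass n ops) (n * suc ℓ) (n * n) ⟩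
          mass n ops * (n * suc ℓ * (n * n))     ≤⟨ *-monoʳ-≤ (mass n ops) (*-mono-≤ (*-mono-≤ n≤ ℓ≤) (*-mono-≤ n≤ n≤)) ⟩
          mass n ops * (P * P * (P * P))         ≡⟨ cong (mass n ops *_) fourth ⟩
          mass n ops * q ∎)
          where
          open ≤-Reasoning
          eq₁ : ∀ x y z → x * y * z ≡ x * z * y
          eq₁ = solve-∀
          ℓ≤ : suc ℓ ≤ P
          ℓ≤ = <⇒≤ (<-trans (n<2^n (suc ℓ)) (n<2^n (2 ^ suc ℓ)))

        open Widths ℓ

        ruling : ∀ r → fails (run ops init (decode ops r)) ≡ false → IsRulingSet 2 G (algorithm ops (suc t) F K G r)
        ruling r ok = Correctness.Finish.finish-ruling G (suc t) F K n≤ width refl width-≤ width-≥ width-suc width-end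
          (proj₁ (run ops init (decode ops r)))
          (Correctness.run-valid G ops init (decode ops r) ((λ _ _ _ → λ { (() , _) }) , unc))
          (λ v → ¬true λ p → true≢false (any⁺ (peels (suc t) (λ v → not (near2 (proj₁ (run ops init (decode ops r))) v))) v p) ok)
          where
          unc : ∀ v → true ≡ true → near2 (λ _ → false) v ≡ false
          unc v _ = ¬true λ p → case Correctness.near2-cover G (λ _ → false) v p of λ { (_ , () , _) }

      algorithm-whp : SucceedsWHP 2 1 (algorithm ops (suc t) F K) G (IsRulingSet 2)
      algorithm-whp = whp (algorithm ops (suc t) F K) G (IsRulingSet 2) (λ r → fails (run ops init (decode ops r))) ruling
        (subst (λ z → z * (n * n) ≤ size ops ^ n) (sym (V-decode ops (λ ω → ⟦ fails (run ops init ω) ⟧)))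
          (≤-trans fails-rare (≤-reflexive (mass≡ n ops))))

-- Kept abstract so that 2^(a₀ + 7) is never evaluated.
abstract
  a₀ : ℕ
  a₀ = 15

  a₀≥ : 16 ≤ suc a₀
  a₀≥ = ≤-refl

theorem1 : Σ (ℕ → ℕ) λ m → Σ (ℕ → ℕ) λ T → Σ ((n : ℕ) → RandAlg n (m n)) λ A →
    (∀ n → 1 ≤ m n) ×
    (∀ n → IsLocal (T n) (A n)) ×
    (Σ ℕ λ C → Σ ℕ λ n₀ → ∀ n → n₀ ≤ n → T n ≤ C * ⌊log₂ ⌊log₂ n ⌋ ⌋) ×
    (Σ ℕ λ p → Σ ℕ λ q → (0 < q) × (q < p) ×
    (∀ n (G : Graph n) → IsTree G → SucceedsWHP p q (A n) G (IsRulingSet 2)))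
theorem1 = (λ n → size (ops (loglog n))) , (λ n → rounds (ops (loglog n)) (suc (t (loglog n))) (K (loglog n))) ,
  (λ n → algorithm (ops (loglog n)) (suc (t (loglog n))) (F (loglog n)) (K (loglog n))) ,
  (λ n → size≥1 (ops (loglog n))) ,
  (λ n → algorithm-local (ops (loglog n)) (suc (t (loglog n))) (F (loglog n)) (K (loglog n))) ,
  -- The value of `slope` is the same at every argument, so 0 serves for all n. From n = 4 on, the
  -- iterated logarithm is at least 1 and absorbs the additive constant.
  (slope 0 , 4 , λ n 4≤n → rounds-bound (loglog n) (1≤loglog n 4≤n)) ,
  2 , 1 , s≤s z≤n , s≤s (s≤s z≤n) , λ n G tree → algorithm-whp (loglog n) G tree (n≤2^2^[1+loglog] n)
  where
  open module Sch ℓ = Schedule ℓ a₀ a₀≥ using (ops; t; K; F)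
  open Main a₀ a₀≥
  1≤loglog : ∀ n → 4 ≤ n → 1 ≤ loglog n
  1≤loglog n h = ≤-trans (≤-reflexive (sym (⌊log₂[2^n]⌋≡n 1)))
    (⌊log₂⌋-mono-≤ (≤-trans (≤-reflexive (sym (⌊log₂[2^n]⌋≡n 2))) (⌊log₂⌋-mono-≤ h)))
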